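{- Let $P$ be an $n$-dimensional lattice polytope in $\mathbb{R}^n$ of degree $d$. Then $P$ decomposes as a Cayley sum of lattice polytopes in $\mathbb{R}^q$ for some $q \leq (d^2 + 19d - 4)/2$.
   Context: A lattice polytope is the convex hull of finitely many lattice points. For an $n$-dimensional lattice polytope $P\subset\mathbb{R}^n$, write $\sum_{m\ge0}|mP\cap\mathbb{Z}^n|t^m = h^*_P(t)/(1-t)^{n+1}$ with $h^*_P$ a polynomial; the degree $d$ of $P$ is the degree of $h^*_P$. Equivalently, $d$ is the largest nonnegative integer such that $(n-d)P$ has no lattice points in its (relative) interior. If $P_0,\dots,P_s$ are lattice polytopes in $\mathbb{R}^q$, their Cayley sum $P_0*\cdots*P_s$ is the convex hull of $(P_0\times 0)\cup(P_1\times e_1)\cup\cdots\cup(P_s\times e_s)$ in $\mathbb{R}^q\times\mathbb{R}^s$, where $e_1,\dots,e_s$ is the standard basis of $\mathbb{R}^s$. $P$ decomposes as a Cayley sum of lattice polytopes in $\mathbb{R}^q$ if there is an affine isomorphism $\mathbb{R}^n\cong\mathbb{R}^q\times\mathbb{R}^s$ mapping $\mathbb{Z}^n$ onto $\mathbb{Z}^q\times\mathbb{Z}^s$ and identifying $P$ with $P_0*\cdots*P_s$ for some lattice polytopes $P_0,\dots,P_s\subset\mathbb{R}^q$.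
   Formalization: For d = 0 the stated bound is -2, which fails (e.g. for a unimodular simplex); there the bound is read as 0, so q = 0 is proved, and for d ≥ 1 it is as stated; real space is represented by its rational points, which is equivalent for lattice polytopes. -}

module Defs where

open import Level using (0ℓ)
open import Data.Nat.Base as ℕ using (ℕ; zero; suc)
open import Data.Integer.Base as ℤ using (ℤ; +_; 0ℤ; 1ℤ; -1ℤ)
import Data.Integer.Properties as ℤ
open import Data.Rational.Base using (ℚ; 0ℚ; 1ℚ; _/_; _+_; _*_; _≤_)
import Data.Rational.Properties as ℚ
open import Data.Fin.Base using (Fin; zero; suc; toℕ)
open import Data.Fin.Properties using (_≟_)
open import Data.Vec.Functional using (Vector; replicate; _++_)
open import Data.Product.Base using (Σ; ∃-syntax; _×_; _,_; proj₁)
open import Data.Bool.Base using (if_then_else_)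
open import Function.Bundles using (_⇔_; Bijection)
open import Relation.Binary.Bundles using (Setoid)
import Relation.Binary.Construct.On as On
open import Relation.Binary.PropositionalEquality
  using (_≡_; _≢_; _≗_; _→-setoid_; setoid)
open import Relation.Nullary.Decidable using (does)
open import Relation.Unary using (Pred; _∈_)

open import Algebra.Properties.CommutativeMonoid.Sum ℚ.+-0-commutativeMonoid
  using (sum)
open import Algebra.Properties.CommutativeMonoid.Sum ℤ.+-0-commutativeMonoid
  using () renaming (sum to sumℤ)

------------------------------------------------------------------------
-- Points and hulls
--
-- Euclidean space is represented by its rational points: ℚⁿ plays the
-- role of ℝⁿ.  A lattice polytope is determined by its rational points,
-- and an affine map taking ℤⁿ to ℤᵐ has integral coefficients, so
-- dimension, lattice-point counts and Cayley decompositions do not depend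
-- on which of the two ordered fields is used.

Point : ℕ → Set
Point n = Vector ℚ n

LatticePoint : ℕ → Set
LatticePoint n = Vector ℤ n

ι : ∀ {n} → LatticePoint n → Point n
ι v j = v j / 1

record AffineCombination {n} (S : Pred (Point n) 0ℓ) (x : Point n) : Set where
  field
    size     : ℕ
    points   : Vector (Point n) size
    weights  : Vector ℚ size
    inside   : ∀ i → points i ∈ S
    total    : sum weights ≡ 1ℚ
    combines : ∀ j → x j ≡ sum (λ i → weights i * points i j)

affineHull : ∀ {n} → Pred (Point n) 0ℓ → Pred (Point n) 0ℓ
affineHull = AffineCombination

convexHull : ∀ {n} → Pred (Point n) 0ℓ → Pred (Point n) 0ℓ
convexHull S x =
  Σ (AffineCombination S x) λ c → ∀ i → 0ℚ ≤ AffineCombination.weights c i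

------------------------------------------------------------------------
-- Lattice polytopes

-- Nonempty, presented by a generating family that may contain repetitions
-- and points that are not vertices.
record LatticePolytope (n : ℕ) : Set where
  field
    pred-size  : ℕ
    generators : Vector (LatticePoint n) (suc pred-size)

body : ∀ {n} → LatticePolytope n → Pred (Point n) 0ℓ
body P = convexHull λ x → ∃[ i ] x ≗ ι (LatticePolytope.generators P i)

-- An n-dimensional polytope in n-space.
FullDimensional : ∀ {n} → LatticePolytope n → Set
FullDimensional P = ∀ x → x ∈ affineHull (body P)

dilate : ∀ {n} → ℕ → Pred (Point n) 0ℓ → Pred (Point n) 0ℓ
dilate m S x = ∃[ y ] y ∈ S × x ≗ λ j → (+ m / 1) * y j

------------------------------------------------------------------------
-- Ehrhart series and degree

-- mP ∩ ℤⁿ; a lattice point is counted once, no matter in how many ways it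
-- is a convex combination.
latticePoints : ∀ {n} → LatticePolytope n → ℕ → Setoid 0ℓ 0ℓ
latticePoints {n} P m =
  On.setoid (Fin n →-setoid ℤ)
    (proj₁ {B = λ (v : LatticePoint n) → ι v ∈ dilate m (body P)})

HasCardinality : Setoid 0ℓ 0ℓ → ℕ → Set
HasCardinality A k = Bijection (setoid (Fin k)) A

-- Formal power series over ℤ, as coefficient sequences.
Series : Set
Series = ℕ → ℤ

_⊛_ : Series → Series → Series
(f ⊛ g) m = sumℤ {suc m} λ i → f (toℕ i) ℤ.* g (m ℕ.∸ toℕ i)

one : Series
one zero    = 1ℤ
one (suc _) = 0ℤ

1-t : Series
1-t 0             = 1ℤ
1-t 1             = -1ℤ
1-t (suc (suc _)) = 0ℤ

_^ˢ_ : Series → ℕ → Series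
f ^ˢ zero  = one
f ^ˢ suc k = f ⊛ (f ^ˢ k)

PolynomialOfDegree : Series → ℕ → Set
PolynomialOfDegree h d = h d ≢ 0ℤ × (∀ j → d ℕ.< j → h j ≡ 0ℤ)

-- The equation Σ |mP ∩ ℤⁿ| tᵐ = h*(t) / (1 - t)ⁿ⁺¹ is stated with the
-- denominator cleared.  The count is a field because the bijections with
-- the lattice points are data here.
record HasDegree {n} (P : LatticePolytope n) (d : ℕ) : Set where
  field
    count    : ℕ → ℕ
    counts   : ∀ m → HasCardinality (latticePoints P m) (count m)
    h*       : Series
    ehrhart  : ((1-t ^ˢ suc n) ⊛ (λ m → + count m)) ≗ h*
    h*-degree : PolynomialOfDegree h* d

------------------------------------------------------------------------
-- Cayley sums

-- The apexes 0, e₁, …, eₛ over which the factors P₀, …, Pₛ are placed.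
apex : ∀ {s} → Fin (suc s) → Point s
apex zero    = replicate _ 0ℚ
apex (suc i) = λ j → if does (i ≟ j) then 1ℚ else 0ℚ

-- ℚ^(q + s) is ℚ^q × ℚ^s via concatenation.
cayleySum : ∀ {q s} → (Fin (suc s) → LatticePolytope q) → Pred (Point (q ℕ.+ s)) 0ℓ
cayleySum Ps =
  convexHull λ z → ∃[ i ] ∃[ x ] x ∈ body (Ps i) × z ≗ (x ++ apex i)

record AffineMap (m n : ℕ) : Set where
  field
    matrix      : Fin n → Fin m → ℚ
    translation : Point n

  apply : Point m → Point n
  apply x i = sum (λ j → matrix i j * x j) + translation i

open AffineMap using (apply)

record AffineIsomorphism (m n : ℕ) : Set where
  field
    to      : AffineMap m n
    from    : AffineMap n m
    from∘to : ∀ x → apply from (apply to x) ≗ x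
    to∘from : ∀ y → apply to (apply from y) ≗ y

MapsLatticeOnto : ∀ {m n} → AffineMap m n → Set
MapsLatticeOnto f =
  (∀ v → ∃[ w ] apply f (ι v) ≗ ι w) × (∀ w → ∃[ v ] apply f (ι v) ≗ ι w)

record CayleyDecomposition {n} (P : LatticePolytope n) (q : ℕ) : Set where
  field
    s         : ℕ
    factors   : Fin (suc s) → LatticePolytope q
    iso       : AffineIsomorphism n (q ℕ.+ s)
    lattice   : MapsLatticeOnto (AffineIsomorphism.to iso)
    identifies : ∀ x →
      x ∈ body P ⇔ apply (AffineIsomorphism.to iso) x ∈ cayleySum factors

{-# OPTIONS --safe #-}
module Submission where

-- Lift the generators gⱼ of P to (1, gⱼ) and let C be the cone they span.
--
-- A lattice point of height k in the interior of C satisfies n + 1 ≤ k + d: the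
-- optimal bases of a lexicographic linear program triangulate C, an infinitesimal
-- perturbation makes the simplices half-open and disjoint, and so h*ₖ counts
-- the box points of height k; reflecting an interior lattice point of height k in
-- its simplex gives a box point of height at least n + 1 - k.
--
-- Fix a basis v₀, …, vₙ of lifted generators with coordinates λ₀, …, λₙ.  A face
-- that contains a generator w and the vᵢ with λᵢ(w) < 0 contains the vᵢ with
-- λᵢ(w) > 0, and conversely.  Using this greedily produces interior lattice points
-- of small height, so that for all but 3d indices the λᵢ are nonnegative on the
-- generators and no two of them are positive on the same generator.  Exchanging the
-- vertices vᵢ with such an index for generators that maximise λᵢ yields λᵢ ≤ 1.
-- In the new basis a lattice point has at most 2d nonintegral coordinates, since
-- its fractional part and the complement of that are interior lattice points;
-- hence at most 4d coordinates are not integral on the whole lattice.  The others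
-- take the values 0 and 1 on the generators and define a lattice projection of P
-- onto a unimodular simplex, which gives a Cayley decomposition with q < 7d or q = 0.

-- The hypothesis speaks of a power series, the conclusion of lattice geometry. They meet in one
-- place: a box point of height h makes the coefficient of h* at h nonzero, so h ≤ d. Boundary
-- points are the obstacle, since they lie in several simplices. Infinitesimals are therefore
-- vectors of rational coefficients compared lexicographically, which keeps every test decidable,
-- and termination of the pivoting comes from the finiteness of the set of bases.
--
-- The 3d is a balance. Absorbing ν negative and p positive vertices costs height min(ν + 1, p), at
-- most two thirds of ν + p except when ν = 0 and p = 1. A set B absorbed at height at most 2|B|/3
-- is completed to an interior lattice point by the remaining vertices, so |B| ≤ 2|B|/3 + d. The 4d
-- comes from coding theory: the nonintegral supports of lattice points behave like the words of a
-- linear code, and supports of size at most 2d cover at most twice 2d coordinates. The quadratic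
-- bound enters only at the end, through 7d - 1.

module Development where

  open import Algebra.Bundles using (CommutativeRing)
  import Algebra.Properties.Semiring.Sum as SemiringSum
  open import Data.Bool.Base using (Bool; true; false; if_then_else_; not; _∧_; T; _∨_)
  open import Data.Bool.Properties using (T?)
  open import Data.Empty using (⊥; ⊥-elim)
  open import Data.Fin.Base using (Fin; zero; suc; finToFun; funToFin; toℕ; fromℕ<; _↑ʳ_; _↑ˡ_; splitAt)
  open import Data.Fin.Induction using (spo-wellFounded)
  open import Data.Fin.Properties using (_≟_; suc-injective; any?; all?; finToFun-funToFin; toℕ-fromℕ<; toℕ-injective; toℕ<n; ↑ʳ-injective; splitAt⁻¹-↑ˡ; splitAt⁻¹-↑ʳ)
  open import Data.Integer.Base as ℤ using (ℤ)
  import Data.Integer.Properties as ℤ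
  import Data.Integer.Tactic.RingSolver as ℤsolver
  open import Data.List.Base using (List; []; _∷_; map; _++_; cartesianProduct; allFin; filter)
  open import Data.List.Membership.Propositional using (_∈_)
  open import Data.List.Membership.Propositional.Properties using (∈-allFin; ∈-++⁺ʳ; ∈-cartesianProduct⁺; ∈-filter⁻; ∈-filter⁺)
  open import Data.List.Relation.Unary.Any using (here; there)
  open import Data.Nat.Base as ℕ using (ℕ; zero; suc)
  open import Data.Nat.DivMod using (m/n<m; m/n*n≤m; m*n/n≡m; /-monoˡ-≤)
  open import Data.Nat.Induction using (<-wellFounded)
  import Data.Nat.Properties as ℕ
  import Data.Nat.Tactic.RingSolver as ℕsolver
  open import Data.Product.Base using (Σ; ∃; ∃-syntax; _×_; _,_; proj₁; proj₂)
  open import Data.Rational.Base hiding (NonZero; truncate; floor)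
  import Data.Rational.Properties as ℚ
  import Data.Rational.Unnormalised.Base as ℚᵘ
  import Data.Rational.Unnormalised.Properties as ℚᵘ
  open import Data.Sum.Base using (_⊎_; inj₁; inj₂; reduce; [_,_]′)
  open import Data.Unit.Base using (tt; ⊤)
  import Data.Vec.Functional as Vector
  open import Data.Vec.Functional using (Vector)
  open import Data.Vec.Functional.Properties using (lookup-++ˡ; lookup-++ʳ)
  open import Function.Base using (_∘_; _$_; case_of_)
  open import Function.Bundles using (Bijection; mk⇔)
  open import Induction.WellFounded using (Acc; acc)
  open import Relation.Binary.Definitions using (tri<; tri≈; tri>)
  open import Relation.Binary.PropositionalEquality
  open import Relation.Nullary hiding (Irrelevant)
  open import Relation.Nullary.Decidable using (dec-true; dec-false; does; ¬?; _→-dec_; _⊎-dec_; decidable-stable; ¬¬-excluded-middle; _×-dec_)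
  open import Tactic.RingSolver using (solve-∀)
  open import Tactic.RingSolver.Core.AlmostCommutativeRing using (AlmostCommutativeRing; fromCommutativeRing)
  open import Algebra.Properties.CommutativeMonoid.Sum ℚ.+-0-commutativeMonoid using (sum; sum-cong-≗; ∑-distrib-+; ∑-comm; sum-replicate-zero)
  import Algebra.Properties.CommutativeMonoid.Sum ℤ.+-0-commutativeMonoid as ℤsum
  open import Defs

  ℚring : AlmostCommutativeRing _ _
  ℚring = fromCommutativeRing ℚ.+-*-commutativeRing λ x → dec⇒maybe (0ℚ ℚ.≟ x)

  -- Order on ℚ

  0≤+ : ∀ {a b} → 0ℚ ≤ a → 0ℚ ≤ b → 0ℚ ≤ a + b
  0≤+ {a} {b} p q = subst (_≤ a + b) (ℚ.+-identityˡ 0ℚ) (ℚ.+-mono-≤ p q)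

  0<+ : ∀ {a b} → 0ℚ < a → 0ℚ ≤ b → 0ℚ < a + b
  0<+ {a} {b} p q = subst (_< a + b) (ℚ.+-identityˡ 0ℚ) (ℚ.+-mono-<-≤ p q)

  0≤* : ∀ {a b} → 0ℚ ≤ a → 0ℚ ≤ b → 0ℚ ≤ a * b
  0≤* {a} {b} p q = ℚ.nonNegative⁻¹ (a * b)
    {{ℚ.nonNeg*nonNeg⇒nonNeg a {{nonNegative p}} b {{nonNegative q}}}}

  0<* : ∀ {a b} → 0ℚ < a → 0ℚ < b → 0ℚ < a * b
  0<* {a} {b} p q = ℚ.positive⁻¹ (a * b)
    {{ℚ.pos*pos⇒pos a {{positive p}} b {{positive q}}}}

  neg-pos : ∀ {a} → a < 0ℚ → 0ℚ < - a
  neg-pos p = ℚ.neg-antimono-< p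

  0≤- : ∀ {a b} → a ≤ b → 0ℚ ≤ b - a
  0≤- {a} {b} p = subst (_≤ b - a) (ℚ.+-inverseʳ a) (ℚ.+-monoˡ-≤ (- a) p)

  0≤-⇒≤ : ∀ {a b} → 0ℚ ≤ b - a → a ≤ b
  0≤-⇒≤ {a} {b} p = subst₂ _≤_ (ℚ.+-identityˡ a) (lem a b) (ℚ.+-monoˡ-≤ a p)
    where
    lem : ∀ a b → b - a + a ≡ b
    lem = solve-∀ ℚring

  0<- : ∀ {a b} → a < b → 0ℚ < b - a
  0<- {a} {b} p = subst (_< b - a) (ℚ.+-inverseʳ a) (ℚ.+-monoˡ-< (- a) p)

  0<-⇒< : ∀ {a b} → 0ℚ < b - a → a < b
  0<-⇒< {a} {b} p = subst₂ _<_ (ℚ.+-identityˡ a) (lem a b) (ℚ.+-monoˡ-< a p)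
    where
    lem : ∀ a b → b - a + a ≡ b
    lem = solve-∀ ℚring

  0<1 : 0ℚ < 1ℚ
  0<1 = ℚ.positive⁻¹ 1ℚ

  0≤1 : 0ℚ ≤ 1ℚ
  0≤1 = ℚ.<⇒≤ 0<1

  <⇒≢0 : ∀ {a} → 0ℚ < a → a ≢ 0ℚ
  <⇒≢0 p refl = ℚ.<-irrefl refl p

  inverse : ∀ a → a ≢ 0ℚ → ∃[ b ] a * b ≡ 1ℚ
  inverse a a≢0 = 1/_ a {{≢-nonZero a≢0}} , ℚ.*-inverseʳ a {{≢-nonZero a≢0}}

  *≡0 : ∀ a b → a ≢ 0ℚ → a * b ≡ 0ℚ → b ≡ 0ℚ
  *≡0 a b a≢0 e with inverse a a≢0
  ... | c , ac = trans (trans (sym (ℚ.*-identityˡ b)) (cong (_* b) (sym ac)))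
                  (trans (lem a b c) (trans (cong (_* c) e) (ℚ.*-zeroˡ c)))
    where
    lem : ∀ a b c → a * c * b ≡ a * b * c
    lem = solve-∀ ℚring

  0<-cancelˡ : ∀ {a b} → 0ℚ < a → 0ℚ < a * b → 0ℚ < b
  0<-cancelˡ {a} {b} p q = ℚ.*-cancelˡ-<-nonNeg a {{nonNegative (ℚ.<⇒≤ p)}}
    (subst (_< a * b) (sym (ℚ.*-zeroʳ a)) q)

  inverse-pos : ∀ a → 0ℚ < a → ∃[ b ] 0ℚ < b × a * b ≡ 1ℚ
  inverse-pos a 0<a with inverse a (<⇒≢0 0<a)
  ... | b , e = b , 0<-cancelˡ 0<a (subst (0ℚ <_) (sym e) 0<1) , e

  sign : ∀ a → a < 0ℚ ⊎ 0ℚ ≤ a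
  sign a with ℚ.<-cmp a 0ℚ
  ... | tri< p _ _ = inj₁ p
  ... | tri≈ _ p _ = inj₂ (ℚ.≤-reflexive (sym p))
  ... | tri> _ _ p = inj₂ (ℚ.<⇒≤ p)

  ≤≢⇒< : ∀ {a} → 0ℚ ≤ a → a ≢ 0ℚ → 0ℚ < a
  ≤≢⇒< {a} p q with ℚ.<-cmp a 0ℚ
  ... | tri< r _ _ = ⊥-elim (ℚ.<-irrefl refl (ℚ.<-≤-trans r p))
  ... | tri≈ _ r _ = ⊥-elim (q r)
  ... | tri> _ _ r = r

  by-cases : ∀ {a} {A : Set a} {C : Set} → Dec A → (A → C) → (¬ A → C) → C
  by-cases (yes a) f g = f a
  by-cases (no ¬a) f g = g ¬a

  -- Finite sums

  private
    module S = SemiringSum (CommutativeRing.semiring ℚ.+-*-commutativeRing)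

  opaque
    ∑ : ∀ {n} → Vector ℚ n → ℚ
    ∑ = sum

    ∑≡sum : ∀ {n} (f : Vector ℚ n) → ∑ f ≡ sum f
    ∑≡sum f = refl

    ∑-swap : ∀ {m n} (f : Fin m → Fin n → ℚ) → ∑ (λ i → ∑ (f i)) ≡ ∑ (λ j → ∑ (λ i → f i j))
    ∑-swap = ∑-comm

    sum-cong : ∀ {n} {f g : Vector ℚ n} → (∀ i → f i ≡ g i) → ∑ f ≡ ∑ g
    sum-cong {n} = sum-cong-≗ {n}

    sum-+ : ∀ {n} (f g : Vector ℚ n) → ∑ (λ i → f i + g i) ≡ ∑ f + ∑ g
    sum-+ = ∑-distrib-+

    sum-*ˡ : ∀ {n} c (f : Vector ℚ n) → ∑ (λ i → c * f i) ≡ c * ∑ f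
    sum-*ˡ c f = sym (S.*-distribˡ-sum c f)

    sum-*ʳ : ∀ {n} c (f : Vector ℚ n) → ∑ (λ i → f i * c) ≡ ∑ f * c
    sum-*ʳ c f = sym (S.*-distribʳ-sum c f)

    sum-zero : ∀ {n} {f : Vector ℚ n} → (∀ i → f i ≡ 0ℚ) → ∑ f ≡ 0ℚ
    sum-zero {n} e = trans (sum-cong e) (sum-replicate-zero n)

    sum-neg : ∀ {n} (f : Vector ℚ n) → ∑ (λ i → - f i) ≡ - ∑ f
    sum-neg f = trans (sum-cong λ i → lem (f i)) (trans (sum-*ˡ (- 1ℚ) f) (sym (lem (∑ f))))
      where
      lem : ∀ a → - a ≡ (- 1ℚ) * a
      lem = solve-∀ ℚring

    sum-minus : ∀ {n} (f g : Vector ℚ n) → ∑ (λ i → f i - g i) ≡ ∑ f - ∑ g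
    sum-minus f g = trans (sum-+ f (λ i → - g i)) (cong (∑ f +_) (sum-neg g))

    sum-nonneg : ∀ {n} {f : Vector ℚ n} → (∀ i → 0ℚ ≤ f i) → 0ℚ ≤ ∑ f
    sum-nonneg {zero}  p = ℚ.≤-refl
    sum-nonneg {suc n} p = 0≤+ (p zero) (sum-nonneg (p ∘ suc))

    term≤∑ : ∀ {n} {f : Vector ℚ n} → (∀ i → 0ℚ ≤ f i) → ∀ i → f i ≤ ∑ f
    term≤∑ {suc n} {f} p zero    = 0≤-⇒≤ (subst (0ℚ ≤_) (lem (f zero) (∑ (f ∘ suc))) (sum-nonneg (p ∘ suc)))
      where
      lem : ∀ a b → b ≡ a + b - a
      lem = solve-∀ ℚring
    term≤∑ {suc n} {f} p (suc i) = ℚ.≤-trans (term≤∑ (p ∘ suc) i)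
      (0≤-⇒≤ (subst (0ℚ ≤_) (lem (f zero) (∑ (f ∘ suc))) (p zero)))
      where
      lem : ∀ a b → a ≡ a + b - b
      lem = solve-∀ ℚring

  δ : ∀ {n} → Fin n → Fin n → ℚ
  δ i j = if does (i ≟ j) then 1ℚ else 0ℚ

  δ-refl : ∀ {n} (i : Fin n) → δ i i ≡ 1ℚ
  δ-refl i = cong (if_then 1ℚ else 0ℚ) (dec-true (i ≟ i) refl)

  δ-≢ : ∀ {n} {i j : Fin n} → i ≢ j → δ i j ≡ 0ℚ
  δ-≢ {i = i} {j} p = cong (if_then 1ℚ else 0ℚ) (dec-false (i ≟ j) p)

  δ-sym : ∀ {n} (i j : Fin n) → δ i j ≡ δ j i
  δ-sym i j with i ≟ j
  ... | yes refl = sym (δ-refl i)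
  ... | no p     = sym (δ-≢ (p ∘ sym))

  0≤δ : ∀ {n} (i j : Fin n) → 0ℚ ≤ δ i j
  0≤δ i j with does (i ≟ j)
  ... | true  = 0≤1
  ... | false = ℚ.≤-refl

  opaque
    unfolding ∑
    sum-δ : ∀ {n} (k : Fin n) (f : Vector ℚ n) → ∑ (λ i → δ k i * f i) ≡ f k
    sum-δ zero    f = trans (cong₂ _+_ (ℚ.*-identityˡ (f zero)) (sum-zero λ i → ℚ.*-zeroˡ (f (suc i)))) (ℚ.+-identityʳ (f zero))
    sum-δ (suc k) f = trans (cong₂ _+_ (ℚ.*-zeroˡ (f zero)) (sum-δ k (f ∘ suc))) (ℚ.+-identityˡ (f (suc k)))

  sum-δʳ : ∀ {n} (k : Fin n) (f : Vector ℚ n) → ∑ (λ i → f i * δ i k) ≡ f k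
  sum-δʳ k f = trans (sum-cong λ i → trans (ℚ.*-comm (f i) _) (cong (_* f i) (δ-sym i k))) (sum-δ k f)

  -- Dot products and linear combinations

  opaque
    dot : ∀ {m} → Vector ℚ m → Vector ℚ m → ℚ
    dot f x = ∑ λ l → f l * x l

    dot≡∑ : ∀ {m} (f x : Vector ℚ m) → dot f x ≡ ∑ λ l → f l * x l
    dot≡∑ f x = refl

  opaque
    unfolding dot
    dot-congˡ : ∀ {m} {f g : Vector ℚ m} (x : Vector ℚ m) → f ≗ g → dot f x ≡ dot g x
    dot-congˡ x e = sum-cong λ l → cong (_* x l) (e l)

    dot-congʳ : ∀ {m} (f : Vector ℚ m) {x y : Vector ℚ m} → x ≗ y → dot f x ≡ dot f y
    dot-congʳ f e = sum-cong λ l → cong (f l *_) (e l)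

  combo : ∀ {k m} → Vector ℚ k → (Fin k → Vector ℚ m) → Vector ℚ m
  combo a v l = ∑ λ j → a j * v j l

  opaque
    unfolding dot
    dot-combo : ∀ {k m} (f : Vector ℚ m) (a : Vector ℚ k) (v : Fin k → Vector ℚ m) →
      dot f (combo a v) ≡ ∑ λ j → a j * dot f (v j)
    dot-combo f a v = begin
      ∑ (λ l → f l * ∑ (λ j → a j * v j l))     ≡⟨ sum-cong (λ l → sym (sum-*ˡ (f l) _)) ⟩
      ∑ (λ l → ∑ (λ j → f l * (a j * v j l)))   ≡⟨ ∑-swap (λ l j → f l * (a j * v j l)) ⟩
      ∑ (λ j → ∑ (λ l → f l * (a j * v j l)))   ≡⟨ sum-cong (λ j → sum-cong λ l → lem (f l) (a j) (v j l)) ⟩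
      ∑ (λ j → ∑ (λ l → a j * (f l * v j l)))   ≡⟨ sum-cong (λ j → sum-*ˡ (a j) _) ⟩
      ∑ (λ j → a j * dot f (v j))                 ∎
      where
      open ≡-Reasoning
      lem : ∀ a b c → a * (b * c) ≡ b * (a * c)
      lem = solve-∀ ℚring

    dot-+ : ∀ {m} (f x y : Vector ℚ m) → dot f (λ l → x l + y l) ≡ dot f x + dot f y
    dot-+ f x y = trans (sum-cong λ l → ℚ.*-distribˡ-+ (f l) (x l) (y l)) (sum-+ _ _)

    dot-* : ∀ {m} (f : Vector ℚ m) c (x : Vector ℚ m) → dot f (λ l → c * x l) ≡ c * dot f x
    dot-* f c x = trans (sum-cong λ l → lem (f l) c (x l)) (sum-*ˡ c _)
      where
      lem : ∀ a b c → a * (b * c) ≡ b * (a * c)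
      lem = solve-∀ ℚring

    dot-minus : ∀ {m} (f x y : Vector ℚ m) → dot f (λ l → x l - y l) ≡ dot f x - dot f y
    dot-minus f x y = trans (sum-cong λ l → lem (f l) (x l) (y l)) (sum-minus _ _)
      where
      lem : ∀ a b c → a * (b - c) ≡ a * b - a * c
      lem = solve-∀ ℚring

  -- Bases of ℚᵐ and exchange of one basis vector

  record IsBasis {m} (u L : Fin m → Vector ℚ m) : Set where
    field
      dual   : ∀ i k → dot (L i) (u k) ≡ δ i k
      expand : ∀ x → x ≗ combo (λ i → dot (L i) x) u

  standard-basis : ∀ {m} → IsBasis {m} δ δ
  standard-basis = record
    { dual   = λ i k → trans (dot≡∑ (δ i) (δ k)) (trans (sum-δ i (δ k)) (δ-sym k i))
    ; expand = λ x l → sym (trans (sum-δʳ l (λ i → dot (δ i) x)) (trans (dot≡∑ (δ l) x) (sum-δ l x))) }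

  coords-unique : ∀ {m} {u u′ L L′ : Fin m → Vector ℚ m} → (∀ i → u i ≗ u′ i) → IsBasis u L → IsBasis u′ L′ →
    ∀ i x → dot (L i) x ≡ dot (L′ i) x
  coords-unique {u = u} {u′} {L} {L′} e b b′ i x = begin
    dot (L i) x                                     ≡⟨ dot-congʳ (L i) (IsBasis.expand b′ x) ⟩
    dot (L i) (combo (λ k → dot (L′ k) x) u′)       ≡⟨ dot-combo (L i) (λ k → dot (L′ k) x) u′ ⟩
    ∑ (λ k → dot (L′ k) x * dot (L i) (u′ k))     ≡⟨ sum-cong (λ k → cong (dot (L′ k) x *_) (trans (dot-congʳ (L i) (λ l → sym (e k l))) (IsBasis.dual b i k))) ⟩
    ∑ (λ k → dot (L′ k) x * δ i k)                ≡⟨ sum-cong (λ k → cong (dot (L′ k) x *_) (δ-sym i k)) ⟩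
    ∑ (λ k → dot (L′ k) x * δ k i)                ≡⟨ sum-δʳ i (λ k → dot (L′ k) x) ⟩
    dot (L′ i) x                                    ∎
    where open ≡-Reasoning

  _[_]≔_ : ∀ {A : Set} {m} → (Fin m → A) → Fin m → A → Fin m → A
  (u [ i ]≔ w) k = if does (i ≟ k) then w else u k

  ≔-same : ∀ {A : Set} {m} (u : Fin m → A) i w → (u [ i ]≔ w) i ≡ w
  ≔-same u i w = cong (if_then w else u i) (dec-true (i ≟ i) refl)

  ≔-other : ∀ {A : Set} {m} (u : Fin m → A) {i k} w → i ≢ k → (u [ i ]≔ w) k ≡ u k
  ≔-other u {i} {k} w p = cong (if_then w else u k) (dec-false (i ≟ k) p)

  -- The functionals dual to the basis with `u i` replaced by `w`, for `c` the inverse of `L i` at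
  -- `w`. Subtracting `δ i k` lets one formula serve both cases: at `k = i` it collapses to `c`
  -- times `L i`.
  pivot : ∀ {m} → (Fin m → Vector ℚ m) → Fin m → Vector ℚ m → ℚ → Fin m → Vector ℚ m
  pivot L i w c k l = L k l - (dot (L k) w - δ i k) * c * L i l

  opaque
    unfolding dot
    dot-pivot : ∀ {m} (L : Fin m → Vector ℚ m) i w c k x →
      dot (pivot L i w c k) x ≡ dot (L k) x - (dot (L k) w - δ i k) * c * dot (L i) x
    dot-pivot L i w c k x = begin
      ∑ (λ l → (L k l - e * L i l) * x l)          ≡⟨ sum-cong (λ l → lem (L k l) e (L i l) (x l)) ⟩
      ∑ (λ l → L k l * x l - e * (L i l * x l))    ≡⟨ sum-minus _ _ ⟩
      dot (L k) x - ∑ (λ l → e * (L i l * x l))    ≡⟨ cong (λ z → dot (L k) x - z) (sum-*ˡ e _) ⟩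
      dot (L k) x - e * dot (L i) x                  ∎
      where
      open ≡-Reasoning
      e : ℚ
      e = (dot (L k) w - δ i k) * c
      lem : ∀ a b c d → (a - b * c) * d ≡ a * d - b * (c * d)
      lem = solve-∀ ℚring

  dot-pivot-other : ∀ {m} (L : Fin m → Vector ℚ m) {i} w c {k} x → i ≢ k →
    dot (pivot L i w c k) x ≡ dot (L k) x - dot (L k) w * c * dot (L i) x
  dot-pivot-other L {i} w c {k} x p = trans (dot-pivot L i w c k x)
    (trans (cong (λ z → dot (L k) x - (dot (L k) w - z) * c * dot (L i) x) (δ-≢ p))
      (lem (dot (L k) x) (dot (L k) w) c (dot (L i) x)))
    where
    lem : ∀ a b c d → a - (b - 0ℚ) * c * d ≡ a - b * c * d
    lem = solve-∀ ℚring

  dot-pivot-same : ∀ {m} (L : Fin m → Vector ℚ m) i w c x → dot (L i) w * c ≡ 1ℚ →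
    dot (pivot L i w c i) x ≡ c * dot (L i) x
  dot-pivot-same L i w c x e = trans (dot-pivot L i w c i x)
    (trans (cong (λ z → dot (L i) x - (dot (L i) w - z) * c * dot (L i) x) (δ-refl i))
    (trans (lem (dot (L i) x) (dot (L i) w) c)
    (trans (cong (λ z → dot (L i) x - z * dot (L i) x + c * dot (L i) x) e)
      (lem₂ (dot (L i) x) c))))
    where
    lem : ∀ a b c → a - (b - 1ℚ) * c * a ≡ a - b * c * a + c * a
    lem = solve-∀ ℚring
    lem₂ : ∀ a c → a - 1ℚ * a + c * a ≡ c * a
    lem₂ = solve-∀ ℚring

  -- Exchanging f i for h in Σ λₖ fₖ; stated for arbitrary f because it is also
  -- applied to the costs of a basis.
  pivot-combo : ∀ {m} (L : Fin m → Vector ℚ m) i w c x (f : Vector ℚ m) h → dot (L i) w * c ≡ 1ℚ →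
    ∑ (λ k → dot (pivot L i w c k) x * (f [ i ]≔ h) k)
      ≡ ∑ (λ k → dot (L k) x * f k) + c * dot (L i) x * (h - ∑ (λ k → dot (L k) w * f k))
  pivot-combo L i w c x f h e = begin
    ∑ (λ k → dot (pivot L i w c k) x * (f [ i ]≔ h) k)
      ≡⟨ sum-cong term ⟩
    ∑ (λ k → (dot (L k) x * f k + - (c * X) * (dot (L k) w * f k)) + δ i k * (c * X * h))
      ≡⟨ sum-+ _ _ ⟩
    ∑ (λ k → dot (L k) x * f k + - (c * X) * (dot (L k) w * f k)) + ∑ (λ k → δ i k * (c * X * h))
      ≡⟨ cong₂ _+_ (sum-+ _ _) (sum-δ i (λ _ → c * X * h)) ⟩
    ∑ (λ k → dot (L k) x * f k) + ∑ (λ k → - (c * X) * (dot (L k) w * f k)) + c * X * h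
      ≡⟨ cong (λ z → ∑ (λ k → dot (L k) x * f k) + z + c * X * h) (sum-*ˡ (- (c * X)) _) ⟩
    ∑ (λ k → dot (L k) x * f k) + - (c * X) * W + c * X * h
      ≡⟨ lem (∑ (λ k → dot (L k) x * f k)) (c * X) W h ⟩
    ∑ (λ k → dot (L k) x * f k) + c * X * (h - W) ∎
    where
    open ≡-Reasoning
    X = dot (L i) x
    W = ∑ (λ k → dot (L k) w * f k)
    lem : ∀ a b c d → a + - b * c + b * d ≡ a + b * (d - c)
    lem = solve-∀ ℚring
    lem₃ : ∀ X c h W f → c * X * h ≡ X * f + - (c * X) * (W * f) + 1ℚ * (c * X * h) - X * (1ℚ - W * c) * f
    lem₃ = solve-∀ ℚring
    lem₄ : ∀ a X f → a - X * (1ℚ - 1ℚ) * f ≡ a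
    lem₄ = solve-∀ ℚring
    term : ∀ k → dot (pivot L i w c k) x * (f [ i ]≔ h) k
      ≡ (dot (L k) x * f k + - (c * X) * (dot (L k) w * f k)) + δ i k * (c * X * h)
    lem₅ : ∀ a b c d e h → (a - b * c * d) * e ≡ a * e + - (c * d) * (b * e) + 0ℚ * (c * d * h)
    lem₅ = solve-∀ ℚring
    term k = by-cases (i ≟ k) same other
      where
      Goal : _ → Set
      Goal k = dot (pivot L i w c k) x * (f [ i ]≔ h) k ≡ (dot (L k) x * f k + - (c * X) * (dot (L k) w * f k)) + δ i k * (c * X * h)
      other : i ≢ k → Goal k
      other p = trans (cong₂ _*_ (dot-pivot-other L w c x p) (≔-other f h p))
        (trans (lem₅ (dot (L k) x) (dot (L k) w) c X (f k) h)
          (cong (λ z → dot (L k) x * f k + - (c * X) * (dot (L k) w * f k) + z * (c * X * h)) (sym (δ-≢ p))))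
      same : i ≡ k → Goal k
      same refl = trans (cong₂ _*_ (dot-pivot-same L i w c x e) (≔-same f i h))
        (trans (lem₃ X c h (dot (L i) w) (f i))
        (trans (cong (λ z → X * f i + - (c * X) * (dot (L i) w * f i) + 1ℚ * (c * X * h) - X * (1ℚ - z) * f i) e)
        (trans (lem₄ _ X (f i))
          (cong (λ z → X * f i + - (c * X) * (dot (L i) w * f i) + z * (c * X * h)) (sym (δ-refl i))))))

  pivot-basis : ∀ {m} {u L : Fin m → Vector ℚ m} i w c → dot (L i) w * c ≡ 1ℚ →
    IsBasis u L → IsBasis (u [ i ]≔ w) (pivot L i w c)
  pivot-basis {u = u} {L} i w c e b = record { dual = dual′ ; expand = expand′ }
    where
    open IsBasis b
    open ≡-Reasoning
    lem₂ : ∀ a b c → a - b * c * 0ℚ ≡ a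
    lem₂ = solve-∀ ℚring
    lem₅ : ∀ a b → a + b * 0ℚ ≡ a
    lem₅ = solve-∀ ℚring
    lem₈ : ∀ a d wi c → a - (a - d) * c * wi ≡ a - (a - d) * (wi * c)
    lem₈ = solve-∀ ℚring
    lem₉ : ∀ a d → a - (a - d) * 1ℚ ≡ d
    lem₉ = solve-∀ ℚring
    dual′ : ∀ k j → dot (pivot L i w c k) ((u [ i ]≔ w) j) ≡ δ k j
    dual′ k j = by-cases (i ≟ j) same other
      where
      Goal = dot (pivot L i w c k) ((u [ i ]≔ w) j) ≡ δ k j
      same : i ≡ j → Goal
      same refl = begin
        dot (pivot L i w c k) ((u [ i ]≔ w) i)
          ≡⟨ dot-congʳ (pivot L i w c k) (λ l → cong (λ v → v l) (≔-same u i w)) ⟩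
        dot (pivot L i w c k) w
          ≡⟨ dot-pivot L i w c k w ⟩
        dot (L k) w - (dot (L k) w - δ i k) * c * dot (L i) w
          ≡⟨ lem₈ (dot (L k) w) (δ i k) (dot (L i) w) c ⟩
        dot (L k) w - (dot (L k) w - δ i k) * (dot (L i) w * c)
          ≡⟨ cong (λ z → dot (L k) w - (dot (L k) w - δ i k) * z) e ⟩
        dot (L k) w - (dot (L k) w - δ i k) * 1ℚ
          ≡⟨ lem₉ (dot (L k) w) (δ i k) ⟩
        δ i k
          ≡⟨ δ-sym i k ⟩
        δ k i ∎
      other : i ≢ j → Goal
      other p = begin
        dot (pivot L i w c k) ((u [ i ]≔ w) j)
          ≡⟨ dot-congʳ (pivot L i w c k) (λ l → cong (λ v → v l) (≔-other u w p)) ⟩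
        dot (pivot L i w c k) (u j)
          ≡⟨ dot-pivot L i w c k (u j) ⟩
        dot (L k) (u j) - (dot (L k) w - δ i k) * c * dot (L i) (u j)
          ≡⟨ cong₂ (λ y z → y - (dot (L k) w - δ i k) * c * z) (dual k j) (trans (dual i j) (δ-≢ p)) ⟩
        δ k j - (dot (L k) w - δ i k) * c * 0ℚ
          ≡⟨ lem₂ (δ k j) (dot (L k) w - δ i k) c ⟩
        δ k j ∎
    at : ∀ l k → (u [ i ]≔ w) k l ≡ ((λ k → u k l) [ i ]≔ w l) k
    at l k with does (i ≟ k)
    ... | true  = refl
    ... | false = refl
    -- Entry by entry this is the exchange formula; its correction term vanishes because `w` equals
    -- its own expansion.
    expand′ : ∀ x → x ≗ combo (λ k → dot (pivot L i w c k) x) (u [ i ]≔ w)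
    expand′ x l = sym (begin
      ∑ (λ k → dot (pivot L i w c k) x * (u [ i ]≔ w) k l)
        ≡⟨ sum-cong (λ k → cong (dot (pivot L i w c k) x *_) (at l k)) ⟩
      ∑ (λ k → dot (pivot L i w c k) x * ((λ k → u k l) [ i ]≔ w l) k)
        ≡⟨ pivot-combo L i w c x (λ k → u k l) (w l) e ⟩
      combo (λ k → dot (L k) x) u l + c * dot (L i) x * (w l - combo (λ k → dot (L k) w) u l)
        ≡⟨ cong₂ (λ y z → y + c * dot (L i) x * (w l - z)) (sym (expand x l)) (sym (expand w l)) ⟩
      x l + c * dot (L i) x * (w l - w l)
        ≡⟨ cong (λ z → x l + c * dot (L i) x * z) (ℚ.+-inverseʳ (w l)) ⟩
      x l + c * dot (L i) x * 0ℚ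
        ≡⟨ lem₅ (x l) (c * dot (L i) x) ⟩
      x l ∎)

  -- Lexicographic order on I → ℚ, for a list of coordinates

  private variable
    I I′ : Set

  -- Lists may repeat or miss indices: a repeated index decides nothing the second time, and a
  -- missing one is never looked at, so reading a value off `Zero` needs a proof that the index is
  -- listed.
  Pos : List I → (I → ℚ) → Set
  Pos []       f = ⊥
  Pos (i ∷ is) f = 0ℚ < f i ⊎ (f i ≡ 0ℚ × Pos is f)

  Zero : List I → (I → ℚ) → Set
  Zero is f = ∀ {i} → i ∈ is → f i ≡ 0ℚ

  NonNeg : List I → (I → ℚ) → Set
  NonNeg is f = Pos is f ⊎ Zero is f

  zero-∷ : ∀ {i : I} {is f} → f i ≡ 0ℚ → Zero is f → Zero (i ∷ is) f
  zero-∷ p z (here refl) = p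
  zero-∷ p z (there i∈)  = z i∈

  pos-cong : ∀ (is : List I) {f g} → f ≗ g → Pos is f → Pos is g
  pos-cong (i ∷ is) e (inj₁ p)       = inj₁ (subst (0ℚ <_) (e i) p)
  pos-cong (i ∷ is) e (inj₂ (p , q)) = inj₂ (trans (sym (e i)) p , pos-cong is e q)

  nonneg-cong : ∀ (is : List I) {f g} → f ≗ g → NonNeg is f → NonNeg is g
  nonneg-cong is e (inj₁ p) = inj₁ (pos-cong is e p)
  nonneg-cong is e (inj₂ z) = inj₂ λ i∈ → trans (sym (e _)) (z i∈)

  pos-trichotomy : ∀ (is : List I) f → Pos is f ⊎ Zero is f ⊎ Pos is (-_ ∘ f)
  pos-trichotomy []       f = inj₂ (inj₁ λ ())
  pos-trichotomy (i ∷ is) f with ℚ.<-cmp (f i) 0ℚ | pos-trichotomy is f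
  ... | tri> _ _ p | _                = inj₁ (inj₁ p)
  ... | tri< p _ _ | _                = inj₂ (inj₂ (inj₁ (neg-pos p)))
  ... | tri≈ _ p _ | inj₁ q           = inj₁ (inj₂ (p , q))
  ... | tri≈ _ p _ | inj₂ (inj₁ q)    = inj₂ (inj₁ (zero-∷ p q))
  ... | tri≈ _ p _ | inj₂ (inj₂ q)    = inj₂ (inj₂ (inj₂ (cong -_ p , q)))

  pos-zero : ∀ (is : List I) {f} → Pos is f → Zero is f → ⊥
  pos-zero (i ∷ is) (inj₁ p)       z = <⇒≢0 p (z (here refl))
  pos-zero (i ∷ is) (inj₂ (_ , p)) z = pos-zero is p (z ∘ there)

  pos-nonneg-+ : ∀ (is : List I) {f g} → Pos is f → NonNeg is g → Pos is (λ i → f i + g i)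
  pos-nonneg-+ (i ∷ is) {f} {g} (inj₁ p) q = inj₁ (0<+ p (lead q))
    where
    lead : NonNeg (i ∷ is) g → 0ℚ ≤ g i
    lead (inj₁ (inj₁ r))       = ℚ.<⇒≤ r
    lead (inj₁ (inj₂ (r , _))) = ℚ.≤-reflexive (sym r)
    lead (inj₂ z)              = ℚ.≤-reflexive (sym (z (here refl)))
  pos-nonneg-+ (i ∷ is) {f} {g} (inj₂ (p , p′)) (inj₁ (inj₁ q)) =
    inj₁ (subst (0ℚ <_) (trans (sym (ℚ.+-identityˡ (g i))) (cong (_+ g i) (sym p))) q)
  pos-nonneg-+ (i ∷ is) (inj₂ (p , p′)) (inj₁ (inj₂ (q , q′))) =
    inj₂ (cong₂ _+_ p q , pos-nonneg-+ is p′ (inj₁ q′))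
  pos-nonneg-+ (i ∷ is) (inj₂ (p , p′)) (inj₂ z) =
    inj₂ (cong₂ _+_ p (z (here refl)) , pos-nonneg-+ is p′ (inj₂ (z ∘ there)))

  nonneg-+ : ∀ (is : List I) {f g} → NonNeg is f → NonNeg is g → NonNeg is (λ i → f i + g i)
  nonneg-+ is         (inj₁ p) q        = inj₁ (pos-nonneg-+ is p q)
  nonneg-+ is {f} {g} (inj₂ z) (inj₁ q) = inj₁ (pos-cong is (λ i → ℚ.+-comm (g i) (f i)) (pos-nonneg-+ is q (inj₂ z)))
  nonneg-+ is         (inj₂ z) (inj₂ y) = inj₂ λ i∈ → cong₂ _+_ (z i∈) (y i∈)

  pos-asym : ∀ (is : List I) {f} → Pos is f → Pos is (-_ ∘ f) → ⊥
  pos-asym is {f} p q = pos-zero is (pos-nonneg-+ is p (inj₁ q)) λ {i} _ → ℚ.+-inverseʳ (f i)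

  ¬pos-neg : ∀ (is : List I) {f} → NonNeg is f → ¬ Pos is (-_ ∘ f)
  ¬pos-neg is (inj₁ p) q = pos-asym is p q
  ¬pos-neg is (inj₂ z) q = pos-zero is q λ i∈ → cong -_ (z i∈)

  pos-* : ∀ (is : List I) {f c} → 0ℚ < c → Pos is f → Pos is (λ i → c * f i)
  pos-* (i ∷ is)         0<c (inj₁ p)       = inj₁ (0<* 0<c p)
  pos-* (i ∷ is) {c = c} 0<c (inj₂ (p , q)) = inj₂ (trans (cong (c *_) p) (ℚ.*-zeroʳ c) , pos-* is 0<c q)

  nonneg-* : ∀ (is : List I) {f c} → 0ℚ ≤ c → NonNeg is f → NonNeg is (λ i → c * f i)
  nonneg-* is {f} {c} 0≤c p with c ℚ.≟ 0ℚ | p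
  ... | yes refl | _      = inj₂ λ {i} _ → ℚ.*-zeroˡ (f i)
  ... | no  c≢0  | inj₁ q = inj₁ (pos-* is (≤≢⇒< 0≤c c≢0) q)
  ... | no  c≢0  | inj₂ z = inj₂ λ i∈ → trans (cong (c *_) (z i∈)) (ℚ.*-zeroʳ c)

  nonneg-∑ : ∀ {n} (is : List I) (f : Fin n → I → ℚ) → (∀ j → NonNeg is (f j)) → NonNeg is (λ i → ∑ λ j → f j i)
  nonneg-∑ {n = n} is f p = nonneg-cong is (λ i → sym (∑≡sum (λ j → f j i))) (go n f p)
    where
    go : ∀ n (f : Fin n → _ → ℚ) → (∀ j → NonNeg is (f j)) → NonNeg is (λ i → sum λ j → f j i)
    go zero    f p = inj₂ λ _ → refl
    go (suc n) f p = nonneg-+ is (p zero) (go n (f ∘ suc) (p ∘ suc))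

  nonneg-head : ∀ {i : I} {is f} → NonNeg (i ∷ is) f → 0ℚ ≤ f i
  nonneg-head (inj₁ (inj₁ r))       = ℚ.<⇒≤ r
  nonneg-head (inj₁ (inj₂ (r , _))) = ℚ.≤-reflexive (sym r)
  nonneg-head (inj₂ z)              = ℚ.≤-reflexive (sym (z (here refl)))

  pos-++ˡ : ∀ (is js : List I) {f} → Pos is f → Pos (is ++ js) f
  pos-++ˡ (i ∷ is) js (inj₁ p)       = inj₁ p
  pos-++ˡ (i ∷ is) js (inj₂ (p , q)) = inj₂ (p , pos-++ˡ is js q)

  pos-++ʳ : ∀ (is js : List I) {f} → Zero is f → Pos js f → Pos (is ++ js) f
  pos-++ʳ []       js z p = p
  pos-++ʳ (i ∷ is) js z p = inj₂ (z (here refl) , pos-++ʳ is js (z ∘ there) p)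

  pos-map : ∀ (g : I′ → I) (is : List I′) {f} → Pos is (f ∘ g) → Pos (map g is) f
  pos-map g (i ∷ is) (inj₁ p)       = inj₁ p
  pos-map g (i ∷ is) (inj₂ (p , q)) = inj₂ (p , pos-map g is q)

  -- The product list runs through the table row by row. Rows before the leading index of `f`
  -- vanish, and the leading row is a positive multiple of `g`, so the leading entry is the product
  -- of the two leading entries.
  pos-⊗ : ∀ (is : List I) (js : List I′) {f g} → Pos is f → Pos js g →
    Pos (cartesianProduct is js) (λ (i , j) → f i * g j)
  pos-⊗ (i ∷ is) js {f} {g} (inj₁ p) q = pos-++ˡ (map (i ,_) js) _ (pos-map (i ,_) js (pos-* js p q))
  pos-⊗ (i ∷ is) js {f} {g} (inj₂ (p , r)) q = pos-++ʳ (map (i ,_) js) _ (zero-map js) (pos-⊗ is js r q)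
    where
    zero-map : ∀ js → Zero (map (i ,_) js) (λ (i , j) → f i * g j)
    zero-map (j ∷ js) (here refl) = trans (cong (_* g j) p) (ℚ.*-zeroˡ (g j))
    zero-map (j ∷ js) (there x∈)  = zero-map js x∈

  nonneg-⊗ : ∀ (is : List I) (js : List I′) {f g} → (∀ i → i ∈ is) → (∀ j → j ∈ js) → NonNeg is f → NonNeg js g →
    NonNeg (cartesianProduct is js) (λ (i , j) → f i * g j)
  nonneg-⊗ is js         ai aj (inj₁ p) (inj₁ q) = inj₁ (pos-⊗ is js p q)
  nonneg-⊗ is js {f} {g} ai aj (inj₂ z) _        = inj₂ λ {(i , j)} _ → trans (cong (_* g j) (z (ai i))) (ℚ.*-zeroˡ (g j))
  nonneg-⊗ is js {f} {g} ai aj (inj₁ _) (inj₂ z) = inj₂ λ {(i , j)} _ → trans (cong (f i *_) (z (aj j))) (ℚ.*-zeroʳ (f i))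

  pos? : ∀ (is : List I) f → Dec (Pos is f)
  pos? is f with pos-trichotomy is f
  ... | inj₁ p        = yes p
  ... | inj₂ (inj₁ z) = no λ p → pos-zero is p z
  ... | inj₂ (inj₂ q) = no λ p → pos-asym is p q

  nonneg-total : ∀ (is : List I) (f g : I → ℚ) → NonNeg is (λ i → g i - f i) ⊎ NonNeg is (λ i → f i - g i)
  nonneg-total is f g with pos-trichotomy is (λ i → g i - f i)
  ... | inj₁ p        = inj₁ (inj₁ p)
  ... | inj₂ (inj₁ z) = inj₁ (inj₂ z)
  ... | inj₂ (inj₂ p) = inj₂ (inj₁ (pos-cong is (λ i → lem (g i) (f i)) p))
    where
    lem : ∀ a b → - (a - b) ≡ b - a
    lem = solve-∀ ℚring

  nonneg-trans : ∀ (is : List I) {f g h : I → ℚ} → NonNeg is (λ i → g i - f i) → NonNeg is (λ i → h i - g i) → NonNeg is (λ i → h i - f i)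
  nonneg-trans is {f} {g} {h} p q = nonneg-cong is (λ i → lem (f i) (g i) (h i)) (nonneg-+ is p q)
    where
    lem : ∀ a b c → b - a + (c - b) ≡ c - a
    lem = solve-∀ ℚring

  argmin : ∀ {n} {P : Fin n → Set} {_≼_ : Fin n → Fin n → Set} → (∀ i → Dec (P i)) →
    (∀ i j → i ≼ j ⊎ j ≼ i) → (∀ {i j k} → i ≼ j → j ≼ k → i ≼ k) →
    ∃ P → ∃[ i ] P i × (∀ j → P j → i ≼ j)
  argmin {suc n} {P} {_≼_} P? total tr (k , pk) with any? (P? ∘ suc)
  argmin {suc n} P? total tr (zero , pk) | no ¬p = zero , pk , λ { zero _ → reduce (total zero zero) ; (suc j) pj → ⊥-elim (¬p (j , pj)) }
  argmin {suc n} P? total tr (suc k , pk) | no ¬p = ⊥-elim (¬p (k , pk))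
  argmin {suc n} P? total tr _ | yes w with argmin (P? ∘ suc) (λ i j → total (suc i) (suc j)) tr w
  ... | i , pi , min with P? zero | total zero (suc i)
  ...   | no ¬p | _      = suc i , pi , λ { zero p → ⊥-elim (¬p p) ; (suc j) → min j }
  ...   | yes p | inj₂ r = suc i , pi , λ { zero _ → r ; (suc j) → min j }
  ...   | yes p | inj₁ r = zero , p , λ { zero _ → reduce (total zero zero) ; (suc j) pj → tr r (min j pj) }

  -- Cardinality of decidable subsets of Fin n

  cardinality : ∀ {n} → (Fin n → Bool) → ℕ
  cardinality {zero}  p = 0
  cardinality {suc n} p = (if p zero then 1 else 0) ℕ.+ cardinality (p ∘ suc)

  count-cong : ∀ {n} {p q : Fin n → Bool} → p ≗ q → cardinality p ≡ cardinality q
  count-cong {zero}  e = refl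
  count-cong {suc n} e = cong₂ (λ b c → (if b then 1 else 0) ℕ.+ c) (e zero) (count-cong (e ∘ suc))

  count-split : ∀ {n} (p q : Fin n → Bool) → cardinality p ≡ cardinality (λ i → p i ∧ q i) ℕ.+ cardinality (λ i → p i ∧ not (q i))
  count-split {zero}  p q = refl
  count-split {suc n} p q with p zero | q zero | count-split (p ∘ suc) (q ∘ suc)
  ... | false | _     | e = e
  ... | true  | true  | e = cong suc e
  ... | true  | false | e = trans (cong suc e) (sym (ℕ.+-suc _ _))

  count-false : ∀ {n} {p : Fin n → Bool} → (∀ i → ¬ T (p i)) → cardinality p ≡ 0
  count-false {zero}      e = refl
  count-false {suc n} {p} e with p zero in eq
  ... | true  = ⊥-elim (e zero (subst T (sym eq) tt))
  ... | false = count-false (e ∘ suc)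

  count-≟ : ∀ {n} (i : Fin n) → cardinality (λ j → does (i ≟ j)) ≡ 1
  count-≟ {suc n} zero = cong suc (count-false {n} {λ j → does (zero {n} ≟ suc j)} λ _ z → z)
  count-≟ (suc i) = count-≟ i

  T-does : ∀ {a} {A : Set a} (d : Dec A) → T (does d) → A
  T-does (yes a) _ = a

  does-T : ∀ {a} {A : Set a} (d : Dec A) → A → T (does d)
  does-T (yes _) a = tt
  does-T (no ¬a) a = ¬a a

  T-∧⁺ : ∀ {a b} → T a → T b → T (a ∧ b)
  T-∧⁺ {true} {true} _ _ = tt

  T-∧⁻ : ∀ {a b} → T (a ∧ b) → T a × T b
  T-∧⁻ {true} {true} _ = tt , tt

  T-true : ∀ {a} → T a → a ≡ true
  T-true {true} _ = refl

  T-not : ∀ {a} → ¬ T a → T (not a)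
  T-not {false} _ = tt
  T-not {true}  f = f tt

  T-not⁻ : ∀ {a} → T (not a) → ¬ T a
  T-not⁻ {false} _ ()

  count-remove : ∀ {n} (q : Fin n → Bool) i → T (q i) → cardinality q ≡ suc (cardinality (λ j → q j ∧ not (does (i ≟ j))))
  count-remove q i qi = trans (count-split q (λ j → does (i ≟ j)))
    (cong (ℕ._+ cardinality (λ j → q j ∧ not (does (i ≟ j)))) (trans (count-cong same) (count-≟ i)))
    where
    same : ∀ j → q j ∧ does (i ≟ j) ≡ does (i ≟ j)
    same j = by-cases (i ≟ j) (λ { refl → yes′ }) (λ p → trans (cong (q j ∧_) (dec-false (i ≟ j) p)) (trans (and-false (q j)) (sym (dec-false (i ≟ j) p))))
      where
      and-false : ∀ b → b ∧ false ≡ false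
      and-false true  = refl
      and-false false = refl
      yes′ : q i ∧ does (i ≟ i) ≡ does (i ≟ i)
      yes′ = cong (_∧ does (i ≟ i)) (T-true qi)

  count-injection : ∀ {n k} (p : Fin n → Bool) (q : Fin k → Bool) (f : ∀ i → T (p i) → Fin k) →
    (∀ i pi → T (q (f i pi))) → (∀ i j pi pj → f i pi ≡ f j pj → i ≡ j) → cardinality p ℕ.≤ cardinality q
  count-injection {zero}  p q f fq inj = ℕ.z≤n
  count-injection {suc n} p q f fq inj with p zero in eq
  ... | false = count-injection (p ∘ suc) q (f ∘ suc) (fq ∘ suc) λ i j pi pj e → suc-injective (inj (suc i) (suc j) pi pj e)
  ... | true  = subst (suc (cardinality (p ∘ suc)) ℕ.≤_) (sym (count-remove q k (fq zero p0)))
    (ℕ.s≤s (count-injection (p ∘ suc) _ (f ∘ suc)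
      (λ i pi → T-∧⁺ (fq (suc i) pi) (T-not λ t → case inj zero (suc i) p0 pi (T-does (k ≟ f (suc i) pi) t) of λ ()))
      λ i j pi pj e → suc-injective (inj (suc i) (suc j) pi pj e)))
    where
    p0 = subst T (sym eq) tt
    k = f zero p0

  count-all : ∀ n → cardinality {n} (λ _ → true) ≡ n
  count-all zero    = refl
  count-all (suc n) = cong suc (count-all n)

  count-⊆ : ∀ {n} (p q : Fin n → Bool) → (∀ i → T (p i) → T (q i)) → cardinality p ℕ.≤ cardinality q
  count-⊆ p q f = count-injection p q (λ i _ → i) f λ _ _ _ _ e → e

  count-∪ : ∀ {n} (p q r : Fin n → Bool) → (∀ i → T (p i) → T (q i) ⊎ T (r i)) → cardinality p ℕ.≤ cardinality q ℕ.+ cardinality r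
  count-∪ p q r f = subst (ℕ._≤ cardinality q ℕ.+ cardinality r) (sym (count-split p q))
    (ℕ.+-mono-≤ (count-⊆ _ q λ i t → proj₂ (T-∧⁻ {p i} t))
                (count-⊆ _ r λ i t → help i (T-∧⁻ {p i} t)))
    where
    help : ∀ i → T (p i) × T (not (q i)) → T (r i)
    help i (a , b) with f i a
    ... | inj₁ c = ⊥-elim (T-not⁻ b c)
    ... | inj₂ c = c

  count-positive : ∀ {n} (p : Fin n → Bool) → 0 ℕ.< cardinality p → ∃[ i ] T (p i)
  count-positive {suc n} p lt with p zero in eq
  ... | true  = zero , subst T (sym eq) tt
  ... | false with count-positive (p ∘ suc) lt
  ...   | i , t = suc i , t

  count-pos : ∀ {n} (p : Fin n → Bool) i → T (p i) → 0 ℕ.< cardinality p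
  count-pos p i t = subst (0 ℕ.<_) (sym (count-remove p i t)) (ℕ.s≤s ℕ.z≤n)

  select : ∀ {n} (p : Fin n → Bool) → Fin (cardinality p) → Fin n
  select {suc n} p k with p zero
  select {suc n} p zero    | true  = zero
  select {suc n} p (suc k) | true  = suc (select (p ∘ suc) k)
  select {suc n} p k       | false = suc (select (p ∘ suc) k)

  select-T : ∀ {n} (p : Fin n → Bool) k → T (p (select p k))
  select-T {suc n} p k with p zero in eq
  select-T {suc n} p zero    | true  = subst T (sym eq) tt
  select-T {suc n} p (suc k) | true  = select-T (p ∘ suc) k
  select-T {suc n} p k       | false = select-T (p ∘ suc) k

  select-injective : ∀ {n} (p : Fin n → Bool) i j → select p i ≡ select p j → i ≡ j
  select-injective {suc n} p i j e with p zero
  select-injective {suc n} p zero    zero    e | true  = refl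
  select-injective {suc n} p (suc i) (suc j) e | true  = cong suc (select-injective (p ∘ suc) i j (suc-injective e))
  select-injective {suc n} p i       j       e | false = select-injective (p ∘ suc) i j (suc-injective e)

  rank : ∀ {n} → (Fin n → Bool) → Fin n → ℕ
  rank p zero    = 0
  rank p (suc i) = (if p zero then 1 else 0) ℕ.+ rank (p ∘ suc) i

  rank-cong : ∀ {n} {p q : Fin n → Bool} → p ≗ q → rank p ≗ rank q
  rank-cong e zero    = refl
  rank-cong e (suc i) = cong₂ (λ b c → (if b then 1 else 0) ℕ.+ c) (e zero) (rank-cong (e ∘ suc) i)

  rank-exists : ∀ {n} (p : Fin n → Bool) k → k ℕ.< cardinality p → ∃[ i ] T (p i) × rank p i ≡ k
  rank-exists {suc n} p k lt with p zero in eq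
  rank-exists {suc n} p k lt | false with rank-exists (p ∘ suc) k lt
  ... | i , t , e = suc i , t , trans (cong (λ b → (if b then 1 else 0) ℕ.+ rank (p ∘ suc) i) eq) e
  rank-exists {suc n} p zero lt | true = zero , subst T (sym eq) tt , refl
  rank-exists {suc n} p (suc k) (ℕ.s≤s lt) | true with rank-exists (p ∘ suc) k lt
  ... | i , t , e = suc i , t , trans (cong (λ b → (if b then 1 else 0) ℕ.+ rank (p ∘ suc) i) eq) (cong suc e)

  rank-injective : ∀ {n} (p : Fin n → Bool) i j → T (p i) → T (p j) → rank p i ≡ rank p j → i ≡ j
  rank-injective p zero    zero    _ _ _ = refl
  rank-injective p zero    (suc j) t _ e with p zero
  ... | true = case e of λ ()
  rank-injective p (suc i) zero    _ t e with p zero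
  ... | true = case e of λ ()
  rank-injective p (suc i) (suc j) ti tj e = cong suc (rank-injective (p ∘ suc) i j ti tj (ℕ.+-cancelˡ-≡ (if p zero then 1 else 0) _ _ e))

  rank<count : ∀ {n} (p : Fin n → Bool) i → T (p i) → rank p i ℕ.< cardinality p
  rank<count p zero t with p zero
  ... | true = ℕ.s≤s ℕ.z≤n
  rank<count p (suc i) t = ℕ.+-monoʳ-< (if p zero then 1 else 0) (rank<count (p ∘ suc) i t)

  ≔-map : ∀ {A B : Set} {m} (φ : A → B) (S : Fin m → A) i w k → φ ((S [ i ]≔ w) k) ≡ ((φ ∘ S) [ i ]≔ φ w) k
  ≔-map φ S i w k with does (i ≟ k)
  ... | true  = refl
  ... | false = refl

  opaque
    -- Total, with a dummy value at 0, so that ratios can be formed for all generators before those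
    -- with a suitable denominator are singled out.
    recip : ℚ → ℚ
    recip a = by-cases (a ℚ.≟ 0ℚ) (λ _ → 0ℚ) λ a≢0 → proj₁ (inverse a a≢0)

    recip-inverse : ∀ {a} → a ≢ 0ℚ → a * recip a ≡ 1ℚ
    recip-inverse {a} a≢0 with a ℚ.≟ 0ℚ
    ... | yes p = ⊥-elim (a≢0 p)
    ... | no  p = proj₂ (inverse a p)

  recip-pos : ∀ {a} → 0ℚ < a → 0ℚ < recip a
  recip-pos {a} p = 0<-cancelˡ p (subst (0ℚ <_) (sym (recip-inverse (<⇒≢0 p))) 0<1)

  opaque
    decode : ∀ {m n} → Fin (n ℕ.^ m) → Fin m → Fin n
    decode = finToFun

    encode : ∀ {m n} → (Fin m → Fin n) → Fin (n ℕ.^ m)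
    encode = funToFin

    decode-encode : ∀ {m n} (f : Fin m → Fin n) → decode (encode f) ≗ f
    decode-encode = finToFun-funToFin

  -- Triangulations

  module Triangulation {N m : ℕ} (g : Fin N → Vector ℚ m) (order : List (Fin N)) (complete : ∀ j → j ∈ order) where

    -- Component `j′` of the reduced cost of generator `j`, where `g j` costs the unit vector at `j`
    -- in ℚᴺ and costs are compared lexicographically along `order`. Equivalently, the generators
    -- are lifted to heights of different orders of magnitude, which induces a regular
    -- triangulation.
    reducedCost : (Fin m → Fin N) → (Fin m → Vector ℚ m) → Fin N → Fin N → ℚ
    reducedCost S L j j′ = δ j j′ - ∑ λ i → dot (L i) (g j) * δ (S i) j′

    -- The simplices of the triangulation are the bases S that are optimal for
    -- the lexicographic linear program with cost vectors e₀, e₁, ….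
    record Simplex (S : Fin m → Fin N) (L : Fin m → Vector ℚ m) : Set where
      field
        basis   : IsBasis (g ∘ S) L
        optimal : ∀ j → NonNeg order (reducedCost S L j)

      injective : ∀ {i k} → S i ≡ S k → i ≡ k
      injective {i} {k} e = by-cases (i ≟ k) (λ p → p) λ p →
        ⊥-elim (ℚ.1≢0 (trans (sym (trans (IsBasis.dual basis i i) (δ-refl i)))
          (trans (cong (dot (L i) ∘ g) e) (trans (IsBasis.dual basis i k) (δ-≢ p)))))

    simplex-cong : ∀ {S S′ L} → S ≗ S′ → Simplex S L → Simplex S′ L
    simplex-cong {S} {S′} {L} e s = record
      { basis   = record
        { dual   = λ i k → trans (cong (dot (L i) ∘ g) (sym (e k))) (IsBasis.dual (Simplex.basis s) i k)
        ; expand = λ x l → trans (IsBasis.expand (Simplex.basis s) x l)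
                            (sum-cong λ k → cong (λ j → dot (L k) x * g j l) (e k)) }
      ; optimal = λ j → nonneg-cong order (λ j′ → cong (λ z → δ j j′ - z)
                    (sum-cong λ k → cong (λ w → dot (L k) (g j) * δ w j′) (e k))) (Simplex.optimal s j) }

    times : List (Fin (suc N))
    times = allFin (suc N)

    -- A point of ℚᵐ together with infinitesimal perturbations of decreasing order.
    Perturbed : Set
    Perturbed = Fin (suc N) → Vector ℚ m

    -- Keeps `X` off the walls of all simplices: a coordinate functional is 1 on its own basis
    -- vector, so it cannot vanish on `X` to all orders.
    Generic : Perturbed → Set
    Generic X = ∀ f → (∀ t → dot f (X t) ≡ 0ℚ) → ∀ j → dot f (g j) ≡ 0ℚ

    Covered : Perturbed → Set
    Covered X = Σ (Fin N → Fin (suc N) → ℚ) λ a → (∀ j → NonNeg times (a j)) × (∀ t → X t ≗ combo (λ j → a j t) g)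

    coords : (Fin m → Vector ℚ m) → Perturbed → Fin m → Fin (suc N) → ℚ
    coords L X i t = dot (L i) (X t)

    Contains : (Fin m → Vector ℚ m) → Perturbed → Set
    Contains L X = ∀ i → Pos times (coords L X i)

    -- Two readings: the objective value of the basis `S` at `X`, and the coefficient of `g j` when
    -- the part of `X` of order `t` is written in that basis. Indexing by generators makes it
    -- independent of the order of the basis vectors.
    value : (Fin m → Fin N) → (Fin m → Vector ℚ m) → Perturbed → Fin N × Fin (suc N) → ℚ
    value S L X (j , t) = ∑ λ i → coords L X i t * δ (S i) j

    private
      pairs : List (Fin N × Fin (suc N))
      pairs = cartesianProduct order times

      complete-times : ∀ t → t ∈ times
      complete-times t = ∈-allFin {suc N} t

    -- The costs are linearly independent: component `j` of the reduced cost of a nonbasic `j` is 1.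
    -- So there are no ties, and a pivot strictly increases the objective.
    reducedCost-pos : ∀ {S L} → Simplex S L → ∀ j → (∀ i → S i ≢ j) → Pos order (reducedCost S L j)
    reducedCost-pos {S} {L} s j j∉ with Simplex.optimal s j
    ... | inj₁ p = p
    ... | inj₂ z = ⊥-elim (ℚ.1≢0 (trans (sym e) (z (complete j))))
      where
      e : reducedCost S L j j ≡ 1ℚ
      e = cong₂ _-_ (δ-refl j) (sum-zero λ i → trans (cong (dot (L i) (g j) *_) (δ-≢ (j∉ i))) (ℚ.*-zeroʳ (dot (L i) (g j))))

    reducedCost-pivot : ∀ (S : Fin m → Fin N) (L : Fin m → Vector ℚ m) i j c → dot (L i) (g j) * c ≡ 1ℚ → ∀ k →
      reducedCost S L k ≗ λ j′ → reducedCost (S [ i ]≔ j) (pivot L i (g j) c) k j′ + c * dot (L i) (g k) * reducedCost S L j j′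
    reducedCost-pivot S L i j c e k j′ = sym (begin
      δ k j′ - ∑ (λ l → dot (L′ l) (g k) * δ ((S [ i ]≔ j) l) j′) + c * x * r
        ≡⟨ cong (λ z → δ k j′ - z + c * x * r) (sum-cong λ l → cong (dot (L′ l) (g k) *_) (≔-map (λ j → δ j j′) S i j l)) ⟩
      δ k j′ - ∑ (λ l → dot (L′ l) (g k) * ((λ l → δ (S l) j′) [ i ]≔ δ j j′) l) + c * x * r
        ≡⟨ cong (λ z → δ k j′ - z + c * x * r) (pivot-combo L i (g j) c (g k) (λ l → δ (S l) j′) (δ j j′) e) ⟩
      δ k j′ - (y + c * x * r) + c * x * r
        ≡⟨ lem (δ k j′) y (c * x * r) ⟩
      reducedCost S L k j′ ∎)
      where
      open ≡-Reasoning
      L′ = pivot L i (g j) c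
      x = dot (L i) (g k)
      r = reducedCost S L j j′
      y = ∑ λ l → dot (L l) (g k) * δ (S l) j′
      lem : ∀ a b c → a - (b + c) + c ≡ a - b
      lem = solve-∀ ℚring

    value-pivot : ∀ (S : Fin m → Fin N) (L : Fin m → Vector ℚ m) X i j c → dot (L i) (g j) * c ≡ 1ℚ → ∀ p →
      value (S [ i ]≔ j) (pivot L i (g j) c) X p ≡ value S L X p + reducedCost S L j (proj₁ p) * (c * coords L X i (proj₂ p))
    value-pivot S L X i j c e (j′ , t) = begin
      ∑ (λ l → dot (L′ l) (X t) * δ ((S [ i ]≔ j) l) j′)
        ≡⟨ (sum-cong λ l → cong (dot (L′ l) (X t) *_) (≔-map (λ j → δ j j′) S i j l)) ⟩
      ∑ (λ l → dot (L′ l) (X t) * ((λ l → δ (S l) j′) [ i ]≔ δ j j′) l)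
        ≡⟨ pivot-combo L i (g j) c (X t) (λ l → δ (S l) j′) (δ j j′) e ⟩
      value S L X (j′ , t) + c * dot (L i) (X t) * reducedCost S L j j′
        ≡⟨ cong (value S L X (j′ , t) +_) (ℚ.*-comm (c * dot (L i) (X t)) (reducedCost S L j j′)) ⟩
      value S L X (j′ , t) + reducedCost S L j j′ * (c * dot (L i) (X t)) ∎
      where
      open ≡-Reasoning
      L′ = pivot L i (g j) c

    Increase : ∀ X → (S S′ : Fin m → Fin N) (L L′ : Fin m → Vector ℚ m) → Set
    Increase X S S′ L L′ = Pos pairs (λ p → value S′ L′ X p - value S L X p)

    opaque
      -- The vector with the negative coordinate leaves. The one that enters minimises the ratio of
      -- reduced cost to `- l j` over the generators with `l j < 0`, which keeps all reduced costs
      -- nonnegative. The gain is the reduced cost of `j` times a positive multiple of the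
      -- violation, a product of two lexicographically positive vectors.
      dual-simplex-step : ∀ {S L X} → Simplex S L → Covered X → ∀ i → Pos times (-_ ∘ coords L X i) →
        ∃[ S′ ] ∃[ L′ ] Simplex S′ L′ × Increase X S S′ L L′
      dual-simplex-step {S} {L} {X} s (a , a≥0 , X≡) i neg = result
        where
        l : Fin N → ℚ
        l j = dot (L i) (g j)
        r : Fin N → Fin N → ℚ
        r = reducedCost S L
        ρ : Fin N → Fin N → ℚ
        ρ j j′ = recip (- l j) * r j j′
        -- If `L i` were nonnegative on all generators, it would be nonnegative on `X`, which they
        -- cover.
        some : ∃[ j ] l j < 0ℚ
        some with any? (λ j → l j ℚ.<? 0ℚ)
        ... | yes p = p
        ... | no ¬p = ⊥-elim (¬pos-neg times (nonneg-cong times (λ t → sym (e t)) (nonneg-∑ times (λ j t → l j * a j t)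
                        λ j → nonneg-* times (ℚ.≮⇒≥ λ p → ¬p (j , p)) (a≥0 j))) neg)
          where
          e : ∀ t → coords L X i t ≡ ∑ λ j → l j * a j t
          e t = trans (dot-congʳ (L i) (X≡ t)) (trans (dot-combo (L i) (λ j → a j t) g) (sum-cong λ j → ℚ.*-comm (a j t) (l j)))
        best : ∃[ j ] l j < 0ℚ × (∀ k → l k < 0ℚ → NonNeg order (λ j′ → ρ k j′ - ρ j j′))
        best = argmin (λ j → l j ℚ.<? 0ℚ) (λ j k → nonneg-total order (ρ j) (ρ k)) (λ {i} {j} {k} → nonneg-trans order {ρ i} {ρ j} {ρ k}) some
        j : Fin N
        j = proj₁ best
        lj<0 : l j < 0ℚ
        lj<0 = proj₁ (proj₂ best)
        j-min : ∀ k → l k < 0ℚ → NonNeg order (λ j′ → ρ k j′ - ρ j j′)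
        j-min = proj₂ (proj₂ best)
        c′ : ℚ
        c′ = recip (- l j)
        c : ℚ
        c = - c′
        0<c′ : 0ℚ < c′
        0<c′ = recip-pos (neg-pos lj<0)
        lc : l j * c ≡ 1ℚ
        lc = trans (lem (l j) c′) (recip-inverse (<⇒≢0 (neg-pos lj<0)))
          where
          lem : ∀ a b → a * - b ≡ - a * b
          lem = solve-∀ ℚring
        S′ : Fin m → Fin N
        S′ = S [ i ]≔ j
        L′ : Fin m → Vector ℚ m
        L′ = pivot L i (g j) c
        rj≥0 : NonNeg order (r j)
        rj≥0 = Simplex.optimal s j
        -- `j` is not basic: `L i` takes only the values 0 and 1 on the basis and is negative on
        -- `g j`.
        rj>0 : Pos order (r j)
        rj>0 = reducedCost-pos s j λ k e → ℚ.<-irrefl refl (ℚ.<-≤-trans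
          (subst (_< 0ℚ) (trans (cong (dot (L i) ∘ g) (sym e)) (IsBasis.dual (Simplex.basis s) i k)) lj<0) (0≤δ i k))
        optimal′ : ∀ k → NonNeg order (reducedCost S′ L′ k)
        optimal′ k = nonneg-cong order (λ j′ → eq j′) (by-sign (sign (l k)))
          where
          lem₁ : ∀ a r l c x → a ≡ x + - c * l * r → a + c * l * r ≡ x
          lem₁ a r l c x refl = lem x r l c
            where
            lem : ∀ x r l c → x + - c * l * r + c * l * r ≡ x
            lem = solve-∀ ℚring
          eq : ∀ j′ → r k j′ + c′ * l k * r j j′ ≡ reducedCost S′ L′ k j′
          eq j′ = lem₁ (r k j′) (r j j′) (l k) c′ (reducedCost S′ L′ k j′) (reducedCost-pivot S L i j c lc k j′)
          by-sign : l k < 0ℚ ⊎ 0ℚ ≤ l k → NonNeg order (λ j′ → r k j′ + c′ * l k * r j j′)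
          by-sign (inj₂ p) = nonneg-+ order (Simplex.optimal s k) (nonneg-* order (0≤* (ℚ.<⇒≤ 0<c′) p) rj≥0)
          -- The minimality of the ratio at `j`, multiplied by `- l k`.
          by-sign (inj₁ p) = nonneg-cong order (λ j′ → e j′) (nonneg-* order (ℚ.<⇒≤ (neg-pos p)) (j-min k p))
            where
            lem : ∀ l d r c s → - l * (d * r - c * s) ≡ - l * d * r + c * l * s
            lem = solve-∀ ℚring
            e : ∀ j′ → - l k * (ρ k j′ - ρ j j′) ≡ r k j′ + c′ * l k * r j j′
            e j′ = trans (lem (l k) (recip (- l k)) (r k j′) c′ (r j j′)) (cong (_+ c′ * l k * r j j′)
              (trans (cong (_* r k j′) (recip-inverse (<⇒≢0 (neg-pos p)))) (ℚ.*-identityˡ (r k j′))))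
        basis′ : IsBasis (g ∘ S′) L′
        basis′ = record { dual = λ k k′ → trans (dot-congʳ (L′ k) (λ x → at k′ x)) (IsBasis.dual b k k′)
                        ; expand = λ x y → trans (IsBasis.expand b x y) (sum-cong λ k → cong (dot (L′ k) x *_) (sym (at k y))) }
          where
          b : IsBasis ((g ∘ S) [ i ]≔ g j) L′
          b = pivot-basis i (g j) c lc (Simplex.basis s)
          at : ∀ k → g (S′ k) ≗ ((g ∘ S) [ i ]≔ g j) k
          at k x = cong (λ v → v x) (≔-map g S i j k)
        result : ∃[ S′ ] ∃[ L′ ] Simplex S′ L′ × Increase X S S′ L L′
        result = S′ , L′ , record { basis = basis′ ; optimal = optimal′ } ,
          pos-cong pairs (λ p → sym (trans (cong (_- value S L X p) (value-pivot S L X i j c lc p)) (lem (value S L X p) _)))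
            (pos-⊗ order times rj>0 (pos-cong times (λ t → lem₂ c′ (coords L X i t)) (pos-* times 0<c′ neg)))
          where
          lem : ∀ a b → a + b - a ≡ b
          lem = solve-∀ ℚring
          lem₂ : ∀ a b → a * - b ≡ - a * b
          lem₂ = solve-∀ ℚring

    module _ {X : Perturbed} (generic : Generic X) (covered : Covered X) where

      private
        Code : Set
        Code = Fin (N ℕ.^ m)

        State : Code → Set
        State c = ∃[ L ] Simplex (decode c) L

        -- The dual functionals may be quantified on both sides because the code determines them as
        -- functions. A strict order on a finite set is well-founded in either direction; here this
        -- says that ascending chains of objective values end.
        _⊐_ : Code → Code → Set
        c ⊐ d = Σ (State c) λ s → Σ (State d) λ t → Increase X (decode d) (decode c) (proj₁ t) (proj₁ s)

        value-unique : ∀ {c} (s t : State c) p → value (decode c) (proj₁ s) X p ≡ value (decode c) (proj₁ t) X p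
        value-unique {c} (L , s) (L′ , s′) (j , t) = sum-cong λ i →
          cong (_* δ (decode c i) j) (coords-unique (λ _ _ → refl) (Simplex.basis s) (Simplex.basis s′) i (X t))

        ⊐-trans : ∀ {c d e} → c ⊐ d → d ⊐ e → c ⊐ e
        ⊐-trans {c} {d} {e} (s , t , p) (t′ , u , q) = s , u , pos-cong pairs eq (pos-nonneg-+ pairs p (inj₁ q))
          where
          lem : ∀ a b c → a - b + (b - c) ≡ a - c
          lem = solve-∀ ℚring
          V : ∀ c → State c → _ → ℚ
          V c s p = value (decode c) (proj₁ s) X p
          eq : ∀ p → V c s p - V d t p + (V d t′ p - V e u p) ≡ V c s p - V e u p
          eq p = trans (cong (λ z → V c s p - V d t p + (z - V e u p)) (value-unique {d} t′ t p)) (lem (V c s p) (V d t p) (V e u p))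

        ⊐-irrefl : ∀ {c} → ¬ (c ⊐ c)
        ⊐-irrefl {c} (s , t , p) = pos-zero pairs p λ {x} _ →
          trans (cong (_- value (decode c) (proj₁ t) X x) (value-unique {c} s t x)) (ℚ.+-inverseʳ (value (decode c) (proj₁ t) X x))

        search : ∀ c → Acc _⊐_ c → State c → ∃[ S ] ∃[ L ] Simplex S L × Contains L X
        search c (acc rs) (L , s) with any? (λ i → pos? times (-_ ∘ coords L X i))
        ... | no ¬p = decode c , L , s , inside
          where
          inside : Contains L X
          inside i with pos-trichotomy times (coords L X i)
          ... | inj₁ p        = p
          ... | inj₂ (inj₂ p) = ⊥-elim (¬p (i , p))
          -- A coordinate vanishing to all orders would, by genericity, vanish on its own basis
          -- vector, where it is 1.
          ... | inj₂ (inj₁ z) = ⊥-elim (ℚ.1≢0 (trans (sym (trans (IsBasis.dual (Simplex.basis s) i i) (δ-refl i)))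
                                  (generic (L i) (λ t → z (complete-times t)) (decode c i))))
        ... | yes (i , p) with dual-simplex-step s covered i p
        ...   | S′ , L′ , s′ , inc = search (encode S′) (rs (t , (L , s) , pos-cong pairs e inc)) t
          where
          t : State (encode S′)
          t = L′ , simplex-cong (sym ∘ decode-encode S′) s′
          e : ∀ p → value S′ L′ X p - value (decode c) L X p ≡ value (decode (encode S′)) L′ X p - value (decode c) L X p
          e (j , τ) = cong (_- value (decode c) L X (j , τ))
            (sum-cong λ k → cong (λ w → coords L′ X k τ * δ w j) (sym (decode-encode S′ k)))

        ⊐-wellFounded : ∀ c → Acc _⊐_ c
        ⊐-wellFounded = spo-wellFounded {_⊏_ = _⊐_} record
          { isEquivalence = isEquivalence
          ; irrefl        = λ { {c} refl → ⊐-irrefl {c} }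
          ; trans         = λ {c} {d} {e} → ⊐-trans {c} {d} {e}
          ; <-resp-≈      = (λ { refl r → r }) , λ { refl r → r } }

      locate : ∀ {S L} → Simplex S L → ∃[ S′ ] ∃[ L′ ] Simplex S′ L′ × Contains L′ X
      locate {S} {L} s = search (encode S) (⊐-wellFounded (encode S)) (L , simplex-cong (sym ∘ decode-encode S) s)

    -- Weak duality: the difference of the objectives is the sum of the reduced costs, with respect
    -- to `S`, of the vectors of `S′`, weighted by the coordinates of `X` in `S′`. Both factors are
    -- nonnegative.
    value-≥ : ∀ {X S L S′ L′} → Simplex S L → Simplex S′ L′ → (∀ i → NonNeg times (coords L′ X i)) →
      NonNeg pairs (λ p → value S′ L′ X p - value S L X p)
    value-≥ {X} {S} {L} {S′} {L′} s s′ κ≥0 = nonneg-cong pairs (λ p → e p)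
      (nonneg-∑ pairs (λ k (j , t) → r (S′ k) j * coords L′ X k t)
        λ k → nonneg-⊗ order times complete complete-times (Simplex.optimal s (S′ k)) (κ≥0 k))
      where
      open ≡-Reasoning
      r = reducedCost S L
      lem : ∀ a b c → (a - b) * c ≡ c * a - c * b
      lem = solve-∀ ℚring
      lem₂ : ∀ a b c → a * (b * c) ≡ a * b * c
      lem₂ = solve-∀ ℚring
      inner : ∀ j t → ∑ (λ k → coords L′ X k t * ∑ (λ i → dot (L i) (g (S′ k)) * δ (S i) j)) ≡ value S L X (j , t)
      inner j t = begin
        ∑ (λ k → κ k * ∑ (λ i → dot (L i) (g (S′ k)) * δ (S i) j))
          ≡⟨ (sum-cong λ k → sym (sum-*ˡ (κ k) (λ i → dot (L i) (g (S′ k)) * δ (S i) j))) ⟩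
        ∑ (λ k → ∑ (λ i → κ k * (dot (L i) (g (S′ k)) * δ (S i) j)))
          ≡⟨ ∑-swap (λ k i → κ k * (dot (L i) (g (S′ k)) * δ (S i) j)) ⟩
        ∑ (λ i → ∑ (λ k → κ k * (dot (L i) (g (S′ k)) * δ (S i) j)))
          ≡⟨ (sum-cong λ i → trans (sum-cong λ k → lem₂ (κ k) (dot (L i) (g (S′ k))) (δ (S i) j))
               (sum-*ʳ (δ (S i) j) (λ k → κ k * dot (L i) (g (S′ k))))) ⟩
        ∑ (λ i → ∑ (λ k → κ k * dot (L i) (g (S′ k))) * δ (S i) j)
          ≡⟨ (sum-cong λ i → cong (_* δ (S i) j) (trans (sym (dot-combo (L i) κ (g ∘ S′)))
               (dot-congʳ (L i) (λ l → sym (IsBasis.expand (Simplex.basis s′) (X t) l))))) ⟩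
        value S L X (j , t) ∎
        where
        κ : Fin m → ℚ
        κ k = coords L′ X k t
      e : ∀ p → ∑ (λ k → r (S′ k) (proj₁ p) * coords L′ X k (proj₂ p)) ≡ value S′ L′ X p - value S L X p
      e (j , t) = begin
        ∑ (λ k → r (S′ k) j * coords L′ X k t)
          ≡⟨ (sum-cong λ k → lem (δ (S′ k) j) (∑ λ i → dot (L i) (g (S′ k)) * δ (S i) j) (coords L′ X k t)) ⟩
        ∑ (λ k → coords L′ X k t * δ (S′ k) j - coords L′ X k t * ∑ (λ i → dot (L i) (g (S′ k)) * δ (S i) j))
          ≡⟨ sum-minus (λ k → coords L′ X k t * δ (S′ k) j) _ ⟩
        value S′ L′ X (j , t) - ∑ (λ k → coords L′ X k t * ∑ (λ i → dot (L i) (g (S′ k)) * δ (S i) j))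
          ≡⟨ cong (λ z → value S′ L′ X (j , t) - z) (inner j t) ⟩
        value S′ L′ X (j , t) - value S L X (j , t) ∎

    -- Weak duality in both directions. This plays the part of the disjointness of the half-open
    -- simplices: the coefficients of `X` do not depend on which simplex containing it is found.
    value-unique : ∀ {X S L S′ L′} → Simplex S L → Simplex S′ L′ → Contains L X → Contains L′ X →
      value S L X ≗ value S′ L′ X
    value-unique {X} {S} {L} {S′} {L′} s s′ κ κ′ (j , t)
      with value-≥ {X} s s′ (inj₁ ∘ κ′) | value-≥ {X} s′ s (inj₁ ∘ κ)
    ... | inj₂ z | _      = sym (x-y≡0⇒x≡y (value S′ L′ X (j , t)) (value S L X (j , t)) (z (∈-cartesianProduct⁺ (complete j) (complete-times t))))
      where
      lem : ∀ a b → a ≡ a - b + b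
      lem = solve-∀ ℚring
      x-y≡0⇒x≡y : ∀ a b → a - b ≡ 0ℚ → a ≡ b
      x-y≡0⇒x≡y a b e = trans (lem a b) (trans (cong (_+ b) e) (ℚ.+-identityˡ b))
    ... | inj₁ p | q = ⊥-elim (¬pos-neg pairs q (pos-cong pairs (λ x → lem (value S′ L′ X x) (value S L X x)) p))
      where
      lem : ∀ a b → a - b ≡ - (b - a)
      lem = solve-∀ ℚring

    value-at : ∀ {X S L} → Simplex S L → ∀ i t → value S L X (S i , t) ≡ coords L X i t
    value-at {X} {S} {L} s i t = trans (sum-cong λ k → cong (coords L X k t *_) (eq k)) (sum-δʳ i (λ k → coords L X k t))
      where
      eq : ∀ k → δ (S k) (S i) ≡ δ k i
      eq k = by-cases (k ≟ i) (λ { refl → trans (δ-refl (S i)) (sym (δ-refl i)) })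
        λ p → trans (δ-≢ (p ∘ Simplex.injective s)) (sym (δ-≢ p))

    value-off : ∀ {X S L} j t → (∀ i → S i ≢ j) → value S L X (j , t) ≡ 0ℚ
    value-off {X} {S} {L} j t p = sum-zero λ i → trans (cong (coords L X i t *_) (δ-≢ (p i))) (ℚ.*-zeroʳ (coords L X i t))

  -- Multiplication by 1 - t

  difference : Series → Series
  difference f zero    = f zero
  difference f (suc h) = f (suc h) ℤ.- f h

  ⊛-cong : ∀ {f f′ g g′} → f ≗ f′ → g ≗ g′ → f ⊛ g ≗ f′ ⊛ g′
  ⊛-cong e e′ h = ℤsum.sum-cong-≗ {suc h} λ i → cong₂ ℤ._*_ (e (toℕ i)) (e′ (h ℕ.∸ toℕ i))

  difference-cong : ∀ {f g} → f ≗ g → difference f ≗ difference g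
  difference-cong e zero    = e zero
  difference-cong e (suc h) = cong₂ ℤ._-_ (e (suc h)) (e h)

  sumℤ-minus : ∀ {n} (f g : Fin n → ℤ) → ℤsum.sum (λ i → f i ℤ.- g i) ≡ ℤsum.sum f ℤ.- ℤsum.sum g
  sumℤ-minus {zero}  f g = refl
  sumℤ-minus {suc n} f g = trans (cong (λ z → f zero ℤ.- g zero ℤ.+ z) (sumℤ-minus (f ∘ suc) (g ∘ suc)))
    (lem (f zero) (g zero) (ℤsum.sum (f ∘ suc)) (ℤsum.sum (g ∘ suc)))
    where
    lem : ∀ a b c d → a ℤ.- b ℤ.+ (c ℤ.- d) ≡ a ℤ.+ c ℤ.- (b ℤ.+ d)
    lem = ℤsolver.solve-∀

  1-t⊛ : ∀ f → 1-t ⊛ f ≗ difference f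
  1-t⊛ f zero    = lem (f 0)
    where
    lem : ∀ a → ℤ.1ℤ ℤ.* a ℤ.+ ℤ.0ℤ ≡ a
    lem = ℤsolver.solve-∀
  1-t⊛ f (suc h) = trans (cong (λ z → ℤ.1ℤ ℤ.* f (suc h) ℤ.+ (ℤ.-1ℤ ℤ.* f h ℤ.+ z))
      (trans (ℤsum.sum-cong-≗ {h} λ i → ℤ.*-zeroˡ (f (h ℕ.∸ suc (toℕ i)))) (ℤsum.sum-replicate-zero h)))
    (lem (f (suc h)) (f h))
    where
    lem : ∀ a b → ℤ.1ℤ ℤ.* a ℤ.+ (ℤ.-1ℤ ℤ.* b ℤ.+ ℤ.0ℤ) ≡ a ℤ.- b
    lem = ℤsolver.solve-∀

  difference-⊛ : ∀ f g → difference f ⊛ g ≗ difference (f ⊛ g)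
  difference-⊛ f g zero    = refl
  difference-⊛ f g (suc h) = begin
    a ℤ.+ ℤsum.sum (λ (i : Fin (suc h)) → (f (suc (toℕ i)) ℤ.- f (toℕ i)) ℤ.* g (h ℕ.∸ toℕ i))
      ≡⟨ cong (λ z → a ℤ.+ z) (trans (ℤsum.sum-cong-≗ {suc h} λ i → lem₁ (f (suc (toℕ i))) (f (toℕ i)) (g (h ℕ.∸ toℕ i))) (sumℤ-minus b c)) ⟩
    a ℤ.+ (ℤsum.sum b ℤ.- ℤsum.sum c)
      ≡⟨ lem₂ a (ℤsum.sum b) (ℤsum.sum c) ⟩
    a ℤ.+ ℤsum.sum b ℤ.- ℤsum.sum c ∎
    where
    open ≡-Reasoning
    a : ℤ
    a = f 0 ℤ.* g (suc h)
    b c : Fin (suc h) → ℤ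
    b i = f (suc (toℕ i)) ℤ.* g (h ℕ.∸ toℕ i)
    c i = f (toℕ i) ℤ.* g (h ℕ.∸ toℕ i)
    lem₁ : ∀ a b c → (a ℤ.- b) ℤ.* c ≡ a ℤ.* c ℤ.- b ℤ.* c
    lem₁ = ℤsolver.solve-∀
    lem₂ : ∀ a b c → a ℤ.+ (b ℤ.- c) ≡ a ℤ.+ b ℤ.- c
    lem₂ = ℤsolver.solve-∀

  iterated-difference : ∀ (F : ℕ → Series) m → (∀ k → k ℕ.< m → difference (F k) ≗ F (suc k)) →
    (1-t ^ˢ m) ⊛ F 0 ≗ F m
  iterated-difference F zero    step h = trans (cong (λ z → ℤ.1ℤ ℤ.* F 0 h ℤ.+ z)
      (trans (ℤsum.sum-cong-≗ {h} λ i → ℤ.*-zeroˡ (F 0 (h ℕ.∸ suc (toℕ i)))) (ℤsum.sum-replicate-zero h)))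
    (lem (F 0 h))
    where
    lem : ∀ a → ℤ.1ℤ ℤ.* a ℤ.+ ℤ.0ℤ ≡ a
    lem = ℤsolver.solve-∀
  iterated-difference F (suc m) step h = begin
    ((1-t ⊛ (1-t ^ˢ m)) ⊛ F 0) h          ≡⟨ ⊛-cong {g = F 0} (1-t⊛ (1-t ^ˢ m)) (λ _ → refl) h ⟩
    (difference (1-t ^ˢ m) ⊛ F 0) h       ≡⟨ difference-⊛ (1-t ^ˢ m) (F 0) h ⟩
    difference ((1-t ^ˢ m) ⊛ F 0) h       ≡⟨ difference-cong (iterated-difference F m λ k lt → step k (ℕ.m<n⇒m<1+n lt)) h ⟩
    difference (F m) h                    ≡⟨ step m (ℕ.n<1+n m) h ⟩
    F (suc m) h                           ∎
    where open ≡-Reasoning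

  -- A graded set whose elements carry an m-element support; an element may be
  -- divided by the members of its support, independently of each other, until
  -- they are no longer removable.
  record Divisible (m : ℕ) (card : ℕ → ℕ) : Set₁ where
    field
      N         : ℕ
      support   : ∀ {h} → Fin (card h) → Fin N → Bool
      removable : ∀ {h} → Fin (card h) → Fin N → Bool
      size      : ∀ {h} (x : Fin (card h)) → cardinality (support x) ≡ m
      -- `Quotient j x y` reads: `x` is `y` multiplied by `j`.
      Quotient  : ∀ {h} → Fin N → Fin (card (suc h)) → Fin (card h) → Set
      support-≗ : ∀ {h j x y} → Quotient {h} j x y → support x ≗ support y
      by-self   : ∀ {h j x y} → Quotient {h} j x y → T (removable x j)
      by-other  : ∀ {h j x y} → Quotient {h} j x y → ∀ {k} → k ≢ j → removable x k ≡ removable y k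
      unique    : ∀ {h j x x′ y} → Quotient {h} j x y → Quotient j x′ y → x ≡ x′
      unique′   : ∀ {h j x y y′} → Quotient {h} j x y → Quotient j x y′ → y ≡ y′
      divide    : ∀ {h j} (x : Fin (card (suc h))) → T (support x j) → T (removable x j) → ∃ (Quotient j x)
      multiply  : ∀ {h j} (y : Fin (card h)) → T (support y j) → ∃ λ x → Quotient j x y
      bottom    : ∀ {j} (x : Fin (card 0)) → T (support x j) → ¬ T (removable x j)

    -- Supports vary with the element, so their members are addressed by rank: stage `k` forbids
    -- division by the first `k` members of each element's own support.
    Reduced : ℕ → ∀ {h} → Fin (card h) → Set
    Reduced k x = ∀ j → T (support x j) → rank (support x) j ℕ.< k → ¬ T (removable x j)

    reduced? : ∀ k {h} (x : Fin (card h)) → Dec (Reduced k x)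
    reduced? k x = all? λ j → T? (support x j) →-dec (rank (support x) j ℕ.<? k →-dec ¬? (T? (removable x j)))

    private
      R : ℕ → ∀ {h} → Fin (card h) → Bool
      R k x = does (reduced? k x)

      reducedCount : ℕ → ℕ → ℕ
      reducedCount k h = cardinality (R k {h})

      weaken : ∀ {k h} {x : Fin (card h)} → Reduced (suc k) x → Reduced k x
      weaken r j s lt = r j s (ℕ.m<n⇒m<1+n lt)

      strengthen : ∀ {k h} (x : Fin (card h)) → Reduced k x →
        (∀ j → T (support x j) → rank (support x) j ≡ k → ¬ T (removable x j)) → Reduced (suc k) x
      strengthen x r n j s lt with ℕ.m≤n⇒m<n∨m≡n (ℕ.s≤s⁻¹ lt)
      ... | inj₁ lt′ = r j s lt′
      ... | inj₂ e   = n j s e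

      both : ∀ k h → cardinality (λ x → R k {h} x ∧ R (suc k) x) ≡ reducedCount (suc k) h
      both k h = ℕ.≤-antisym
        (count-⊆ _ (R (suc k)) λ x t → proj₂ (T-∧⁻ {R k x} t))
        (count-⊆ (R (suc k)) _ λ x t → T-∧⁺ (does-T (reduced? k x) (weaken (T-does (reduced? (suc k) x) t))) t)

      Obstructed : ∀ k {h} → Fin (card h) → Set
      Obstructed k x = ∃[ j ] T (support x j) × rank (support x) j ≡ k × T (removable x j)

      obstructed : ∀ {k} h (x : Fin (card h)) → k ℕ.< m → T (R k x ∧ not (R (suc k) x)) → Reduced k x × Obstructed k x
      obstructed {k} h x k<m t with T-∧⁻ {R k x} t | rank-exists (support x) k (subst (k ℕ.<_) (sym (size x)) k<m)
      ... | r , ¬r | j , s , e with T? (removable x j)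
      ...   | yes v = T-does (reduced? k x) r , j , s , e , v
      ...   | no ¬v = ⊥-elim (T-not⁻ ¬r (does-T (reduced? (suc k) x) (strengthen x (T-does (reduced? k x) r)
                        λ j′ s′ e′ v → ¬v (subst (T ∘ removable x) (rank-injective (support x) j′ j s′ s (trans e′ (sym e))) v))))

      obstructed⁻ : ∀ {k} h (x : Fin (card h)) → Reduced k x → Obstructed k x → T (R k x ∧ not (R (suc k) x))
      obstructed⁻ {k} h x r (j , s , e , v) = T-∧⁺ (does-T (reduced? k x) r)
        (T-not λ t → T-does (reduced? (suc k) x) t j s (ℕ.s≤s (ℕ.≤-reflexive e)) v)

      -- Division by the member of rank `k` changes neither the support nor the removability of the
      -- members before it.
      quotient-reduced : ∀ {k h j x y} → Quotient {h} j x y → rank (support x) j ≡ k → (Reduced k x → Reduced k y) × (Reduced k y → Reduced k x)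
      quotient-reduced {k} {h} {j} {x} {y} q e =
        (λ r j′ s lt v → let lt′ = subst (ℕ._< k) (sym (rank-cong (support-≗ q) j′)) lt in
           r j′ (subst T (sym (support-≗ q j′)) s) lt′ (subst T (sym (by-other q (≢j lt′))) v)) ,
        (λ r j′ s lt v → r j′ (subst T (support-≗ q j′) s) (subst (ℕ._< k) (rank-cong (support-≗ q) j′) lt)
           (subst T (by-other q (≢j lt)) v))
        where
        ≢j : ∀ {j′} → rank (support x) j′ ℕ.< k → j′ ≢ j
        ≢j lt refl = ℕ.<-irrefl e lt

      -- Division by the member of rank `k` and multiplication by it are injections in opposite
      -- directions: what stage `suc k` discards at height `suc h` is a copy of stage `k` at height
      -- `h`.
      fibre : ∀ k h → k ℕ.< m → cardinality (λ x → R k {suc h} x ∧ not (R (suc k) x)) ≡ reducedCount k h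
      fibre k h k<m = ℕ.≤-antisym
        (count-injection _ (R k) (λ x t → proj₁ (to x t)) (λ x t → does-T (reduced? k _) (to-reduced x t)) to-injective)
        (count-injection (R k) _ (λ y t → proj₁ (from y t)) from-good from-injective)
        where
        to : ∀ x → T (R k {suc h} x ∧ not (R (suc k) x)) →
          ∃[ y ] ∃[ j ] Quotient {h} j x y × T (support x j) × rank (support x) j ≡ k × Reduced k x
        to x t = let r , j , s , e , v = obstructed (suc h) x k<m t
                     y , q = divide x s v
                 in y , j , q , s , e , r
        to-reduced : ∀ x t → Reduced k (proj₁ (to x t))
        to-reduced x t = let y , j , q , s , e , r = to x t in proj₁ (quotient-reduced q e) r
        to-injective : ∀ x x′ t t′ → proj₁ (to x t) ≡ proj₁ (to x′ t′) → x ≡ x′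
        to-injective x x′ t t′ = helper (to x t) (to x′ t′)
          where
          Image : Fin (card (suc h)) → Set
          Image x = ∃[ y ] ∃[ j ] Quotient {h} j x y × T (support x j) × rank (support x) j ≡ k × Reduced k x
          helper : (u : Image x) (u′ : Image x′) → proj₁ u ≡ proj₁ u′ → x ≡ x′
          helper (y , j , q , s , e , _) (_ , j′ , q′ , s′ , e′ , _) refl
            with rank-injective (support y) j j′ (subst T (support-≗ q j) s) (subst T (support-≗ q′ j′) s′)
                   (trans (sym (rank-cong (support-≗ q) j)) (trans e (trans (sym e′) (rank-cong (support-≗ q′) j′))))
          ... | refl = unique q q′
        next : ∀ y → ∃[ j ] T (support {h} y j) × rank (support y) j ≡ k
        next y = rank-exists (support y) k (subst (k ℕ.<_) (sym (size y)) k<m)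
        from : ∀ y → T (R k {h} y) → ∃ λ x → Quotient (proj₁ (next y)) x y
        from y t = multiply y (proj₁ (proj₂ (next y)))
        from-rank : ∀ y t → rank (support (proj₁ (from y t))) (proj₁ (next y)) ≡ k
        from-rank y t = trans (rank-cong (support-≗ (proj₂ (from y t))) (proj₁ (next y))) (proj₂ (proj₂ (next y)))
        from-good : ∀ y t → T (R k (proj₁ (from y t)) ∧ not (R (suc k) (proj₁ (from y t))))
        from-good y t = obstructed⁻ (suc h) (proj₁ (from y t))
          (proj₂ (quotient-reduced (proj₂ (from y t)) (from-rank y t)) (T-does (reduced? k y) t))
          (proj₁ (next y) , subst T (sym (support-≗ (proj₂ (from y t)) _)) (proj₁ (proj₂ (next y))) , from-rank y t , by-self (proj₂ (from y t)))
        from-injective : ∀ y y′ t t′ → proj₁ (from y t) ≡ proj₁ (from y′ t′) → y ≡ y′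
        from-injective y y′ t t′ eq = unique′ q (subst (λ j → Quotient j x y′) j≡ q′)
          where
          x = proj₁ (from y t)
          q = proj₂ (from y t)
          q′ = subst (λ x → Quotient (proj₁ (next y′)) x y′) (sym eq) (proj₂ (from y′ t′))
          j≡ : proj₁ (next y′) ≡ proj₁ (next y)
          j≡ = rank-injective (support x) _ _ (subst T (sym (support-≗ q′ _)) (proj₁ (proj₂ (next y′))))
            (subst T (sym (support-≗ q _)) (proj₁ (proj₂ (next y))))
            (trans (trans (rank-cong (support-≗ q′) (proj₁ (next y′))) (proj₂ (proj₂ (next y′)))) (sym (from-rank y t)))

      no-fibre : ∀ k → k ℕ.< m → cardinality (λ x → R k {0} x ∧ not (R (suc k) x)) ≡ 0
      no-fibre k k<m = count-false λ x t → case obstructed 0 x k<m t of λ { (_ , j , s , _ , v) → bottom x s v }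

      -- Each stage accounts for one factor `1 - t`: the elements lost between two stages are the
      -- earlier stage shifted by one height, and at height 0 nothing is lost.
      recurrence : ∀ k → k ℕ.< m → difference (λ h → ℤ.+ reducedCount k h) ≗ λ h → ℤ.+ reducedCount (suc k) h
      recurrence k k<m zero    = cong ℤ.+_ (trans (count-split (R k {0}) (R (suc k)))
        (trans (cong₂ ℕ._+_ (both k 0) (no-fibre k k<m)) (ℕ.+-identityʳ (reducedCount (suc k) 0))))
      recurrence k k<m (suc h) = trans (cong (λ z → z ℤ.- ℤ.+ reducedCount k h)
          (trans (cong ℤ.+_ (trans (count-split (R k {suc h}) (R (suc k))) (cong₂ ℕ._+_ (both k (suc h)) (fibre k h k<m))))
                 (ℤ.pos-+ (reducedCount (suc k) (suc h)) (reducedCount k h))))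
        (lem (ℤ.+ reducedCount (suc k) (suc h)) (ℤ.+ reducedCount k h))
        where
        lem : ∀ a b → a ℤ.+ b ℤ.- b ≡ a
        lem = ℤsolver.solve-∀

      initial : ∀ h → reducedCount 0 h ≡ card h
      initial h = trans (count-cong {q = λ _ → true} λ x → dec-true (reduced? 0 x) λ _ _ ()) (count-all (card h))

    -- So (1 - t)ᵐ Σ card(h) tʰ counts the elements that cannot be divided.
    h*-coefficient : ∀ {h} (x : Fin (card h)) → (∀ j → T (support x j) → ¬ T (removable x j)) →
      ((1-t ^ˢ m) ⊛ (λ h → ℤ.+ card h)) h ≢ ℤ.0ℤ
    h*-coefficient {h} x r e = ℕ.<-irrefl (sym (ℤ.+-injective (trans (sym eq) e))) (count-pos (R m) x (does-T (reduced? m x) λ j s _ → r j s))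
      where
      eq : ((1-t ^ˢ m) ⊛ (λ h → ℤ.+ card h)) h ≡ ℤ.+ reducedCount m h
      eq = trans (⊛-cong {f = 1-t ^ˢ m} (λ _ → refl) (λ h → cong ℤ.+_ (sym (initial h))) h)
        (iterated-difference (λ k h → ℤ.+ reducedCount k h) m recurrence h)

  -- Integers in ℚ

  opaque
    int : ℤ → ℚ
    int z = z / 1

    int≡/1 : ∀ z → int z ≡ z / 1
    int≡/1 z = refl

    int-0 : int ℤ.0ℤ ≡ 0ℚ
    int-0 = refl

    int-1 : int ℤ.1ℤ ≡ 1ℚ
    int-1 = refl

    private
      toℚᵘ-int : ∀ z → toℚᵘ (z / 1) ℚᵘ.≃ ℚᵘ.mkℚᵘ z 0
      toℚᵘ-int z = ℚ.toℚᵘ-fromℚᵘ (ℚᵘ.mkℚᵘ z 0)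

    int-+ : ∀ a b → int (a ℤ.+ b) ≡ int a + int b
    int-+ a b = ℚ.toℚᵘ-injective (ℚᵘ.≃-trans (toℚᵘ-int (a ℤ.+ b))
      (ℚᵘ.≃-trans (ℚᵘ.*≡* (cong (ℤ._* ℤ.1ℤ) (sym (cong₂ ℤ._+_ (ℤ.*-identityʳ a) (ℤ.*-identityʳ b)))))
      (ℚᵘ.≃-sym (ℚᵘ.≃-trans (ℚ.toℚᵘ-homo-+ (a / 1) (b / 1)) (ℚᵘ.+-cong (toℚᵘ-int a) (toℚᵘ-int b))))))

    int-* : ∀ a b → int (a ℤ.* b) ≡ int a * int b
    int-* a b = ℚ.toℚᵘ-injective (ℚᵘ.≃-trans (toℚᵘ-int (a ℤ.* b))
      (ℚᵘ.≃-sym (ℚᵘ.≃-trans (ℚ.toℚᵘ-homo-* (a / 1) (b / 1)) (ℚᵘ.*-cong (toℚᵘ-int a) (toℚᵘ-int b)))))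

    int-injective : ∀ {a b} → int a ≡ int b → a ≡ b
    int-injective {a} {b} e with ℚᵘ.≃-trans (ℚᵘ.≃-sym (toℚᵘ-int a)) (ℚᵘ.≃-trans (ℚ.toℚᵘ-cong e) (toℚᵘ-int b))
    ... | ℚᵘ.*≡* p = ℤ.*-cancelʳ-≡ a b ℤ.1ℤ p

    int-mono-≤ : ∀ {a b} → a ℤ.≤ b → int a ≤ int b
    int-mono-≤ {a} {b} p = ℚ.toℚᵘ-cancel-≤ (ℚᵘ.≤-respˡ-≃ (ℚᵘ.≃-sym (toℚᵘ-int a)) (ℚᵘ.≤-respʳ-≃ (ℚᵘ.≃-sym (toℚᵘ-int b))
      (ℚᵘ.*≤* (subst₂ ℤ._≤_ (sym (ℤ.*-identityʳ a)) (sym (ℤ.*-identityʳ b)) p))))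

    int-cancel-≤ : ∀ {a b} → int a ≤ int b → a ℤ.≤ b
    int-cancel-≤ {a} {b} p with ℚᵘ.≤-respˡ-≃ (toℚᵘ-int a) (ℚᵘ.≤-respʳ-≃ (toℚᵘ-int b) (ℚ.toℚᵘ-mono-≤ p))
    ... | ℚᵘ.*≤* q = subst₂ ℤ._≤_ (ℤ.*-identityʳ a) (ℤ.*-identityʳ b) q

    archimedean : ∀ q → ∃[ k ] q < int (ℤ.+ k)
    -- One more than the absolute value of the numerator suffices, since denominators are at least
    -- 1.
    archimedean q = suc ℤ.∣ ↥ q ∣ , ℚ.toℚᵘ-cancel-< (ℚᵘ.<-respʳ-≃ (ℚᵘ.≃-sym (toℚᵘ-int (ℤ.+ suc ℤ.∣ ↥ q ∣)))
      (ℚᵘ.*<* (subst₂ ℤ._<_ (sym (trans (cong (ℤ._* ℤ.1ℤ) (ℚ.↥ᵘ-toℚᵘ q)) (ℤ.*-identityʳ (↥ q)))) (cong (ℤ.+ suc ℤ.∣ ↥ q ∣ ℤ.*_) (sym (ℚ.↧ᵘ-toℚᵘ q)))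
        (ℤ.<-≤-trans (ℤ.≤-<-trans (i≤∣i∣ (↥ q)) (ℤ.+<+ (ℕ.n<1+n ℤ.∣ ↥ q ∣)))
          (subst (ℤ.+ suc ℤ.∣ ↥ q ∣ ℤ.≤_) (ℤ.pos-* (suc ℤ.∣ ↥ q ∣) (↧ₙ q)) (ℤ.+≤+ (ℕ.m≤m*n (suc ℤ.∣ ↥ q ∣) (↧ₙ q))))))))
      where
      i≤∣i∣ : ∀ i → i ℤ.≤ ℤ.+ ℤ.∣ i ∣
      i≤∣i∣ (ℤ.+ n)     = ℤ.≤-refl
      i≤∣i∣ ℤ.-[1+ n ] = ℤ.-≤+

  int-neg : ∀ a → int (ℤ.- a) ≡ - int a
  int-neg a = trans (lem (int (ℤ.- a)) (int a)) (trans (cong (_- int a) (trans (sym (int-+ (ℤ.- a) a))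
    (trans (cong int (ℤ.+-inverseˡ a)) int-0))) (ℚ.+-identityˡ (- int a)))
    where
    lem : ∀ a b → a ≡ a + b - b
    lem = solve-∀ ℚring

  0≤int : ∀ k → 0ℚ ≤ int (ℤ.+ k)
  0≤int k = subst (_≤ int (ℤ.+ k)) int-0 (int-mono-≤ {ℤ.0ℤ} (ℤ.+≤+ ℕ.z≤n))

  int-suc : ∀ k → int (ℤ.+ suc k) ≡ 1ℚ + int (ℤ.+ k)
  int-suc k = trans (int-+ ℤ.1ℤ (ℤ.+ k)) (cong (_+ int (ℤ.+ k)) int-1)

  Int : ℚ → Set
  Int q = ∃[ z ] q ≡ int z

  Int-int : ∀ z → Int (int z)
  Int-int z = z , refl

  Int-0 : Int 0ℚ
  Int-0 = ℤ.0ℤ , sym int-0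

  Int-1 : Int 1ℚ
  Int-1 = ℤ.1ℤ , sym int-1

  Int-+ : ∀ {p q} → Int p → Int q → Int (p + q)
  Int-+ (a , refl) (b , refl) = a ℤ.+ b , sym (int-+ a b)

  Int-* : ∀ {p q} → Int p → Int q → Int (p * q)
  Int-* (a , refl) (b , refl) = a ℤ.* b , sym (int-* a b)

  Int-neg : ∀ {p} → Int p → Int (- p)
  Int-neg (a , refl) = ℤ.- a , sym (int-neg a)

  Int-minus : ∀ {p q} → Int p → Int q → Int (p - q)
  Int-minus p q = Int-+ p (Int-neg q)

  Int-≡ : ∀ {p q} → p ≡ q → Int p → Int q
  Int-≡ refl p = p

  Int-∑ : ∀ {n} (f : Vector ℚ n) → (∀ i → Int (f i)) → Int (∑ f)
  Int-∑ f p = subst Int (sym (∑≡sum f)) (go f p)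
    where
    go : ∀ {n} (f : Vector ℚ n) → (∀ i → Int (f i)) → Int (sum f)
    go {zero}  f p = Int-0
    go {suc n} f p = Int-+ (p zero) (go (f ∘ suc) (p ∘ suc))

  Int-dot : ∀ {n} (f x : Vector ℚ n) → (∀ i → Int (f i)) → (∀ i → Int (x i)) → Int (dot f x)
  Int-dot f x p q = subst Int (sym (dot≡∑ f x)) (Int-∑ _ λ i → Int-* (p i) (q i))

  Int-δ : ∀ {n} (i j : Fin n) → Int (δ i j)
  Int-δ i j with does (i ≟ j)
  ... | true  = Int-1
  ... | false = Int-0

  Int-nonneg : ∀ {p} → Int p → 0ℚ ≤ p → ∃[ k ] p ≡ int (ℤ.+ k)
  Int-nonneg (ℤ.+ k , e)     _ = k , e
  Int-nonneg (ℤ.-[1+ k ] , e) p with int-cancel-≤ (subst₂ _≤_ (sym int-0) e p)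
  ... | ()

  least : ∀ {P : ℕ → Set} → (∀ k → Dec (P k)) → ∀ k → P k → ∃[ l ] P l × (∀ j → j ℕ.< l → ¬ P j)
  least P? zero    p = zero , p , λ _ ()
  least P? (suc k) p with P? zero
  ... | yes p₀ = zero , p₀ , λ _ ()
  ... | no ¬p₀ with least (P? ∘ suc) k p
  ...   | l , q , min = suc l , q , λ { zero _ → ¬p₀ ; (suc j) (ℕ.s≤s lt) → min j lt }

  -- Shifting `q` by a natural number above `- q` makes it positive; the least natural number
  -- exceeding the result is one more than its floor.
  floor : ∀ q → ∃[ z ] 0ℚ ≤ q - int z × q - int z < 1ℚ
  floor q = result (least (λ k → x ℚ.<? int (ℤ.+ k)) (proj₁ (archimedean x)) (proj₂ (archimedean x)))
    where
    M : ℕ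
    M = proj₁ (archimedean (- q))
    x : ℚ
    x = q + int (ℤ.+ M)
    0<x : 0ℚ < x
    0<x = subst (0ℚ <_) (lem (int (ℤ.+ M)) q) (0<- (proj₂ (archimedean (- q))))
      where
      lem : ∀ a b → a - - b ≡ b + a
      lem = solve-∀ ℚring
    result : (∃[ l ] x < int (ℤ.+ l) × (∀ j → j ℕ.< l → ¬ (x < int (ℤ.+ j)))) → ∃[ z ] 0ℚ ≤ q - int z × q - int z < 1ℚ
    result (zero , p , _) = ⊥-elim (ℚ.<-asym 0<x (subst (x <_) int-0 p))
    result (suc l , p , min) = z , subst (0ℚ ≤_) (sym e) (0≤- (ℚ.≮⇒≥ (min l (ℕ.n<1+n l)))) ,
      subst₂ _<_ (sym e) (lem₂ (int (ℤ.+ l))) (ℚ.+-monoˡ-< (- int (ℤ.+ l)) (subst (x <_) (int-suc l) p))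
      where
      z : ℤ
      z = ℤ.+ l ℤ.- ℤ.+ M
      lem : ∀ q l m → q - (l + - m) ≡ q + m - l
      lem = solve-∀ ℚring
      lem₂ : ∀ a → 1ℚ + a - a ≡ 1ℚ
      lem₂ = solve-∀ ℚring
      e : q - int z ≡ x - int (ℤ.+ l)
      e = trans (cong (λ y → q - y) (trans (int-+ (ℤ.+ l) (ℤ.- ℤ.+ M)) (cong (int (ℤ.+ l) +_) (int-neg (ℤ.+ M)))))
                (lem q (int (ℤ.+ l)) (int (ℤ.+ M)))

  ∑-1 : ∀ m → ∑ {m} (λ _ → 1ℚ) ≡ int (ℤ.+ m)
  ∑-1 m = trans (∑≡sum {m} (λ _ → 1ℚ)) (go m)
    where
    go : ∀ m → sum {m} (λ _ → 1ℚ) ≡ int (ℤ.+ m)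
    go zero    = sym int-0
    go (suc m) = trans (cong (1ℚ +_) (go m)) (sym (int-suc m))

  pos-any : ∀ {I : Set} (is : List I) {f} → (∀ {i} → i ∈ is → 0ℚ ≤ f i) → ∀ {i} → i ∈ is → 0ℚ < f i → Pos is f
  pos-any (i ∷ is)     nn (here refl) p = inj₁ p
  pos-any (i ∷ is) {f} nn (there i∈)  p with f i ℚ.≟ 0ℚ
  ... | yes e = inj₂ (e , pos-any is (nn ∘ there) i∈ p)
  ... | no ne = inj₁ (≤≢⇒< (nn (here refl)) ne)

  -- A spanning family contains a basis

  Spanning : ∀ {N m} → (Fin N → Vector ℚ m) → Set
  Spanning {N} g = ∀ x → Σ (Vector ℚ N) λ a → x ≗ combo a g

  module _ {N m : ℕ} {g : Fin N → Vector ℚ m} (span : Spanning g) (j₀ : Fin N) where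

    private
      Partial : ℕ → Set
      Partial k = Σ (Fin m → Vector ℚ m) λ u → Σ (Fin m → Vector ℚ m) λ L → Σ (Fin m → Fin N) λ S →
        IsBasis u L × (∀ i → toℕ i ℕ.< k → u i ≗ g (S i))

      -- Unit vectors are exchanged for generators one index at a time. Some generator has a nonzero
      -- coordinate at the current index, since otherwise this coordinate would vanish on the whole
      -- span, including its own basis vector.
      extend : ∀ k → k ℕ.< m → Partial k → Partial (suc k)
      extend k k<m (u , L , S , b , done) with any? (λ j → ¬? (dot (L (fromℕ< k<m)) (g j) ℚ.≟ 0ℚ))
      ... | yes (j , l≢0) = u [ i ]≔ g j , pivot L i (g j) (recip (dot (L i) (g j))) , S [ i ]≔ j ,
            pivot-basis i (g j) (recip (dot (L i) (g j))) (recip-inverse l≢0) b , done′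
        where
        i : Fin m
        i = fromℕ< k<m
        done′ : ∀ i′ → toℕ i′ ℕ.< suc k → (u [ i ]≔ g j) i′ ≗ g ((S [ i ]≔ j) i′)
        done′ i′ lt l = by-cases (i ≟ i′)
          (λ { refl → trans (cong (λ v → v l) (≔-same u i (g j))) (cong (λ k → g k l) (sym (≔-same S i j))) })
          λ i≢i′ → trans (cong (λ v → v l) (≔-other u (g j) i≢i′)) (trans (done i′ (ℕ.≤∧≢⇒< (ℕ.s≤s⁻¹ lt)
            (λ e → i≢i′ (toℕ-injective (trans (toℕ-fromℕ< k<m) (sym e))))) l) (cong (λ k → g k l) (sym (≔-other S j i≢i′))))
      ... | no ¬p = ⊥-elim (ℚ.1≢0 (trans (sym (trans (IsBasis.dual b i i) (δ-refl i)))
            (trans (dot-congʳ (L i) (proj₂ (span (u i)))) (trans (dot-combo (L i) (proj₁ (span (u i))) g)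
              (sum-zero λ j → trans (cong (proj₁ (span (u i)) j *_) (zero′ j)) (ℚ.*-zeroʳ (proj₁ (span (u i)) j)))))))
        where
        i : Fin m
        i = fromℕ< k<m
        zero′ : ∀ j → dot (L i) (g j) ≡ 0ℚ
        zero′ j with dot (L i) (g j) ℚ.≟ 0ℚ
        ... | yes e = e
        ... | no ne = ⊥-elim (¬p (j , ne))

      partial : ∀ k → k ℕ.≤ m → Partial k
      -- `j₀` is a placeholder at the indices not yet treated.
      partial zero    _  = δ , δ , (λ _ → j₀) , standard-basis , λ _ ()
      partial (suc k) le = extend k le (partial k (ℕ.<⇒≤ le))

    opaque
      basis-exists : Σ (Fin m → Fin N) λ S → Σ (Fin m → Vector ℚ m) λ L → IsBasis (g ∘ S) L
      basis-exists = let u , L , S , b , done = partial m ℕ.≤-refl in S , L , record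
        { dual   = λ i k → trans (dot-congʳ (L i) λ l → sym (done k (toℕ<n k) l)) (IsBasis.dual b i k)
        ; expand = λ x l → trans (IsBasis.expand b x l) (sum-cong λ k → cong (dot (L k) x *_) (done k (toℕ<n k) l)) }

  -- Affine and convex combinations of a finite family

  Combines : ∀ {N n} → (Fin N → Point n) → Vector ℚ N → Point n → Set
  Combines p a y = ∑ a ≡ 1ℚ × y ≗ combo a p

  combines-compose : ∀ {N n k} (p : Fin N → Point n) (w : Vector ℚ k) (a : Fin k → Vector ℚ N) (y : Fin k → Point n) {x} →
    (∀ i → Combines p (a i) (y i)) → Combines y w x → Combines p (combo w a) x
  combines-compose p w a y {x} c (Σw≡1 , x≡) = total′ , λ l → begin
    x l                                            ≡⟨ x≡ l ⟩
    ∑ (λ i → w i * y i l)                          ≡⟨ (sum-cong λ i → cong (w i *_) (proj₂ (c i) l)) ⟩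
    ∑ (λ i → w i * ∑ (λ j → a i j * p j l))        ≡⟨ (sum-cong λ i → sym (sum-*ˡ (w i) (λ j → a i j * p j l))) ⟩
    ∑ (λ i → ∑ (λ j → w i * (a i j * p j l)))      ≡⟨ ∑-swap (λ i j → w i * (a i j * p j l)) ⟩
    ∑ (λ j → ∑ (λ i → w i * (a i j * p j l)))      ≡⟨ (sum-cong λ j → trans (sum-cong λ i → sym (ℚ.*-assoc (w i) (a i j) (p j l))) (sum-*ʳ (p j l) (λ i → w i * a i j))) ⟩
    ∑ (λ j → combo w a j * p j l)                  ∎
    where
    open ≡-Reasoning
    total′ : ∑ (combo w a) ≡ 1ℚ
    total′ = begin
      ∑ (λ j → ∑ (λ i → w i * a i j))   ≡⟨ ∑-swap (λ j i → w i * a i j) ⟩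
      ∑ (λ i → ∑ (λ j → w i * a i j))   ≡⟨ (sum-cong λ i → trans (sum-*ˡ (w i) (a i)) (trans (cong (w i *_) (proj₁ (c i))) (ℚ.*-identityʳ (w i)))) ⟩
      ∑ w                                ≡⟨ Σw≡1 ⟩
      1ℚ                                 ∎

  combo-nonneg : ∀ {N k} (w : Vector ℚ k) (a : Fin k → Vector ℚ N) → (∀ i → 0ℚ ≤ w i) → (∀ i j → 0ℚ ≤ a i j) → ∀ j → 0ℚ ≤ combo w a j
  combo-nonneg w a p q j = sum-nonneg λ i → 0≤* (p i) (q i j)

  combines-δ : ∀ {N n} (p : Fin N → Point n) j → Combines p (δ j) (p j)
  combines-δ {N} p j = trans (sum-cong λ i → sym (ℚ.*-identityʳ (δ j i))) (sum-δ j (λ _ → 1ℚ)) , λ l → sym (sum-δ j (λ i → p i l))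

  combines-cong : ∀ {N n} (p : Fin N → Point n) {a y z} → y ≗ z → Combines p a y → Combines p a z
  combines-cong p e (t , c) = t , λ l → trans (sym (e l)) (c l)

  hull⇒combines : ∀ {N n} (p : Fin N → Point n) {S y} (c : AffineCombination S y) →
    (∀ i → ∃[ a ] Combines p a (AffineCombination.points c i)) → ∃[ a ] Combines p a y
  hull⇒combines p c inside = combo (AffineCombination.weights c) (proj₁ ∘ inside) ,
    combines-compose p _ _ (AffineCombination.points c) (proj₂ ∘ inside)
      (trans (∑≡sum (AffineCombination.weights c)) (AffineCombination.total c) , λ l → trans (AffineCombination.combines c l) (sym (∑≡sum _)))

  ConvexCombines : ∀ {N n} → (Fin N → Point n) → Point n → Set
  ConvexCombines {N} p y = Σ (Vector ℚ N) λ a → (∀ j → 0ℚ ≤ a j) × Combines p a y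

  hull⇒convex : ∀ {N n} (p : Fin N → Point n) {S y} → convexHull S y → (∀ z → S z → ConvexCombines p z) → ConvexCombines p y
  hull⇒convex p (c , w≥0) f = _ , combo-nonneg _ _ w≥0 (λ i → proj₁ (proj₂ (in′ i))) , proj₂ (hull⇒combines p c λ i → proj₁ (in′ i) , proj₂ (proj₂ (in′ i)))
    where
    in′ : ∀ i → ConvexCombines p (AffineCombination.points c i)
    in′ i = f _ (AffineCombination.inside c i)

  convex⇒hull : ∀ {N n} (p : Fin N → Point n) {S : Point n → Set} {y} → (∀ j → S (p j)) → ConvexCombines p y → convexHull S y
  convex⇒hull p s (a , a≥0 , t , c) = record
    { points = p ; weights = a ; inside = s ; total = trans (sym (∑≡sum a)) t ; combines = λ l → trans (c l) (∑≡sum _) } , a≥0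

  gens : ∀ {n} (P : LatticePolytope n) → Fin (suc (LatticePolytope.pred-size P)) → Point n
  gens P j l = int (LatticePolytope.generators P j l)

  body⇒convex : ∀ {n} (P : LatticePolytope n) {y} → body P y → ConvexCombines (gens P) y
  body⇒convex P b = hull⇒convex (gens P) b λ { z (j , e) → δ j , 0≤δ j ,
    combines-cong (gens P) (λ l → trans (int≡/1 _) (sym (e l))) (combines-δ (gens P) j) }

  convex⇒body : ∀ {n} (P : LatticePolytope n) {y} → ConvexCombines (gens P) y → body P y
  convex⇒body P = convex⇒hull (gens P) λ j → j , λ l → int≡/1 _

  -- The cone over a full-dimensional polytope

  module Cone {n} (P : LatticePolytope n) where

    open LatticePolytope P

    N m : ℕ
    N = suc pred-size
    m = suc n

    g : Fin N → Vector ℚ m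
    g j zero    = 1ℚ
    g j (suc l) = gens P j l

    Lattice : Vector ℚ m → Set
    Lattice x = ∀ l → Int (x l)

    InCone : Vector ℚ m → Set
    InCone x = Σ (Vector ℚ N) λ a → (∀ j → 0ℚ ≤ a j) × x ≗ combo a g

    lift : LatticePoint n → ℕ → Vector ℚ m
    lift v h zero    = int (ℤ.+ h)
    lift v h (suc l) = int (v l)

    g-lattice : ∀ j → Lattice (g j)
    g-lattice j zero    = Int-1
    g-lattice j (suc l) = Int-int _

    cone-height : ∀ {x} ((a , _) : InCone x) → x zero ≡ ∑ a
    cone-height (a , _ , e) = trans (e zero) (sum-cong λ j → ℚ.*-identityʳ (a j))

    cone-height-nonneg : ∀ {x} → InCone x → 0ℚ ≤ x zero
    cone-height-nonneg c@(a , a≥0 , _) = subst (0ℚ ≤_) (sym (cone-height c)) (sum-nonneg a≥0)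

    cone-cong : ∀ {x y} → x ≗ y → InCone x → InCone y
    cone-cong e (a , p , q) = a , p , λ l → trans (sym (e l)) (q l)

    cone-+ : ∀ {x y} → InCone x → InCone y → InCone (λ l → x l + y l)
    cone-+ (a , p , q) (b , r , s) = (λ j → a j + b j) , (λ j → 0≤+ (p j) (r j)) ,
      λ l → trans (cong₂ _+_ (q l) (s l)) (trans (sym (sum-+ (λ j → a j * g j l) (λ j → b j * g j l)))
        (sum-cong λ j → sym (ℚ.*-distribʳ-+ (g j l) (a j) (b j))))

    cone-* : ∀ {x c} → 0ℚ ≤ c → InCone x → InCone (λ l → c * x l)
    cone-* {c = c} 0≤c (a , p , q) = (λ j → c * a j) , (λ j → 0≤* 0≤c (p j)) ,
      λ l → trans (cong (c *_) (q l)) (trans (sym (sum-*ˡ c (λ j → a j * g j l))) (sum-cong λ j → sym (ℚ.*-assoc c (a j) (g j l))))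

    cone-g : ∀ j → InCone (g j)
    cone-g j = δ j , 0≤δ j , λ l → sym (sum-δ j (λ i → g i l))

    cone-0 : InCone (λ _ → 0ℚ)
    cone-0 = (λ _ → 0ℚ) , (λ _ → ℚ.≤-refl) , λ l → sym (sum-zero λ j → ℚ.*-zeroˡ (g j l))

    cone-combo : ∀ {k} (w : Vector ℚ k) (y : Fin k → Vector ℚ m) → (∀ i → 0ℚ ≤ w i) → (∀ i → InCone (y i)) → InCone (combo w y)
    cone-combo {k} w y p q = cone-cong (λ l → sym (∑≡sum (λ i → w i * y i l))) (go k w y p q)
      where
      go : ∀ k (w : Vector ℚ k) (y : Fin k → Vector ℚ m) → (∀ i → 0ℚ ≤ w i) → (∀ i → InCone (y i)) → InCone (λ l → sum λ i → w i * y i l)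
      go zero    w y p q = cone-0
      go (suc k) w y p q = cone-+ (cone-* (p zero) (q zero)) (go k (w ∘ suc) (y ∘ suc) (p ∘ suc) (q ∘ suc))

    cone-coords : ∀ {S L x} → IsBasis (g ∘ S) L → (∀ i → 0ℚ ≤ dot (L i) x) → InCone x
    cone-coords {S} b p = cone-cong (λ l → sym (IsBasis.expand b _ l)) (cone-combo _ (g ∘ S) p (cone-g ∘ S))

    dilate⇒cone : ∀ {v h} → dilate h (body P) (ι v) → InCone (lift v h)
    dilate⇒cone {v} {h} (y , y∈ , e) with body⇒convex P y∈
    ... | a , a≥0 , Σa≡1 , y≡ = (λ j → H * a j) , (λ j → 0≤* (0≤int h) (a≥0 j)) , eq
      where
      H : ℚ
      H = int (ℤ.+ h)
      eq : lift v h ≗ combo (λ j → H * a j) g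
      eq zero    = sym (trans (sum-cong λ j → ℚ.*-identityʳ (H * a j)) (trans (sum-*ˡ H a) (trans (cong (H *_) Σa≡1) (ℚ.*-identityʳ H))))
      eq (suc l) = trans (trans (int≡/1 (v l)) (trans (e l) (cong₂ _*_ (sym (int≡/1 (ℤ.+ h))) (y≡ l))))
        (trans (sym (sum-*ˡ H (λ j → a j * gens P j l))) (sum-cong λ j → sym (ℚ.*-assoc H (a j) (gens P j l))))

    cone⇒dilate : ∀ {v h} → InCone (lift v h) → dilate h (body P) (ι v)
    -- At height 0 all coefficients vanish, so `v` is the origin, and any point of the body dilated
    -- by 0 is a witness.
    cone⇒dilate {v} {zero} c@(a , a≥0 , e) = gens P zero , convex⇒body P (δ zero , 0≤δ zero , combines-δ (gens P) zero) ,
      λ l → trans (sym (int≡/1 (v l))) (trans (e (suc l)) (trans (sum-zero λ j → trans (cong (_* gens P j l) (a≡0 j)) (ℚ.*-zeroˡ (gens P j l)))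
        (sym (ℚ.*-zeroˡ (gens P zero l)))))
      where
      a≡0 : ∀ j → a j ≡ 0ℚ
      a≡0 j = ℚ.≤-antisym (subst (a j ≤_) (trans (sym (cone-height c)) int-0) (term≤∑ a≥0 j)) (a≥0 j)
    cone⇒dilate {v} {suc h} c@(a , a≥0 , e) with inverse-pos (int (ℤ.+ suc h)) (subst (0ℚ <_) (sym (int-suc h)) (0<+ 0<1 (0≤int h)))
    ... | H⁻¹ , 0<H⁻¹ , HH⁻¹ = combo b (gens P) , convex⇒body P (b , (λ j → 0≤* (ℚ.<⇒≤ 0<H⁻¹) (a≥0 j)) , Σb≡1 , λ l → refl) , eq
      where
      H : ℚ
      H = int (ℤ.+ suc h)
      b : Vector ℚ N
      b j = H⁻¹ * a j
      Σb≡1 : ∑ b ≡ 1ℚ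
      Σb≡1 = trans (sum-*ˡ H⁻¹ a) (trans (cong (H⁻¹ *_) (sym (cone-height c))) (trans (ℚ.*-comm H⁻¹ H) HH⁻¹))
      lem : ∀ h d a g → h * (d * a * g) ≡ h * d * (a * g)
      lem = solve-∀ ℚring
      eq : ι v ≗ λ l → (ℤ.+ suc h / 1) * combo b (gens P) l
      eq l = trans (sym (int≡/1 (v l))) (trans (e (suc l)) (sym (trans (cong (_* combo b (gens P) l) (sym (int≡/1 (ℤ.+ suc h))))
        (trans (sym (sum-*ˡ H (λ j → b j * gens P j l))) (sum-cong λ j → trans (lem H H⁻¹ (a j) (gens P j l))
          (trans (cong (_* (a j * gens P j l)) HH⁻¹) (ℚ.*-identityˡ (a j * gens P j l))))))))

    lattice⇒lift : ∀ {x} → Lattice x → 0ℚ ≤ x zero → ∃[ v ] ∃[ h ] x ≗ lift v h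
    lattice⇒lift {x} lat p = (λ l → proj₁ (lat (suc l))) , proj₁ (Int-nonneg (lat zero) p) ,
      λ { zero → proj₂ (Int-nonneg (lat zero) p) ; (suc l) → proj₂ (lat (suc l)) }

    -- A vector is its projection `x ∘ suc` lifted to height 1, plus `x zero - 1` times the lifted
    -- origin. Points at height 1 are linear combinations of the `g j` because their projections are
    -- affine combinations of the generators.
    spanning : FullDimensional P → Spanning g
    spanning full x = (λ j → proj₁ c₁ j + (x zero - 1ℚ) * proj₁ c₀ j) , eq
      where
      affine : ∀ y → ∃[ a ] Combines (gens P) a y
      affine y = hull⇒combines (gens P) (full y) λ i →
        let a , _ , c = body⇒convex P (AffineCombination.inside (full y) i) in a , c
      c₁ = affine (x ∘ suc)
      c₀ = affine (λ _ → 0ℚ)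
      lem : ∀ x → x ≡ 1ℚ + (x - 1ℚ) * 1ℚ
      lem = solve-∀ ℚring
      lem₂ : ∀ x y → x ≡ x + y * 0ℚ
      lem₂ = solve-∀ ℚring
      lem₃ : ∀ a b c g → (a + b * c) * g ≡ a * g + b * (c * g)
      lem₃ = solve-∀ ℚring
      split : ∀ l → combo (λ j → proj₁ c₁ j + (x zero - 1ℚ) * proj₁ c₀ j) g l ≡ combo (proj₁ c₁) g l + (x zero - 1ℚ) * combo (proj₁ c₀) g l
      split l = trans (sum-cong λ j → lem₃ (proj₁ c₁ j) (x zero - 1ℚ) (proj₁ c₀ j) (g j l))
        (trans (sum-+ (λ j → proj₁ c₁ j * g j l) (λ j → (x zero - 1ℚ) * (proj₁ c₀ j * g j l)))
          (cong (combo (proj₁ c₁) g l +_) (sum-*ˡ (x zero - 1ℚ) (λ j → proj₁ c₀ j * g j l))))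
      ones : ∀ a → ∑ a ≡ 1ℚ → combo a g zero ≡ 1ℚ
      ones a e = trans (sum-cong λ j → ℚ.*-identityʳ (a j)) e
      eq : x ≗ combo (λ j → proj₁ c₁ j + (x zero - 1ℚ) * proj₁ c₀ j) g
      eq zero    = trans (lem (x zero)) (sym (trans (split zero)
        (cong₂ (λ y z → y + (x zero - 1ℚ) * z) (ones _ (proj₁ (proj₂ c₁))) (ones _ (proj₁ (proj₂ c₀))))))
      eq (suc l) = trans (lem₂ (x (suc l)) (x zero - 1ℚ)) (sym (trans (split (suc l))
        (cong₂ (λ y z → y + (x zero - 1ℚ) * z) (sym (proj₂ (proj₂ c₁) l)) (sym (proj₂ (proj₂ c₀) l)))))

  -- From the Ehrhart series to the heights of interior lattice points

  module Ehrhart {n d} (P : LatticePolytope n) (full : FullDimensional P) (degree : HasDegree P d) where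

    open Cone P
    open HasDegree degree

    span : Spanning g
    span = spanning full

    S₀ : Fin m → Fin N
    S₀ = proj₁ (basis-exists span zero)

    L₀ : Fin m → Vector ℚ m
    L₀ = proj₁ (proj₂ (basis-exists span zero))

    basis₀ : IsBasis (g ∘ S₀) L₀
    basis₀ = proj₂ (proj₂ (basis-exists span zero))

    private
      outside? : ∀ j → Dec (¬ (∃[ i ] S₀ i ≡ j))
      outside? j = ¬? (any? λ i → S₀ i ≟ j)

      outer order : List (Fin N)
      outer = filter outside? (allFin N)
      -- The repetition of `outer` never decides a comparison and makes completeness immediate.
      order = outer ++ allFin N

      complete : ∀ j → j ∈ order
      complete j = ∈-++⁺ʳ outer (∈-allFin j)

    -- The costs of S₀ come last in the lexicographic order, so S₀ is optimal.
    open Triangulation g order complete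

    private
      simplex₀ : Simplex S₀ L₀
      simplex₀ = record { basis = basis₀ ; optimal = λ j → optimal j (outside? j) }
        where
        open ≡-Reasoning
        optimal : ∀ j → Dec (¬ (∃[ i ] S₀ i ≡ j)) → NonNeg order (reducedCost S₀ L₀ j)
        optimal j (yes out) = inj₁ (pos-++ˡ outer (allFin N) (pos-any outer nonneg (∈-filter⁺ outside? (∈-allFin j) out)
            (subst (0ℚ <_) (sym (trans (on-outer j j out) (δ-refl j))) 0<1)))
          where
          on-outer : ∀ j j′ → ¬ (∃[ i ] S₀ i ≡ j′) → reducedCost S₀ L₀ j j′ ≡ δ j j′
          on-outer j j′ out = trans (cong (λ z → δ j j′ - z)
            (sum-zero λ i → trans (cong (dot (L₀ i) (g j) *_) (δ-≢ λ e → out (i , e))) (ℚ.*-zeroʳ (dot (L₀ i) (g j))))) (lem (δ j j′))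
            where
            lem : ∀ a → a - 0ℚ ≡ a
            lem = solve-∀ ℚring
          nonneg : ∀ {j′} → j′ ∈ outer → 0ℚ ≤ reducedCost S₀ L₀ j j′
          nonneg {j′} j′∈ = subst (0ℚ ≤_) (sym (on-outer j j′ (proj₂ (∈-filter⁻ outside? {xs = allFin N} j′∈)))) (0≤δ j j′)
        optimal j (no ¬out) with any? (λ i → S₀ i ≟ j)
        ... | no out = ⊥-elim (¬out out)
        ... | yes (i , refl) = inj₂ λ {j′} _ → trans (cong (λ z → δ (S₀ i) j′ - z)
            (trans (sum-cong λ k → cong (_* δ (S₀ k) j′) (trans (IsBasis.dual basis₀ k i) (δ-sym k i))) (sum-δ i (λ k → δ (S₀ k) j′))))
            (ℚ.+-inverseʳ (δ (S₀ i) j′))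

      -- The number 1 with no infinitesimal part.
      unit : Fin (suc N) → ℚ
      unit zero    = 1ℚ
      unit (suc _) = 0ℚ

    -- The point `x + s (ε₀ g₀ + ε₁ g₁ + …)`, each ε infinitesimal against the one before it.
    -- Perturbing along every generator makes the point generic whatever `x` is.
    perturb : ℚ → Vector ℚ m → Perturbed
    perturb s x zero    = x
    perturb s x (suc k) = λ l → s * g k l

    private
      perturb-generic : ∀ s x → s ≢ 0ℚ → Generic (perturb s x)
      perturb-generic s x s≢0 f z j = *≡0 s (dot f (g j)) s≢0 (trans (sym (dot-* f s (g j))) (z (suc j)))

      coefficients : ℚ → Vector ℚ N → Fin N → Fin (suc N) → ℚ
      coefficients s a j zero    = a j
      coefficients s a j (suc k) = s * δ k j

      perturb-combo : ∀ s x a → x ≗ combo a g → ∀ t → perturb s x t ≗ combo (λ j → coefficients s a j t) g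
      perturb-combo s x a e zero    = e
      perturb-combo s x a e (suc k) l = sym (trans (sum-cong λ j → ℚ.*-assoc s (δ k j) (g j l))
        (trans (sum-*ˡ s (λ j → δ k j * g j l)) (cong (s *_) (sum-δ k (λ j → g j l)))))

      -- The coefficients `aⱼ + εⱼ` are positive even on the boundary of the cone.
      covered⁺ : ∀ x → InCone x → Covered (perturb 1ℚ x)
      covered⁺ x (a , a≥0 , e) = coefficients 1ℚ a , (λ j → inj₁ (pos-any times (λ {t} _ → nonneg j t) (∈-allFin (suc j))
          (subst (0ℚ <_) (sym (trans (ℚ.*-identityˡ (δ j j)) (δ-refl j))) 0<1))) , perturb-combo 1ℚ x a e
        where
        nonneg : ∀ j t → 0ℚ ≤ coefficients 1ℚ a j t
        nonneg j zero    = a≥0 j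
        nonneg j (suc k) = 0≤* 0≤1 (0≤δ k j)

      -- The coefficients are now `aⱼ - εⱼ`; here the rational parts themselves have to be positive,
      -- so the point must be interior.
      covered⁻ : ∀ x a → (∀ j → 0ℚ < a j) → x ≗ combo a g → Covered (perturb (- 1ℚ) x)
      covered⁻ x a a>0 e = coefficients (- 1ℚ) a , (λ j → inj₁ (inj₁ (a>0 j))) , perturb-combo (- 1ℚ) x a e

      -1≢0 : - 1ℚ ≢ 0ℚ
      -1≢0 ()

      opaque
        locate⁺ : ∀ x → InCone x → ∃[ S ] ∃[ L ] Simplex S L × Contains L (perturb 1ℚ x)
        locate⁺ x c = locate (perturb-generic 1ℚ x ℚ.1≢0) (covered⁺ x c) simplex₀

        locate⁻ : ∀ x a → (∀ j → 0ℚ < a j) → x ≗ combo a g → ∃[ S ] ∃[ L ] Simplex S L × Contains L (perturb (- 1ℚ) x)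
        locate⁻ x a a>0 e = locate (perturb-generic (- 1ℚ) x -1≢0) (covered⁻ x a a>0 e) simplex₀

      does-cong : ∀ {a b} {A : Set a} {B : Set b} (p : Dec A) (q : Dec B) → (A → B) → (B → A) → does p ≡ does q
      does-cong (yes _) (yes _) _ _ = refl
      does-cong (no _)  (no _)  _ _ = refl
      does-cong (yes a) (no ¬b) f _ = ⊥-elim (¬b (f a))
      does-cong (no ¬a) (yes b) _ g = ⊥-elim (¬a (g b))

      point : ∀ {h} → Fin (count h) → Vector ℚ m
      point {h} i = lift (proj₁ (Bijection.to (counts h) i)) h

      in-cone : ∀ {h} (i : Fin (count h)) → InCone (point i)
      in-cone {h} i = dilate⇒cone (proj₂ (Bijection.to (counts h) i))

      index : ∀ {x v h} → x ≗ lift v h → InCone x → ∃[ i ] point {h} i ≗ x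
      index {x} {v} {h} e c with Bijection.surjective (counts h) (v , cone⇒dilate (cone-cong e c))
      ... | i , p = i , λ { zero → sym (e zero) ; (suc l) → trans (cong int (p refl l)) (sym (e (suc l))) }

      point-injective : ∀ {h} (i i′ : Fin (count h)) → point i ≗ point i′ → i ≡ i′
      point-injective {h} i i′ e = Bijection.injective (counts h) λ l → int-injective (e (suc l))

      S : ∀ {h} → Fin (count h) → Fin m → Fin N
      S i = proj₁ (locate⁺ (point i) (in-cone i))

      L : ∀ {h} → Fin (count h) → Fin m → Vector ℚ m
      L i = proj₁ (proj₂ (locate⁺ (point i) (in-cone i)))

      simplex : ∀ {h} (i : Fin (count h)) → Simplex (S i) (L i)
      simplex i = proj₁ (proj₂ (proj₂ (locate⁺ (point i) (in-cone i))))

      contains : ∀ {h} (i : Fin (count h)) → Contains (L i) (perturb 1ℚ (point i))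
      contains i = proj₂ (proj₂ (proj₂ (locate⁺ (point i) (in-cone i))))

      -- The coefficient of `g j` in the perturbed lattice point; by uniqueness of `value`, any
      -- simplex containing that point computes it.
      V : ∀ {h} → Fin (count h) → Fin N → Fin (suc N) → ℚ
      V i j t = value (S i) (L i) (perturb 1ℚ (point i)) (j , t)

      perturb-cong : ∀ s {x y} → x ≗ y → ∀ t → perturb s x t ≗ perturb s y t
      perturb-cong s e zero    = e
      perturb-cong s e (suc k) l = refl

      coords-cong : ∀ L s {x y} → x ≗ y → ∀ i → coords L (perturb s x) i ≗ coords L (perturb s y) i
      coords-cong L s e i t = dot-congʳ (L i) (perturb-cong s e t)

      V-unique : ∀ {h} (i : Fin (count h)) {S L x} → Simplex S L → Contains L (perturb 1ℚ x) → point i ≗ x →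
        ∀ j t → V i j t ≡ value S L (perturb 1ℚ x) (j , t)
      V-unique i {S} {L} {x} s c e j t = trans
        (value-unique (simplex i) s (contains i) (λ k → pos-cong times (coords-cong L 1ℚ (λ l → sym (e l)) k) (c k)) (j , t))
        (sum-cong λ k → cong (_* δ (S k) j) (coords-cong L 1ℚ e k t))

      supported : ∀ {h} (i : Fin (count h)) j → Pos times (V i j) → ∃[ k ] S i k ≡ j
      supported i j p = by-cases (any? (λ k → S i k ≟ j)) (λ q → q) λ ¬q →
        ⊥-elim (pos-zero times p λ {t} _ → value-off {perturb 1ℚ (point i)} {S i} {L i} j t λ k e → ¬q (k , e))

      coords-shift : ∀ {S L x x′} c k → Simplex S L → (∀ l → x′ l ≡ x l + c * g (S k) l) → ∀ i t →
        coords L (perturb 1ℚ x′) i t ≡ coords L (perturb 1ℚ x) i t + δ i k * (c * unit t)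
      coords-shift {S} {L} {x} {x′} c k s e i zero = trans (dot-congʳ (L i) e) (trans (dot-+ (L i) x (λ l → c * g (S k) l))
        (cong (dot (L i) x +_) (trans (dot-* (L i) c (g (S k))) (trans (cong (c *_) (IsBasis.dual (Simplex.basis s) i k)) (lem c (δ i k))))))
        where
        lem : ∀ c d → c * d ≡ d * (c * 1ℚ)
        lem = solve-∀ ℚring
      coords-shift {L = L} c k s e i (suc t) = lem (dot (L i) (λ l → 1ℚ * g t l)) (δ i k) c
        where
        lem : ∀ a d c → a ≡ a + d * (c * 0ℚ)
        lem = solve-∀ ℚring

      value-shift : ∀ {S L x x′} c k → Simplex S L → (∀ l → x′ l ≡ x l + c * g (S k) l) → ∀ j t →
        value S L (perturb 1ℚ x′) (j , t) ≡ value S L (perturb 1ℚ x) (j , t) + δ (S k) j * (c * unit t)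
      value-shift {S} {L} {x} {x′} c k s e j t = begin
        ∑ (λ i → coords L (perturb 1ℚ x′) i t * δ (S i) j)
          ≡⟨ (sum-cong λ i → trans (cong (_* δ (S i) j) (coords-shift {S} {L} {x} {x′} c k s e i t)) (trans (lem (coords L (perturb 1ℚ x) i t) (δ i k) (c * unit t) (δ (S i) j))
               (cong (λ z → coords L (perturb 1ℚ x) i t * δ (S i) j + z * (c * unit t * δ (S i) j)) (δ-sym i k)))) ⟩
        ∑ (λ i → coords L (perturb 1ℚ x) i t * δ (S i) j + δ k i * (c * unit t * δ (S i) j))
          ≡⟨ sum-+ _ _ ⟩
        value S L (perturb 1ℚ x) (j , t) + ∑ (λ i → δ k i * (c * unit t * δ (S i) j))
          ≡⟨ cong (value S L (perturb 1ℚ x) (j , t) +_) (trans (sum-δ k (λ i → c * unit t * δ (S i) j)) (ℚ.*-comm (c * unit t) (δ (S k) j))) ⟩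
        value S L (perturb 1ℚ x) (j , t) + δ (S k) j * (c * unit t) ∎
        where
        open ≡-Reasoning
        lem : ∀ a b c d → (a + b * c) * d ≡ a * d + b * (c * d)
        lem = solve-∀ ℚring

      -- A generator can be subtracted within the same simplex when its coefficient exceeds 1. The
      -- infinitesimal part takes part in the comparison, so a coefficient with rational part
      -- exactly 1 is decided by the half-open convention.
      support removable : ∀ {h} → Fin (count h) → Fin N → Bool
      support i j = does (pos? times (V i j))
      removable i j = does (pos? times (λ t → V i j t - unit t))

      shift-contains : ∀ {S L x x′} c k → Simplex S L → (∀ l → x′ l ≡ x l + c * g (S k) l) → Contains L (perturb 1ℚ x) →
        Pos times (λ t → coords L (perturb 1ℚ x) k t + c * unit t) → Contains L (perturb 1ℚ x′)
      shift-contains {S} {L} {x} {x′} c k s e co p i = by-cases (i ≟ k)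
        (λ { refl → pos-cong times (λ t → sym (trans (coords-shift {S} {L} {x} {x′} c k s e k t) (trans (cong (λ z → coords L (perturb 1ℚ x) k t + z * (c * unit t)) (δ-refl k))
           (cong (coords L (perturb 1ℚ x) k t +_) (ℚ.*-identityˡ (c * unit t)))))) p })
        λ i≢k → pos-cong times (λ t → sym (trans (coords-shift {S} {L} {x} {x′} c k s e i t) (trans (cong (λ z → coords L (perturb 1ℚ x) i t + z * (c * unit t)) (δ-≢ i≢k))
           (lem (coords L (perturb 1ℚ x) i t) (c * unit t))))) (co i)
        where
        lem : ∀ a b → a + 0ℚ * b ≡ a
        lem = solve-∀ ℚring

      contains⇒cone : ∀ {S L x} → Simplex S L → Contains L (perturb 1ℚ x) → InCone x
      contains⇒cone {S} {L} {x} s c = cone-coords (Simplex.basis s) λ i → nonneg-head {i = zero} {f = coords L (perturb 1ℚ x) i} (inj₁ (c i))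

      unit-nonneg : NonNeg times (λ t → 1ℚ * unit t)
      unit-nonneg = inj₁ (inj₁ (subst (0ℚ <_) (sym (ℚ.*-identityˡ 1ℚ)) 0<1))

      V-at : ∀ {h} (i : Fin (count h)) k t → V i (S i k) t ≡ coords (L i) (perturb 1ℚ (point i)) k t
      V-at i k t = value-at {perturb 1ℚ (point i)} (simplex i) k t

      IsQuotient : ∀ {h} → Fin N → Fin (count (suc h)) → Fin (count h) → Set
      IsQuotient j x y = T (support y j) × point x ≗ (λ l → point y l + g j l)

      V-quotient : ∀ {h j x y} → IsQuotient {h} j x y → ∀ j′ t → V x j′ t ≡ V y j′ t + δ j j′ * unit t
      V-quotient {h} {j} {x} {y} (s , e) j′ t = at (supported y j (T-does (pos? times (V y j)) s)) e
        where
        at : ∃[ k ] S y k ≡ j → point x ≗ (λ l → point y l + g j l) → V x j′ t ≡ V y j′ t + δ j j′ * unit t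
        at (k , refl) e = trans (V-unique x {x = point x} (simplex y) co (λ _ → refl) j′ t)
            (trans (value-shift {S y} {L y} {point y} {point x} 1ℚ k (simplex y) e′ j′ t) (cong (λ z → V y j′ t + δ (S y k) j′ * z) (ℚ.*-identityˡ (unit t))))
          where
          e′ : ∀ l → point x l ≡ point y l + 1ℚ * g (S y k) l
          e′ l = trans (e l) (cong (point y l +_) (sym (ℚ.*-identityˡ (g (S y k) l))))
          co : Contains (L y) (perturb 1ℚ (point x))
          co = shift-contains {S y} {L y} {point y} {point x} 1ℚ k (simplex y) e′ (contains y) (pos-nonneg-+ times (contains y k) unit-nonneg)

      V-self : ∀ {h j x y} → IsQuotient {h} j x y → ∀ t → V x j t ≡ V y j t + unit t
      V-self {j = j} {y = y} q t = trans (V-quotient q j t) (cong (V y j t +_) (trans (cong (_* unit t) (δ-refl j)) (ℚ.*-identityˡ (unit t))))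

      V-other : ∀ {h j x y} → IsQuotient {h} j x y → ∀ {j′} → j ≢ j′ → ∀ t → V x j′ t ≡ V y j′ t
      V-other {y = y} q {j′} ne t = trans (V-quotient q j′ t) (trans (cong (λ z → V y j′ t + z * unit t) (δ-≢ ne)) (lem (V y j′ t) (unit t)))
        where
        lem : ∀ a b → a + 0ℚ * b ≡ a
        lem = solve-∀ ℚring

      divide-at : ∀ {h} (x : Fin (count h)) k → T (removable x (S x k)) →
        Contains (L x) (perturb 1ℚ (λ l → point x l - g (S x k) l))
      divide-at x k t = shift-contains {S x} {L x} {point x} {λ l → point x l - g (S x k) l} (- 1ℚ) k (simplex x) (λ l → lem (point x l) (g (S x k) l)) (contains x)
        (pos-cong times (λ τ → trans (cong (_- unit τ) (V-at x k τ)) (lem (coords (L x) (perturb 1ℚ (point x)) k τ) (unit τ)))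
          (T-does (pos? times (λ τ → V x (S x k) τ - unit τ)) t))
        where
        lem : ∀ a b → a - b ≡ a + - 1ℚ * b
        lem = solve-∀ ℚring

      lift-minus : ∀ v h j → (λ l → lift v (suc h) l - g j l) ≗ lift (λ l → v l ℤ.- LatticePolytope.generators P j l) h
      lift-minus v h j zero    = trans (cong (_- 1ℚ) (int-suc h)) (lem (int (ℤ.+ h)))
        where
        lem : ∀ a → 1ℚ + a - 1ℚ ≡ a
        lem = solve-∀ ℚring
      lift-minus v h j (suc l) = sym (trans (int-+ (v l) (ℤ.- LatticePolytope.generators P j l)) (cong (int (v l) +_) (int-neg (LatticePolytope.generators P j l))))

      lift-+ : ∀ v h j → (λ l → lift v h l + g j l) ≗ lift (λ l → v l ℤ.+ LatticePolytope.generators P j l) (suc h)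
      lift-+ v h j zero    = trans (ℚ.+-comm (int (ℤ.+ h)) 1ℚ) (sym (int-suc h))
      lift-+ v h j (suc l) = sym (int-+ (v l) (LatticePolytope.generators P j l))

      divide : ∀ {h j} (x : Fin (count (suc h))) → T (support x j) → T (removable x j) → ∃ (IsQuotient j x)
      divide {h} {j} x s r = at (supported x j (T-does (pos? times (V x j)) s)) r
        where
        lem : ∀ a b → a - b + b ≡ a
        lem = solve-∀ ℚring
        at : ∃[ k ] S x k ≡ j → T (removable x j) → ∃ (IsQuotient j x)
        at (k , refl) r = y , does-T (pos? times (V y (S x k))) (pos-cong times (λ t → sym
                (trans (V-unique y (simplex x) co e (S x k) t) (value-at {perturb 1ℚ x′} (simplex x) k t))) (co k)) ,
              λ l → sym (trans (cong (_+ g (S x k) l) (e l)) (lem (point x l) (g (S x k) l)))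
          where
          x′ : Vector ℚ m
          x′ l = point x l - g (S x k) l
          co : Contains (L x) (perturb 1ℚ x′)
          co = divide-at x k r
          found : ∃[ i ] point {h} i ≗ x′
          found = index {x′} (lift-minus _ h (S x k)) (contains⇒cone (simplex x) co)
          y : Fin (count h)
          y = proj₁ found
          e : point y ≗ x′
          e = proj₂ found

      divisible : Divisible m count
      divisible = record
        { N         = N
        ; support   = support
        ; removable = removable
        ; size      = size
        ; Quotient  = IsQuotient
        ; support-≗ = support-≗
        ; by-self   = λ {h} {j} {x} {y} q → does-T (pos? times (λ t → V x j t - unit t))
                        (pos-cong times (λ t → sym (trans (cong (_- unit t) (V-self q t)) (lem (V y j t) (unit t)))) (T-does (pos? times (V y j)) (proj₁ q)))
        ; by-other  = λ {h} {j} {x} {y} q {k} k≢j → does-cong (pos? times (λ t → V x k t - unit t)) (pos? times (λ t → V y k t - unit t))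
                        (pos-cong times λ t → cong (_- unit t) (V-other q (k≢j ∘ sym) t))
                        (pos-cong times λ t → cong (_- unit t) (sym (V-other q (k≢j ∘ sym) t)))
        ; unique    = λ {h} {j} {x} {x′} (_ , e) (_ , e′) → point-injective x x′ λ l → trans (e l) (sym (e′ l))
        ; unique′   = λ {h} {j} {x} {y} {y′} (_ , e) (_ , e′) → point-injective y y′ λ l →
                        trans (lem₂ (point y l) (g j l)) (trans (cong (_- g j l) (trans (sym (e l)) (e′ l))) (sym (lem₂ (point y′ l) (g j l))))
        ; divide    = divide
        ; multiply  = λ {h} {j} y s → let x , e = index (lift-+ _ h j) (cone-+ (in-cone y) (cone-g j)) in x , s , e
        ; bottom    = bottom
        }
        where
        lem : ∀ a b → a + b - b ≡ a
        lem = solve-∀ ℚring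
        lem₂ : ∀ a b → a ≡ a + b - b
        lem₂ = solve-∀ ℚring
        size : ∀ {h} (x : Fin (count h)) → cardinality (support x) ≡ m
        size x = ℕ.≤-antisym
          (subst (cardinality (support x) ℕ.≤_) (count-all m) (count-injection (support x) (λ _ → true) (λ j t → proj₁ (at j t)) (λ _ _ → tt)
            λ j j′ t t′ e → trans (sym (proj₂ (at j t))) (trans (cong (S x) e) (proj₂ (at j′ t′)))))
          (subst (ℕ._≤ cardinality (support x)) (count-all m) (count-injection (λ _ → true) (support x) (λ k _ → S x k)
            (λ k _ → does-T (pos? times (V x (S x k))) (pos-cong times (λ t → sym (V-at x k t)) (contains x k)))
            λ k k′ _ _ → Simplex.injective (simplex x)))
          where
          at : ∀ j → T (support x j) → ∃[ k ] S x k ≡ j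
          at j t = supported x j (T-does (pos? times (V x j)) t)
        support-≗ : ∀ {h j x y} → IsQuotient {h} j x y → support x ≗ support y
        support-≗ {h} {j} {x} {y} q j′ = by-cases (j ≟ j′)
          (λ { refl → let p = T-does (pos? times (V y j)) (proj₁ q) in does-cong (pos? times (V x j)) (pos? times (V y j)) (λ _ → p)
                 (λ _ → pos-cong times (λ t → sym (V-self q t)) (pos-nonneg-+ times p (inj₁ (inj₁ 0<1)))) })
          λ j≢j′ → does-cong (pos? times (V x j′)) (pos? times (V y j′)) (pos-cong times (V-other q j≢j′)) (pos-cong times λ t → sym (V-other q j≢j′ t))
        -- Subtracting a generator at height 0 would give a point of the cone at height -1.
        bottom : ∀ {j} (x : Fin (count 0)) → T (support x j) → ¬ T (removable x j)
        bottom {j} x s = at (supported x j (T-does (pos? times (V x j)) s))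
          where
          height : point x zero - 1ℚ ≡ - 1ℚ
          height = cong (_- 1ℚ) int-0
          at : ∃[ k ] S x k ≡ j → ¬ T (removable x j)
          at (k , refl) r = ℚ.<-irrefl refl (ℚ.<-≤-trans (subst (_< 0ℚ) (sym height) (ℚ.negative⁻¹ (- 1ℚ)))
            (cone-height-nonneg (contains⇒cone (simplex x) (divide-at x k r))))

    -- Such a `b` is a box point of its simplex: it cannot be divided, so coefficient `h` of h* is
    -- nonzero, whereas h* vanishes beyond `d`.
    reduced-height : ∀ {S L b h v} → Simplex S L → Contains L (perturb 1ℚ b) → b ≗ lift v h →
      (∀ k → ¬ Pos times (λ t → coords L (perturb 1ℚ b) k t - unit t)) → h ℕ.≤ d
    reduced-height {S′} {L′} {b} {h} {v} s c e irreducible = ℕ.≮⇒≥ λ d<h → Divisible.h*-coefficient divisible x reduced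
        (trans (ehrhart h) (proj₂ h*-degree h d<h))
      where
      x : Fin (count h)
      x = proj₁ (index {b} {v} {h} e (contains⇒cone s c))
      e′ : point x ≗ b
      e′ = proj₂ (index {b} {v} {h} e (contains⇒cone s c))
      reduced : ∀ j → T (support x j) → ¬ T (removable x j)
      reduced j t r = by-cases (any? λ k → S′ k ≟ j)
        (λ (k , p) → at k p r)
        λ ¬q → pos-zero times (T-does (pos? times (V x j)) t) λ {τ} _ → trans (V-unique x s c e′ j τ)
                      (value-off {perturb 1ℚ b} {S′} {L′} j τ λ k p → ¬q (k , p))
        where
        at : ∀ k → S′ k ≡ j → ¬ T (removable x j)
        at k refl r = irreducible k (pos-cong times (λ τ → cong (_- unit τ) (trans (V-unique x s c e′ j τ) (value-at {perturb 1ℚ b} s k τ)))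
                      (T-does (pos? times (λ τ → V x (S′ k) τ - unit τ)) r))

    opaque
      -- Reflect σ in the simplex that contains σ - ε y: the result is reduced.
      interior-height : ∀ {σ k} a → (∀ j → 0ℚ < a j) → σ ≗ combo a g → Lattice σ → σ zero ≡ int (ℤ.+ k) → m ℕ.≤ k ℕ.+ d
      interior-height {σ} {k} a a>0 e lat ht = result (locate⁻ σ a a>0 e)
        where
        result : (∃[ S ] ∃[ L ] Simplex S L × Contains L (perturb (- 1ℚ) σ)) → m ℕ.≤ k ℕ.+ d
        result (S , L , s , c) = ℤ.drop‿+≤+ (int-cancel-≤ (ℚ.≤-trans m≤Σ
            (ℚ.≤-trans (ℚ.≤-reflexive height) (int-mono-≤ (ℤ.+≤+ (ℕ.+-monoʳ-≤ k (reduced-height s b-contains b≡ irreducible)))))))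
          where
          κ : Fin m → Fin (suc N) → ℚ
          κ = coords L (perturb (- 1ℚ) σ)
          -- The least such number is the ceiling of the perturbed coordinate `κ i`, taken strictly
          -- above it.
          Beyond : Fin m → ℕ → Set
          Beyond i l = Pos times (λ t → int (ℤ.+ l) * unit t - κ i t)
          lem₀ : ∀ a b → a * 1ℚ - b ≡ a - b
          lem₀ = solve-∀ ℚring
          first : ∀ i → ∃[ l ] Beyond i l × (∀ j → j ℕ.< l → ¬ Beyond i j)
          first i = least (λ l → pos? times (λ t → int (ℤ.+ l) * unit t - κ i t)) (proj₁ (archimedean (κ i zero)))
            (inj₁ (subst (0ℚ <_) (sym (lem₀ (int (ℤ.+ proj₁ (archimedean (κ i zero)))) (κ i zero))) (0<- (proj₂ (archimedean (κ i zero))))))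
          l : Fin m → ℕ
          l i = proj₁ (first i)
          l≢0 : ∀ i → l i ≢ 0
          l≢0 i e = pos-asym times (c i) (pos-cong times (λ t → trans (cong (λ z → int (ℤ.+ z) * unit t - κ i t) e)
            (trans (cong (λ z → z * unit t - κ i t) int-0) (lem (unit t) (κ i t)))) (proj₁ (proj₂ (first i))))
            where
            lem : ∀ a b → 0ℚ * a - b ≡ - b
            lem = solve-∀ ℚring
          w : Vector ℚ m
          w i = int (ℤ.+ l i)
          b : Vector ℚ m
          b x = combo w (g ∘ S) x - σ x
          -- The reflection turns the perturbation of `σ` with sign -1 into the perturbation of `b`
          -- with sign 1, the one used for counting; hence the sign with which `σ` was located.
          b-coords : ∀ i t → coords L (perturb 1ℚ b) i t ≡ w i * unit t - κ i t
          b-coords i zero = trans (dot-minus (L i) (combo w (g ∘ S)) σ) (cong (_- dot (L i) σ) (trans (dot-combo (L i) w (g ∘ S))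
            (trans (sum-cong λ k → cong (w k *_) (trans (IsBasis.dual (Simplex.basis s) i k) (δ-sym i k))) (trans (sum-δʳ i w) (sym (ℚ.*-identityʳ (w i)))))))
          b-coords i (suc t) = trans (dot-* (L i) 1ℚ (g t)) (trans (lem (dot (L i) (g t)) (w i)) (cong (λ z → w i * 0ℚ - z) (sym (dot-* (L i) (- 1ℚ) (g t)))))
            where
            lem : ∀ a b → 1ℚ * a ≡ b * 0ℚ - - 1ℚ * a
            lem = solve-∀ ℚring
          b-contains : Contains L (perturb 1ℚ b)
          b-contains i = pos-cong times (λ t → sym (b-coords i t)) (proj₁ (proj₂ (first i)))
          b-lift : ∃[ v ] ∃[ h ] b ≗ lift v h
          b-lift = lattice⇒lift (λ x → Int-minus (Int-∑ _ λ i → Int-* (Int-int _) (g-lattice (S i) x)) (lat x))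
            (cone-height-nonneg (contains⇒cone s b-contains))
          h : ℕ
          h = proj₁ (proj₂ b-lift)
          b≡ : b ≗ lift (proj₁ b-lift) h
          b≡ = proj₂ (proj₂ b-lift)
          height : ∑ w ≡ int (ℤ.+ (k ℕ.+ h))
          height = trans (sum-cong λ i → sym (ℚ.*-identityʳ (w i))) (trans (lem (combo w (g ∘ S) zero) (σ zero)) (trans (cong₂ _+_ ht (b≡ zero))
            (trans (sym (int-+ (ℤ.+ k) (ℤ.+ h))) (cong int (sym (ℤ.pos-+ k h))))))
            where
            lem : ∀ a b → a ≡ b + (a - b)
            lem = solve-∀ ℚring
          -- Each `l i` is at least 1 because `κ i` is positive, and the sum of the `l i` is the sum
          -- of the heights of `σ` and `b`.
          m≤Σ : int (ℤ.+ m) ≤ ∑ w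
          m≤Σ = subst (_≤ ∑ w) (∑-1 m) (0≤-⇒≤ (subst (0ℚ ≤_) (sum-minus w (λ _ → 1ℚ)) (sum-nonneg λ i →
            0≤- (subst (_≤ w i) int-1 (int-mono-≤ (ℤ.+≤+ (ℕ.n≢0⇒n>0 (l≢0 i))))))))
          irreducible : ∀ i → ¬ Pos times (λ t → coords L (perturb 1ℚ b) i t - unit t)
          irreducible i p = at (l i) refl (proj₂ (proj₂ (first i)))
            where
            lem : ∀ a u k → (1ℚ + a) * u - k - u ≡ a * u - k
            lem = solve-∀ ℚring
            at : ∀ q → l i ≡ q → ¬ (∀ j → j ℕ.< q → ¬ Beyond i j)
            at zero     eq _   = l≢0 i eq
            at (suc l′) eq min = min l′ (ℕ.n<1+n l′) (pos-cong times
                (λ t → trans (cong (_- unit t) (trans (b-coords i t) (cong (λ z → int (ℤ.+ z) * unit t - κ i t) eq)))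
                  (trans (cong (λ z → z * unit t - κ i t - unit t) (int-suc l′)) (lem (int (ℤ.+ l′)) (unit t) (κ i t)))) p)

  -- Complements, indicators and positive parts

  cardinality-¬ : ∀ {n} (p : Fin n → Bool) → cardinality p ℕ.+ cardinality (not ∘ p) ≡ n
  cardinality-¬ {n} p = trans (sym (count-split (λ _ → true) p)) (count-all n)

  cardinality-≤ : ∀ {n} (p : Fin n → Bool) → cardinality p ℕ.≤ n
  cardinality-≤ {n} p = subst (cardinality p ℕ.≤_) (count-all n) (count-⊆ p (λ _ → true) λ _ _ → tt)

  cardinality-⊎ : ∀ {n} (p q r : Fin n → Bool) → (∀ i → T (p i) → T (r i)) → (∀ i → T (q i) → T (r i)) → (∀ i → T (p i) → ¬ T (q i)) →
    cardinality p ℕ.+ cardinality q ℕ.≤ cardinality r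
  cardinality-⊎ p q r p⊆r q⊆r disjoint = subst (cardinality p ℕ.+ cardinality q ℕ.≤_) (sym (count-split r p))
    (ℕ.+-mono-≤ (count-⊆ p _ λ i t → T-∧⁺ (p⊆r i t) t) (count-⊆ q _ λ i t → T-∧⁺ (q⊆r i t) (T-not λ u → disjoint i u t)))

  cardinality≤1 : ∀ {n} (p : Fin n → Bool) → cardinality p ℕ.≤ 1 → ∀ {i j} → T (p i) → T (p j) → i ≡ j
  cardinality≤1 p le {i} {j} pi pj = by-cases (i ≟ j) (λ e → e) λ i≢j → ⊥-elim (ℕ.<⇒≱ (subst (1 ℕ.<_) (sym (count-remove p i pi))
    (ℕ.s≤s (count-pos _ j (T-∧⁺ pj (T-not λ t → i≢j (T-does (i ≟ j) t)))))) le)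

  indicator : Bool → ℚ
  indicator b = if b then 1ℚ else 0ℚ

  ∑-indicator : ∀ {n} (p : Fin n → Bool) → ∑ (indicator ∘ p) ≡ int (ℤ.+ cardinality p)
  ∑-indicator p = trans (∑≡sum (indicator ∘ p)) (go p)
    where
    go : ∀ {n} (p : Fin n → Bool) → sum (indicator ∘ p) ≡ int (ℤ.+ cardinality p)
    go {zero}  p = sym int-0
    go {suc n} p with p zero
    ... | true  = trans (cong (1ℚ +_) (go (p ∘ suc))) (sym (int-suc (cardinality (p ∘ suc))))
    ... | false = trans (ℚ.+-identityˡ _) (go (p ∘ suc))

  0≤indicator : ∀ b → 0ℚ ≤ indicator b
  0≤indicator true  = 0≤1
  0≤indicator false = ℚ.≤-refl

  indicator-T : ∀ {b} → T b → indicator b ≡ 1ℚ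
  indicator-T {true} _ = refl

  Int-indicator : ∀ b → Int (indicator b)
  Int-indicator true  = Int-1
  Int-indicator false = Int-0

  opaque
    positivePart : ℚ → ℚ
    positivePart q = q ⊔ 0ℚ

    0≤positivePart : ∀ q → 0ℚ ≤ positivePart q
    0≤positivePart q = ℚ.p≤q⊔p q 0ℚ

    positivePart-pos : ∀ {q} → 0ℚ ≤ q → positivePart q ≡ q
    positivePart-pos p = ℚ.p≥q⇒p⊔q≡p p

    positivePart-neg : ∀ {q} → q ≤ 0ℚ → positivePart q ≡ 0ℚ
    positivePart-neg p = ℚ.p≤q⇒p⊔q≡q p

  0<positivePart : ∀ q → 0ℚ < positivePart q → 0ℚ < q
  0<positivePart q p with sign q
  ... | inj₁ q<0 = ⊥-elim (ℚ.<-irrefl (sym (positivePart-neg (ℚ.<⇒≤ q<0))) p)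
  ... | inj₂ 0≤q = subst (0ℚ <_) (positivePart-pos 0≤q) p

  split-parts : ∀ q → positivePart q ≡ q + positivePart (- q)
  split-parts q with sign q
  ... | inj₁ q<0 = trans (positivePart-neg (ℚ.<⇒≤ q<0)) (sym (trans (cong (q +_) (positivePart-pos (ℚ.<⇒≤ (neg-pos q<0)))) (ℚ.+-inverseʳ q)))
  ... | inj₂ 0≤q = trans (positivePart-pos 0≤q) (sym (trans (cong (q +_) (positivePart-neg (ℚ.neg-antimono-≤ 0≤q))) (ℚ.+-identityʳ q)))

  0<neg : ∀ {q} → 0ℚ < - q → q < 0ℚ
  0<neg {q} p = subst (_< 0ℚ) (lem q) (ℚ.neg-antimono-< p)
    where
    lem : ∀ a → - - a ≡ a
    lem = solve-∀ ℚring

  T-∨⁻ : ∀ {a b} → T (a ∨ b) → T a ⊎ T b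
  T-∨⁻ {true}  _ = inj₁ tt
  T-∨⁻ {false} t = inj₂ t

  T-∨ˡ : ∀ {a b} → T a → T (a ∨ b)
  T-∨ˡ {true} _ = tt

  T-∨ʳ : ∀ {a b} → T b → T (a ∨ b)
  T-∨ʳ {true}  _ = tt
  T-∨ʳ {false} t = t

  -- Faces of the cone and the greedy search for exceptional vertices

  module Greedy {n d} (P : LatticePolytope n) (full : FullDimensional P) (degree : HasDegree P d) where

    open Cone P
    open Ehrhart P full degree public using (S₀; L₀; basis₀; interior-height)

    -- v lies in the smallest face of the cone that contains σ.
    record Face (σ v : Vector ℚ m) : Set where
      constructor face
      field
        weight    : ℚ
        0<weight  : 0ℚ < weight
        remainder : InCone (λ l → σ l - weight * v l)

    face-cong : ∀ {σ v w} → v ≗ w → Face σ v → Face σ w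
    face-cong {σ} e (face t 0<t c) = face t 0<t $ cone-cong (λ l → cong (λ z → σ l - t * z) (e l)) c

    face-0 : ∀ {σ} → InCone σ → Face σ (λ _ → 0ℚ)
    face-0 {σ} c = face 1ℚ 0<1 $ cone-cong (λ l → lem (σ l)) c
      where
      lem : ∀ a → a ≡ a - 1ℚ * 0ℚ
      lem = solve-∀ ℚring

    face-* : ∀ {σ v c} → 0ℚ < c → Face σ v → Face σ (λ l → c * v l)
    face-* {σ} {v} {c} 0<c (face t 0<t k) with inverse-pos c 0<c
    ... | r , 0<r , cr = face (t * r) (0<* 0<t 0<r) $ cone-cong (λ l → cong (λ z → σ l - z) (sym
            (trans (lem t r c (v l)) (trans (cong (t * v l *_) cr) (ℚ.*-identityʳ (t * v l)))))) k
      where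
      lem : ∀ t r c v → t * r * (c * v) ≡ t * v * (c * r)
      lem = solve-∀ ℚring

    face-+ : ∀ {σ v w} → Face σ v → Face σ w → Face σ (λ l → v l + w l)
    face-+ {σ} {v} {w} (face t 0<t c) (face s 0<s c′) with inverse-pos (s + t) (0<+ 0<s (ℚ.<⇒≤ 0<t))
    -- The average of `σ - t v` and `σ - s w`, weighted in proportion to `s` and `t`, is `σ` minus
    -- `s t / (s + t)` times `v + w`.
    ... | r , 0<r , e = face (s * t * r) (0<* (0<* 0<s 0<t) 0<r) $
          cone-cong (λ l → trans (lem s t r (σ l) (v l) (w l)) (trans (cong (λ z → z * σ l - s * t * r * (v l + w l)) e) (cong (_- s * t * r * (v l + w l)) (ℚ.*-identityˡ (σ l)))))
            (cone-+ (cone-* (ℚ.<⇒≤ (0<* 0<s 0<r)) c) (cone-* (ℚ.<⇒≤ (0<* 0<t 0<r)) c′))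
      where
      lem : ∀ s t r σ v w → s * r * (σ - t * v) + t * r * (σ - s * w) ≡ (s + t) * r * σ - s * t * r * (v + w)
      lem = solve-∀ ℚring

    -- The extremality that distinguishes faces from other subcones: the other summand can be added
    -- back to the remainder without leaving the cone.
    face-summand : ∀ {σ} v w → InCone w → Face σ (λ l → v l + w l) → Face σ v
    face-summand {σ} v w c (face t 0<t k) = face t 0<t $ cone-cong (λ l → lem (σ l) t (v l) (w l)) (cone-+ k (cone-* (ℚ.<⇒≤ 0<t) c))
      where
      lem : ∀ σ t v w → σ - t * (v + w) + t * w ≡ σ - t * v
      lem = solve-∀ ℚring

    face-mono : ∀ {σ τ v} → InCone τ → Face σ v → Face (λ l → σ l + τ l) v
    face-mono {σ} {τ} {v} c (face t 0<t k) = face t 0<t $ cone-cong (λ l → lem (σ l) t (v l) (τ l)) (cone-+ k c)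
      where
      lem : ∀ σ t v τ → σ - t * v + τ ≡ σ + τ - t * v
      lem = solve-∀ ℚring

    face-self : ∀ {σ} v → InCone σ → Face (λ l → σ l + v l) v
    face-self {σ} v c = face 1ℚ 0<1 $ cone-cong (λ l → lem (σ l) (v l)) c
      where
      lem : ∀ σ v → σ ≡ σ + v - 1ℚ * v
      lem = solve-∀ ℚring

    face-combo : ∀ {k σ} (a : Vector ℚ k) (y : Fin k → Vector ℚ m) → InCone σ → (∀ i → 0ℚ ≤ a i) → (∀ i → 0ℚ < a i → Face σ (y i)) →
      Face σ (combo a y)
    face-combo {k} {σ} a y c p f = face-cong (λ l → sym (∑≡sum (λ i → a i * y i l))) (go k a y p f)
      where
      go : ∀ k (a : Vector ℚ k) (y : Fin k → Vector ℚ m) → (∀ i → 0ℚ ≤ a i) → (∀ i → 0ℚ < a i → Face σ (y i)) → Face σ (λ l → sum λ i → a i * y i l)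
      go zero    a y p f = face-0 c
      go (suc k) a y p f = face-+ (by-cases (a zero ℚ.≟ 0ℚ)
          (λ e → face-cong (λ l → sym (trans (cong (_* y zero l) e) (ℚ.*-zeroˡ (y zero l)))) (face-0 c))
          (λ ne → face-* (≤≢⇒< (p zero) ne) (f zero (≤≢⇒< (p zero) ne))))
        (go k (a ∘ suc) (y ∘ suc) (p ∘ suc) (f ∘ suc))

    module _ {k : ℕ} (a : Vector ℚ k) (y : Fin k → Vector ℚ m) (a≥0 : ∀ i → 0ℚ ≤ a i) (y∈ : ∀ i → InCone (y i)) where

      private
        rest : Fin k → Vector ℚ k
        rest i j = a j - δ i j * a j

        rest≥0 : ∀ i j → 0ℚ ≤ rest i j
        rest≥0 i j = by-cases (i ≟ j)
          (λ { refl → ℚ.≤-reflexive (sym (trans (cong (λ z → a i - z * a i) (δ-refl i)) (lem (a i)))) })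
          λ ne → subst (0ℚ ≤_) (sym (trans (cong (λ z → a j - z * a j) (δ-≢ ne)) (lem₂ (a j)))) (a≥0 j)
          where
          lem : ∀ a → a - 1ℚ * a ≡ 0ℚ
          lem = solve-∀ ℚring
          lem₂ : ∀ a → a - 0ℚ * a ≡ a
          lem₂ = solve-∀ ℚring

        combo-rest : ∀ i l → combo (rest i) y l ≡ combo a y l - a i * y i l
        combo-rest i l = trans (sum-cong λ j → lem (a j) (δ i j) (y j l)) (trans (sum-minus (λ j → a j * y j l) (λ j → δ i j * (a j * y j l)))
          (cong (λ z → combo a y l - z) (sum-δ i (λ j → a j * y j l))))
          where
          lem : ∀ a d y → (a - d * a) * y ≡ a * y - d * (a * y)
          lem = solve-∀ ℚring

        rest-cone : ∀ i → InCone (combo (rest i) y)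
        rest-cone i = cone-combo (rest i) y (rest≥0 i) y∈

      face-term : ∀ {σ} → Face σ (combo a y) → ∀ i → 0ℚ < a i → Face σ (y i)
      face-term {σ} f i 0<a with inverse-pos (a i) 0<a
      ... | r , 0<r , ar = face-cong (λ l → trans (lem r (a i) (y i l)) (trans (cong (_* y i l) ar) (ℚ.*-identityˡ (y i l))))
            (face-* 0<r (face-summand (λ l → a i * y i l) (combo (rest i) y) (rest-cone i)
              (face-cong (λ l → sym (trans (cong (a i * y i l +_) (combo-rest i l)) (lem₂ (a i * y i l) (combo a y l)))) f)))
        where
        lem : ∀ r a y → r * (a * y) ≡ a * r * y
        lem = solve-∀ ℚring
        lem₂ : ∀ a c → a + (c - a) ≡ c
        lem₂ = solve-∀ ℚring

      face-of-combo : ∀ i → 0ℚ < a i → Face (combo a y) (y i)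
      face-of-combo i 0<a = face (a i) 0<a $ cone-cong (combo-rest i) (rest-cone i)

    -- A face containing a basis is the whole cone: after its negative coordinates are moved to the
    -- other side, each generator is a summand of a nonnegative combination of the basis. So `σ`
    -- minus a positive multiple of the sum of all generators stays in the cone, and this gives the
    -- strictly positive coefficients that `interior-height` asks for.
    interior-lattice-point : ∀ {S L} → IsBasis (g ∘ S) L → ∀ {σ k} → InCone σ → Lattice σ → σ zero ≡ int (ℤ.+ k) →
      (∀ i → Face σ (g (S i))) → m ℕ.≤ k ℕ.+ d
    interior-lattice-point {S} {L} b {σ} c lat ht f = interior all
      where
      λ⁺ λ⁻ : Fin N → Vector ℚ m
      λ⁺ j i = positivePart (dot (L i) (g j))
      λ⁻ j i = positivePart (- dot (L i) (g j))
      each : ∀ j → Face σ (g j)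
      each j = face-summand (g j) (combo (λ⁻ j) (g ∘ S)) (cone-combo (λ⁻ j) (g ∘ S) (λ i → 0≤positivePart _) (cone-g ∘ S))
        (face-cong (λ l → trans (trans (sum-cong λ i → trans (cong (_* g (S i) l) (split-parts (dot (L i) (g j)))) (ℚ.*-distribʳ-+ (g (S i) l) (dot (L i) (g j)) (λ⁻ j i)))
            (sum-+ (λ i → dot (L i) (g j) * g (S i) l) (λ i → λ⁻ j i * g (S i) l))) (cong (_+ combo (λ⁻ j) (g ∘ S) l) (sym (IsBasis.expand b (g j) l))))
          (face-combo (λ⁺ j) (g ∘ S) c (λ i → 0≤positivePart _) (λ i _ → f i)))
      all : Face σ (combo (λ _ → 1ℚ) g)
      all = face-combo (λ _ → 1ℚ) g c (λ _ → 0≤1) (λ j _ → each j)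
      interior : Face σ (combo (λ _ → 1ℚ) g) → m ℕ.≤ _ ℕ.+ d
      interior (face t 0<t (a , a≥0 , e)) = interior-height (λ j → t + a j) (λ j → 0<+ 0<t (a≥0 j)) (λ l → trans (lem (σ l) (t * combo (λ _ → 1ℚ) g l))
          (trans (cong₂ _+_ (sym (sum-*ˡ t (λ j → 1ℚ * g j l))) (e l)) (trans (sym (sum-+ (λ j → t * (1ℚ * g j l)) (λ j → a j * g j l)))
            (sum-cong λ j → lem₂ t (a j) (g j l))))) lat ht
        where
        lem : ∀ a b → a ≡ b + (a - b)
        lem = solve-∀ ℚring
        lem₂ : ∀ t a g → t * (1ℚ * g) + a * g ≡ (t + a) * g
        lem₂ = solve-∀ ℚring

    private
      v : Fin m → Vector ℚ m
      v = g ∘ S₀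

      coord : Fin N → Fin m → ℚ
      coord j i = dot (L₀ i) (g j)

      -- The relation between a generator and the basis, arranged so that all coefficients are
      -- nonnegative: a face that contains one side contains every term of the other.
      parts : ∀ j l → combo (λ i → positivePart (coord j i)) v l ≡ g j l + combo (λ i → positivePart (- coord j i)) v l
      parts j l = trans (trans (sum-cong λ i → trans (cong (_* v i l) (split-parts (coord j i))) (ℚ.*-distribʳ-+ (v i l) (coord j i) (positivePart (- coord j i))))
        (sum-+ (λ i → coord j i * v i l) (λ i → positivePart (- coord j i) * v i l))) (cong (_+ combo (λ i → positivePart (- coord j i)) v l) (sym (IsBasis.expand basis₀ (g j) l)))

      0<⁺ : ∀ {q} → 0ℚ < q → 0ℚ < positivePart q
      0<⁺ p = subst (0ℚ <_) (sym (positivePart-pos (ℚ.<⇒≤ p))) p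

      complete-positive : ∀ {τ} j → InCone τ → Face τ (g j) → (∀ i → coord j i < 0ℚ → Face τ (v i)) → ∀ i → 0ℚ < coord j i → Face τ (v i)
      complete-positive j c fw fn i p = face-term (λ i → positivePart (coord j i)) v (λ i → 0≤positivePart _) (cone-g ∘ S₀)
        (face-cong (λ l → sym (parts j l)) (face-+ fw (face-combo _ v c (λ i → 0≤positivePart _) λ i q → fn i (0<neg (0<positivePart _ q))))) i (0<⁺ p)

      complete-negative : ∀ {τ} j → InCone τ → (∀ i → 0ℚ < coord j i → Face τ (v i)) → ∀ i → coord j i < 0ℚ → Face τ (v i)
      complete-negative {τ} j c fp i p = face-term (λ i → positivePart (- coord j i)) v (λ i → 0≤positivePart _) (cone-g ∘ S₀)
        (face-summand (combo (λ i → positivePart (- coord j i)) v) (g j) (cone-g j)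
          (face-cong (λ l → trans (parts j l) (ℚ.+-comm (g j l) (combo (λ i → positivePart (- coord j i)) v l)))
            (face-combo _ v c (λ i → 0≤positivePart _) λ i q → fp i (0<positivePart _ q)))) i (0<⁺ (neg-pos p))

      vertices : (Fin m → Bool) → Vector ℚ m
      vertices q = combo (indicator ∘ q) v

      vertices-cone : ∀ q → InCone (vertices q)
      vertices-cone q = cone-combo (indicator ∘ q) v (λ i → 0≤indicator (q i)) (cone-g ∘ S₀)

      vertices-lattice : ∀ q → Lattice (vertices q)
      vertices-lattice q l = Int-∑ _ λ i → Int-* (Int-indicator (q i)) (g-lattice (S₀ i) l)

      vertices-height : ∀ q → vertices q zero ≡ int (ℤ.+ cardinality q)
      vertices-height q = trans (sum-cong λ i → ℚ.*-identityʳ (indicator (q i))) (∑-indicator q)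

      face-vertices : ∀ {τ} q → InCone τ → ∀ i → T (q i) → Face (λ l → τ l + vertices q l) (v i)
      face-vertices {τ} q c i t = face-cong′ (face-mono c (face-of-combo (indicator ∘ q) v (λ i → 0≤indicator (q i)) (cone-g ∘ S₀) i
          (subst (0ℚ <_) (sym (indicator-T t)) 0<1)))
        where
        face-cong′ : Face (λ l → vertices q l + τ l) (v i) → Face (λ l → τ l + vertices q l) (v i)
        face-cong′ (face t 0<t k) = face t 0<t $ cone-cong (λ l → cong (_- t * v i l) (ℚ.+-comm (vertices q l) (τ l))) k

      -- A lattice point τ of small height whose face contains many vertices of S₀.
      record Cheap (B : Fin m → Bool) : Set where
        field
          τ       : Vector ℚ m
          height  : ℕ
          in-cone : InCone τ
          lattice : Lattice τ
          τ-zero  : τ zero ≡ int (ℤ.+ height)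
          faces   : ∀ i → T (B i) → Face τ (v i)
          cheap   : 3 ℕ.* height ℕ.≤ 2 ℕ.* cardinality B

      record Extension (B : Fin m → Bool) (c : Cheap B) (q : Fin m → Bool) : Set where
        open Cheap c
        field
          τ′         : Vector ℚ m
          in-cone′   : InCone τ′
          lattice′   : Lattice τ′
          τ′-zero    : τ′ zero ≡ int (ℤ.+ (height ℕ.+ cardinality q))
          old-faces  : ∀ w → Face τ w → Face τ′ w
          new-faces  : ∀ i → T (q i) → Face τ′ (v i)

      opaque
        add-vertices : ∀ {B} (c : Cheap B) q → Extension B c q
        add-vertices c q = record
          { τ′        = λ l → τ l + vertices q l
          ; in-cone′  = cone-+ in-cone (vertices-cone q)
          ; lattice′  = λ l → Int-+ (lattice l) (vertices-lattice q l)
          ; τ′-zero   = trans (cong₂ _+_ τ-zero (vertices-height q)) (trans (sym (int-+ (ℤ.+ height) (ℤ.+ cardinality q)))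
                          (cong int (sym (ℤ.pos-+ height (cardinality q)))))
          ; old-faces = λ w → face-mono (vertices-cone q)
          ; new-faces = face-vertices q in-cone }
          where open Cheap c

      module Step {B : Fin m → Bool} (c : Cheap B) (j : Fin N) where
        open Cheap c

        new⁻ new⁺ B′ : Fin m → Bool
        new⁻ i = not (B i) ∧ does (coord j i ℚ.<? 0ℚ)
        new⁺ i = not (B i) ∧ does (0ℚ ℚ.<? coord j i)
        B′ i = B i ∨ (new⁻ i ∨ new⁺ i)

        ν p : ℕ
        ν = cardinality new⁻
        p = cardinality new⁺

        new⁻-sign : ∀ i → T (new⁻ i) → coord j i < 0ℚ
        new⁻-sign i t = T-does (coord j i ℚ.<? 0ℚ) (proj₂ (T-∧⁻ {not (B i)} t))

        new⁺-sign : ∀ i → T (new⁺ i) → 0ℚ < coord j i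
        new⁺-sign i t = T-does (0ℚ ℚ.<? coord j i) (proj₂ (T-∧⁻ {not (B i)} t))

        is-new⁻ : ∀ i → coord j i < 0ℚ → T (B i) ⊎ T (new⁻ i)
        is-new⁻ i q = by-cases (T? (B i)) inj₁ λ ¬b → inj₂ (T-∧⁺ (T-not ¬b) (does-T (coord j i ℚ.<? 0ℚ) q))

        is-new⁺ : ∀ i → 0ℚ < coord j i → T (B i) ⊎ T (new⁺ i)
        is-new⁺ i q = by-cases (T? (B i)) inj₁ λ ¬b → inj₂ (T-∧⁺ (T-not ¬b) (does-T (0ℚ ℚ.<? coord j i) q))

        growth : cardinality B ℕ.+ (ν ℕ.+ p) ℕ.≤ cardinality B′
        growth = ℕ.≤-trans (ℕ.+-monoʳ-≤ (cardinality B) (cardinality-⊎ new⁻ new⁺ new (λ i → T-∨ˡ {new⁻ i}) (λ i → T-∨ʳ {new⁻ i})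
            λ i t u → ℚ.<-asym (new⁻-sign i t) (new⁺-sign i u)))
          (cardinality-⊎ B new B′ (λ i → T-∨ˡ {B i}) (λ i → T-∨ʳ {B i}) λ i b t → helper i b (T-∨⁻ {new⁻ i} t))
          where
          new : Fin m → Bool
          new i = new⁻ i ∨ new⁺ i
          helper : ∀ i → T (B i) → ¬ (T (new⁻ i) ⊎ T (new⁺ i))
          helper i b (inj₁ t) = T-not⁻ (proj₁ (T-∧⁻ {not (B i)} t)) b
          helper i b (inj₂ t) = T-not⁻ (proj₁ (T-∧⁻ {not (B i)} t)) b

        face′ : ∀ {τ′} → (∀ i → T (B i) → Face τ′ (v i)) → (∀ i → T (new⁻ i) → Face τ′ (v i)) → (∀ i → T (new⁺ i) → Face τ′ (v i)) →
          ∀ i → T (B′ i) → Face τ′ (v i)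
        face′ fB f⁻ f⁺ i t = [ fB i , (λ u → [ f⁻ i , f⁺ i ]′ (T-∨⁻ {new⁻ i} u)) ]′ (T-∨⁻ {B i} t)

        -- Adding gⱼ and its negative vertices forces the positive ones into the face,
        -- and adding the positive vertices forces the negative ones; the cheaper of
        -- the two is chosen.
        via-negative : 3 ℕ.* (height ℕ.+ ν ℕ.+ 1) ℕ.≤ 2 ℕ.* cardinality B′ → Cheap B′
        via-negative le = record
          { τ       = λ l → τ′ l + g j l
          ; height  = height ℕ.+ ν ℕ.+ 1
          ; in-cone = cone-+ in-cone′ (cone-g j)
          ; lattice = λ l → Int-+ (lattice′ l) (g-lattice j l)
          ; τ-zero  = trans (cong₂ _+_ τ′-zero (sym int-1)) (trans (sym (int-+ (ℤ.+ (height ℕ.+ ν)) ℤ.1ℤ)) (cong int (sym (ℤ.pos-+ (height ℕ.+ ν) 1))))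
          ; faces   = face′ fB f⁻ (λ i t → complete-positive j (cone-+ in-cone′ (cone-g j)) (face-self (g j) in-cone′) fneg i (new⁺-sign i t))
          ; cheap   = le }
          where
          open Extension (add-vertices c new⁻)
          fB : ∀ i → T (B i) → Face (λ l → τ′ l + g j l) (v i)
          fB i b = face-mono (cone-g j) (old-faces (v i) (faces i b))
          f⁻ : ∀ i → T (new⁻ i) → Face (λ l → τ′ l + g j l) (v i)
          f⁻ i t = face-mono (cone-g j) (new-faces i t)
          fneg : ∀ i → coord j i < 0ℚ → Face (λ l → τ′ l + g j l) (v i)
          fneg i q = [ fB i , f⁻ i ]′ (is-new⁻ i q)

        via-positive : 3 ℕ.* (height ℕ.+ p) ℕ.≤ 2 ℕ.* cardinality B′ → Cheap B′
        via-positive le = record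
          { τ       = τ′
          ; height  = height ℕ.+ p
          ; in-cone = in-cone′
          ; lattice = lattice′
          ; τ-zero  = τ′-zero
          ; faces   = face′ fB (λ i t → complete-negative j in-cone′ fpos i (new⁻-sign i t)) new-faces
          ; cheap   = le }
          where
          open Extension (add-vertices c new⁺)
          fB : ∀ i → T (B i) → Face τ′ (v i)
          fB i b = old-faces (v i) (faces i b)
          fpos : ∀ i → 0ℚ < coord j i → Face τ′ (v i)
          fpos i q = [ fB i , new-faces i ]′ (is-new⁺ i q)

        -- The cases in which absorbing vertices is worth its cost. When no generator is bad, both
        -- properties in `Settled` hold outside `B`.
        Bad : Set
        Bad = 0 ℕ.< ν ⊎ 1 ℕ.< p

        bad⇒3+ν≤2p : ν ℕ.< p → Bad → 3 ℕ.+ ν ℕ.≤ 2 ℕ.* p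
        bad⇒3+ν≤2p lt bad = subst (3 ℕ.+ ν ℕ.≤_) (sym (lem p)) (ℕ.≤-trans (ℕ.≤-reflexive (lem₂ ν)) (ℕ.+-mono-≤ (1<p bad) lt))
          where
          1<p : Bad → 2 ℕ.≤ p
          1<p (inj₁ q) = ℕ.≤-trans (ℕ.s≤s q) lt
          1<p (inj₂ q) = q
          lem : ∀ p → 2 ℕ.* p ≡ p ℕ.+ p
          lem = ℕsolver.solve-∀
          lem₂ : ∀ ν → 3 ℕ.+ ν ≡ 2 ℕ.+ (1 ℕ.+ ν)
          lem₂ = ℕsolver.solve-∀

        -- The route through the negative vertices costs `ν + 1` and needs `3 + ν ≤ 2 p`; the route
        -- through the positive ones costs `p` and needs `p ≤ 2 ν`. The former serves when `ν < p`,
        -- the latter otherwise.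
        step : Bad → Cheap B′
        step bad = by-cases (ν ℕ.<? p)
          (λ lt → via-negative (ℕ.≤-trans (ℕ.≤-reflexive (lem height ν)) (ℕ.≤-trans (ℕ.+-mono-≤ cheap (ℕ.+-monoʳ-≤ (2 ℕ.* ν) (bad⇒3+ν≤2p lt bad)))
                  (ℕ.≤-trans (ℕ.≤-reflexive (lem₂ (cardinality B) ν p)) (ℕ.*-monoʳ-≤ 2 growth)))))
          λ ge → via-positive (ℕ.≤-trans (ℕ.≤-reflexive (lem₃ height p)) (ℕ.≤-trans (ℕ.+-mono-≤ cheap (ℕ.+-monoˡ-≤ (2 ℕ.* p) (ℕ.≤-trans (ℕ.≮⇒≥ ge) (ℕ.m≤n*m ν 2))))
                  (ℕ.≤-trans (ℕ.≤-reflexive (lem₂ (cardinality B) ν p)) (ℕ.*-monoʳ-≤ 2 growth))))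
          where
          lem : ∀ h ν → 3 ℕ.* (h ℕ.+ ν ℕ.+ 1) ≡ 3 ℕ.* h ℕ.+ (2 ℕ.* ν ℕ.+ (3 ℕ.+ ν))
          lem = ℕsolver.solve-∀
          lem₂ : ∀ b ν p → 2 ℕ.* b ℕ.+ (2 ℕ.* ν ℕ.+ 2 ℕ.* p) ≡ 2 ℕ.* (b ℕ.+ (ν ℕ.+ p))
          lem₂ = ℕsolver.solve-∀
          lem₃ : ∀ h p → 3 ℕ.* (h ℕ.+ p) ≡ 3 ℕ.* h ℕ.+ (p ℕ.+ 2 ℕ.* p)
          lem₃ = ℕsolver.solve-∀

        bad⇒new : Bad → 1 ℕ.≤ ν ℕ.+ p
        bad⇒new (inj₁ q) = ℕ.≤-trans q (ℕ.m≤m+n ν p)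
        bad⇒new (inj₂ q) = ℕ.≤-trans (ℕ.<⇒≤ q) (ℕ.m≤n+m p ν)

        bad? : Dec Bad
        bad? = (0 ℕ.<? ν) ⊎-dec (1 ℕ.<? p)

        settled⁻ : ¬ Bad → ∀ i → ¬ T (B i) → 0ℚ ≤ coord j i
        settled⁻ ok i ¬b = ℚ.≮⇒≥ λ q → ok (inj₁ (count-pos new⁻ i (T-∧⁺ (T-not ¬b) (does-T (coord j i ℚ.<? 0ℚ) q))))

        settled⁺ : ¬ Bad → ∀ {i k} → ¬ T (B i) → ¬ T (B k) → 0ℚ < coord j i → 0ℚ < coord j k → i ≡ k
        settled⁺ ok {i} {k} ¬b ¬b′ q q′ = cardinality≤1 new⁺ (ℕ.≮⇒≥ (ok ∘ inj₂))
          (T-∧⁺ (T-not ¬b) (does-T (0ℚ ℚ.<? coord j i) q)) (T-∧⁺ (T-not ¬b′) (does-T (0ℚ ℚ.<? coord j k) q′))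

      Settled : (Fin m → Bool) → Set
      Settled B = (∀ j i → ¬ T (B i) → 0ℚ ≤ coord j i) × (∀ j {i k} → ¬ T (B i) → ¬ T (B k) → 0ℚ < coord j i → 0ℚ < coord j k → i ≡ k)

      -- `k` is fuel: it bounds the number of indices outside `B`, and every bad step enlarges `B`.
      search : ∀ k {B} → Cheap B → m ℕ.≤ k ℕ.+ cardinality B → ∃[ B ] Cheap B × Settled B
      search k {B} c le = by-cases (any? λ j → Step.bad? c j) (continue k le)
        λ ¬bad → B , c , (λ j → Step.settled⁻ c j (λ b → ¬bad (j , b))) , (λ j → Step.settled⁺ c j (λ b → ¬bad (j , b)))
        where
        grow : ∀ j → Step.Bad c j → cardinality B ℕ.< cardinality (Step.B′ c j)
        grow j bad = ℕ.≤-trans (ℕ.≤-reflexive (ℕ.+-comm 1 (cardinality B))) (ℕ.≤-trans (ℕ.+-monoʳ-≤ (cardinality B) (Step.bad⇒new c j bad)) (Step.growth c j))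
        continue : ∀ k → m ℕ.≤ k ℕ.+ cardinality B → (∃[ j ] Step.Bad c j) → ∃[ B ] Cheap B × Settled B
        continue zero    le (j , bad) = ⊥-elim (ℕ.<⇒≱ (grow j bad) (ℕ.≤-trans (cardinality-≤ (Step.B′ c j)) le))
        continue (suc k) le (j , bad) = search k (Step.step c j bad) (ℕ.≤-trans le (ℕ.≤-trans (ℕ.≤-reflexive (sym (ℕ.+-suc k (cardinality B)))) (ℕ.+-monoʳ-≤ k (grow j bad))))

      initial : Cheap (λ _ → false)
      initial = record { τ = λ _ → 0ℚ ; height = 0 ; in-cone = cone-0 ; lattice = λ _ → Int-0 ; τ-zero = sym int-0 ; faces = λ _ () ; cheap = ℕ.z≤n }

      -- Adding the vertices outside `B` to `τ` yields an interior lattice point of height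
      -- `height + m - |B|`, whence `|B| ≤ height + d`. Tripling this and using `cheap` leaves
      -- `|B| ≤ 3 d`.
      cheap-bound : ∀ {B} → Cheap B → cardinality B ℕ.≤ 3 ℕ.* d
      cheap-bound {B} c = ℕ.+-cancelˡ-≤ (2 ℕ.* b) b (3 ℕ.* d) (ℕ.≤-trans (ℕ.≤-reflexive (lem b))
            (ℕ.≤-trans (ℕ.*-monoʳ-≤ 3 b≤) (ℕ.≤-trans (ℕ.≤-reflexive (ℕ.*-distribˡ-+ 3 height d)) (ℕ.+-monoˡ-≤ (3 ℕ.* d) cheap))))
        where
        open Cheap c
        open Extension (add-vertices c (not ∘ B))
        b : ℕ
        b = cardinality B
        lem : ∀ b → 2 ℕ.* b ℕ.+ b ≡ 3 ℕ.* b
        lem = ℕsolver.solve-∀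
        lem₂ : ∀ h x d → h ℕ.+ x ℕ.+ d ≡ h ℕ.+ d ℕ.+ x
        lem₂ = ℕsolver.solve-∀
        all : ∀ i → Face τ′ (v i)
        all i = by-cases (T? (B i)) (λ t → old-faces (v i) (faces i t)) (λ ¬t → new-faces i (T-not ¬t))
        b≤ : b ℕ.≤ height ℕ.+ d
        b≤ = ℕ.+-cancelʳ-≤ (cardinality (not ∘ B)) b (height ℕ.+ d) (ℕ.≤-trans (ℕ.≤-reflexive (cardinality-¬ B))
          (ℕ.≤-trans (interior-lattice-point basis₀ in-cone′ lattice′ τ′-zero all) (ℕ.≤-reflexive (lem₂ height (cardinality (not ∘ B)) d))))

    opaque
      exceptional : ∃[ B ] cardinality B ℕ.≤ 3 ℕ.* d ×
        (∀ j i → ¬ T (B i) → 0ℚ ≤ dot (L₀ i) (g j)) ×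
        (∀ j {i k} → ¬ T (B i) → ¬ T (B k) → 0ℚ < dot (L₀ i) (g j) → 0ℚ < dot (L₀ k) (g j) → i ≡ k)
      exceptional = let B , c , s = search m initial (ℕ.m≤m+n m _) in B , cheap-bound c , s

  -- Fractional parts and integrality

  Int-below-1 : ∀ {q} → Int q → 0ℚ ≤ q → q < 1ℚ → q ≡ 0ℚ
  Int-below-1 i p lt with Int-nonneg i p
  ... | zero  , e = trans e int-0
  ... | suc k , e = ⊥-elim (ℚ.<-irrefl refl (ℚ.<-≤-trans (subst (_< 1ℚ) (trans e (int-suc k)) lt)
    (0≤-⇒≤ (subst (0ℚ ≤_) (lem (int (ℤ.+ k))) (0≤int k)))))
    where
    lem : ∀ a → a ≡ 1ℚ + a - 1ℚ
    lem = solve-∀ ℚring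

  Int-unit-interval : ∀ {q} → Int q → 0ℚ ≤ q → q ≤ 1ℚ → q ≡ 0ℚ ⊎ q ≡ 1ℚ
  Int-unit-interval {q} i p le with ℚ.<-cmp q 1ℚ
  ... | tri< lt _ _ = inj₁ (Int-below-1 i p lt)
  ... | tri≈ _ e _  = inj₂ e
  ... | tri> _ _ gt = ⊥-elim (ℚ.<-irrefl refl (ℚ.<-≤-trans gt le))

  opaque
    frac : ℚ → ℚ
    frac q = q - int (proj₁ (floor q))

    frac-int : ∀ q → Int (q - frac q)
    frac-int q = proj₁ (floor q) , lem q (int (proj₁ (floor q)))
      where
      lem : ∀ a b → a - (a - b) ≡ b
      lem = solve-∀ ℚring

    0≤frac : ∀ q → 0ℚ ≤ frac q
    0≤frac q = proj₁ (proj₂ (floor q))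

    frac<1 : ∀ q → frac q < 1ℚ
    frac<1 q = proj₂ (proj₂ (floor q))

  frac≡0⇒Int : ∀ q → frac q ≡ 0ℚ → Int q
  frac≡0⇒Int q e = Int-≡ (trans (cong (λ z → q - z) e) (lem q)) (frac-int q)
    where
    lem : ∀ a → a - 0ℚ ≡ a
    lem = solve-∀ ℚring

  Int⇒frac≡0 : ∀ q → Int q → frac q ≡ 0ℚ
  Int⇒frac≡0 q i = Int-below-1 (Int-≡ (lem q (frac q)) (Int-minus i (frac-int q))) (0≤frac q) (frac<1 q)
    where
    lem : ∀ a b → a - (a - b) ≡ b
    lem = solve-∀ ℚring

  Int? : ∀ q → Dec (Int q)
  Int? q = by-cases (frac q ℚ.≟ 0ℚ) (λ e → yes (frac≡0⇒Int q e)) (λ ne → no (ne ∘ Int⇒frac≡0 q))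

  -- Outside the support of a heaviest word of a linear code, no weight exceeds half
  -- the maximum.
  module Supports {m : ℕ} {W : Set} (supp : W → Fin m → Bool) (_⊕_ : W → W → W)
    (⊕ˡ : ∀ x y i → T (supp x i) → ¬ T (supp y i) → T (supp (x ⊕ y) i))
    (⊕ʳ : ∀ x y i → ¬ T (supp x i) → T (supp y i) → T (supp (x ⊕ y) i))
    (U : Fin m → Bool) (used : ∀ i → T (U i) → ∃[ x ] T (supp x i)) where

    private
      weight : (Fin m → Bool) → W → ℕ
      weight D x = cardinality (λ i → D i ∧ supp x i)

      -- Within `D`, let `y` have `a` coordinates outside the support of `x` and `b` inside. The sum
      -- of the words contains the symmetric difference of the supports, so its weight is at least
      -- that of `x` minus `b` plus `a`. As `x` is heaviest, `a ≤ b`, while `a + b ≤ c`.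
      half : ∀ {c} D x → (∀ y → weight D y ℕ.≤ c) → c ℕ.≤ weight D x → ∀ y → 2 ℕ.* weight (λ i → D i ∧ not (supp x i)) y ℕ.≤ c
      half {c} D x bound heavy y = ℕ.≤-trans (ℕ.≤-reflexive (lem a)) (ℕ.≤-trans (ℕ.+-monoʳ-≤ a a≤b) a+b≤c)
        where
        lem : ∀ a → 2 ℕ.* a ≡ a ℕ.+ a
        lem = ℕsolver.solve-∀
        A Bc X : Fin m → Bool
        A i = (D i ∧ not (supp x i)) ∧ supp y i
        Bc i = (D i ∧ supp x i) ∧ supp y i
        X i = (D i ∧ supp x i) ∧ not (supp y i)
        a b e : ℕ
        a = cardinality A
        b = cardinality Bc
        e = cardinality X
        A-D : ∀ i → T (A i) → T (D i) × ¬ T (supp x i) × T (supp y i)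
        A-D i t = let u , s = T-∧⁻ {D i ∧ not (supp x i)} t ; v , n = T-∧⁻ {D i} u in v , T-not⁻ n , s
        B-D : ∀ i → T (Bc i) → T (D i) × T (supp x i) × T (supp y i)
        B-D i t = let u , s = T-∧⁻ {D i ∧ supp x i} t ; v , n = T-∧⁻ {D i} u in v , n , s
        X-D : ∀ i → T (X i) → T (D i) × T (supp x i) × ¬ T (supp y i)
        X-D i t = let u , s = T-∧⁻ {D i ∧ supp x i} t ; v , n = T-∧⁻ {D i} u in v , n , T-not⁻ s
        a+b≤c : a ℕ.+ b ℕ.≤ c
        a+b≤c = ℕ.≤-trans (cardinality-⊎ A Bc (λ i → D i ∧ supp y i)
          (λ i t → let p , _ , q = A-D i t in T-∧⁺ p q) (λ i t → let p , _ , q = B-D i t in T-∧⁺ p q)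
          λ i t u → proj₁ (proj₂ (A-D i t)) (proj₁ (proj₂ (B-D i u)))) (bound y)
        e+a≤c : e ℕ.+ a ℕ.≤ c
        e+a≤c = ℕ.≤-trans (cardinality-⊎ X A (λ i → D i ∧ supp (x ⊕ y) i)
          (λ i t → let p , q , r = X-D i t in T-∧⁺ p (⊕ˡ x y i q r)) (λ i t → let p , q , r = A-D i t in T-∧⁺ p (⊕ʳ x y i q r))
          λ i t u → proj₂ (proj₂ (X-D i t)) (proj₂ (proj₂ (A-D i u)))) (bound (x ⊕ y))
        a≤b : a ℕ.≤ b
        a≤b = ℕ.+-cancelˡ-≤ e a b (ℕ.≤-trans e+a≤c (ℕ.≤-trans heavy (ℕ.≤-reflexive
          (trans (count-split (λ i → D i ∧ supp x i) (supp y)) (ℕ.+-comm b e)))))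

      -- A word of full weight `c` covers at most `c` coordinates. What remains has weights at most
      -- half of `c`, and so contributes at most `c` by induction.
      union : ∀ c → Acc ℕ._<_ c → ∀ D → (∀ x → weight D x ℕ.≤ c) → cardinality (λ i → D i ∧ U i) ℕ.≤ 2 ℕ.* c
      union zero _ D bound = ℕ.≤-reflexive (count-false λ i t → let d , u = T-∧⁻ {D i} t ; x , s = used i u in
        ℕ.<⇒≱ (count-pos _ i (T-∧⁺ d s)) (bound x))
      -- Whether a word of weight `suc c` exists is not decidable for an arbitrary `W`; the goal is
      -- a decidable inequality, so the case distinction may be made under a double negation.
      union (suc c) (acc rs) D bound = decidable-stable (_ ℕ.≤? _) λ ¬goal → ¬¬-excluded-middle λ dec → ¬goal (by-cases dec heavy light)
        where
        Goal : Set
        Goal = cardinality (λ i → D i ∧ U i) ℕ.≤ 2 ℕ.* suc c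
        light : ¬ (∃[ x ] suc c ℕ.≤ weight D x) → Goal
        light none = ℕ.≤-trans (union c (rs (ℕ.n<1+n c)) D λ x → ℕ.s≤s⁻¹ (ℕ.≰⇒> λ le → none (x , le))) (ℕ.*-monoʳ-≤ 2 (ℕ.n≤1+n c))
        heavy : (∃[ x ] suc c ℕ.≤ weight D x) → Goal
        heavy (x , h) = ℕ.≤-trans (count-∪ (λ i → D i ∧ U i) (λ i → D i ∧ supp x i) (λ i → D′ i ∧ U i) cases)
            (ℕ.≤-trans (ℕ.+-mono-≤ (bound x) (ℕ.≤-trans (union e (rs (m/n<m (suc c) 2 (ℕ.s≤s (ℕ.s≤s ℕ.z≤n)))) D′ bound′) 2e≤))
              (ℕ.≤-reflexive (lem (suc c))))
          where
          D′ : Fin m → Bool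
          D′ i = D i ∧ not (supp x i)
          e : ℕ
          e = suc c ℕ./ 2
          lem : ∀ a → a ℕ.+ a ≡ 2 ℕ.* a
          lem = ℕsolver.solve-∀
          2e≤ : 2 ℕ.* e ℕ.≤ suc c
          2e≤ = ℕ.≤-trans (ℕ.≤-reflexive (ℕ.*-comm 2 e)) (m/n*n≤m (suc c) 2)
          bound′ : ∀ y → weight D′ y ℕ.≤ e
          bound′ y = ℕ.≤-trans (ℕ.≤-reflexive (sym (m*n/n≡m (weight D′ y) 2)))
            (/-monoˡ-≤ 2 (ℕ.≤-trans (ℕ.≤-reflexive (ℕ.*-comm (weight D′ y) 2)) (half D x bound h y)))
          cases : ∀ i → T (D i ∧ U i) → T (D i ∧ supp x i) ⊎ T (D′ i ∧ U i)
          cases i t = let d , u = T-∧⁻ {D i} t in by-cases (T? (supp x i)) (λ s → inj₁ (T-∧⁺ d s)) λ ¬s → inj₂ (T-∧⁺ (T-∧⁺ d (T-not ¬s)) u)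

    used-coordinates : ∀ c → (∀ x → cardinality (supp x) ℕ.≤ c) → cardinality U ℕ.≤ 2 ℕ.* c
    used-coordinates c bound = union c (<-wellFounded c) (λ _ → true) bound

  -- A basis adapted to the Cayley structure

  module Adapted {n d} (P : LatticePolytope n) (full : FullDimensional P) (degree : HasDegree P d) where

    open Cone P
    open Greedy P full degree

    private
      B : Fin m → Bool
      B = proj₁ exceptional

      B-nonneg : ∀ j i → ¬ T (B i) → 0ℚ ≤ dot (L₀ i) (g j)
      B-nonneg = proj₁ (proj₂ (proj₂ exceptional))

      B-unique : ∀ j {i k} → ¬ T (B i) → ¬ T (B k) → 0ℚ < dot (L₀ i) (g j) → 0ℚ < dot (L₀ k) (g j) → i ≡ k
      B-unique = proj₂ (proj₂ (proj₂ exceptional))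

      -- Outside B the vertices of S₀ are replaced by generators of maximal coordinate.
      record Rescaled (k : ℕ) : Set where
        field
          S       : Fin m → Fin N
          L       : Fin m → Vector ℚ m
          basis   : IsBasis (g ∘ S) L
          scale   : Vector ℚ m
          scale>0 : ∀ i → 0ℚ < scale i
          scaled  : ∀ i → ¬ T (B i) → ∀ x → dot (L i) x ≡ scale i * dot (L₀ i) x
          bounded : ∀ i → toℕ i ℕ.< k → ¬ T (B i) → ∀ j → dot (L i) (g j) ≤ 1ℚ

      start : Rescaled 0
      start = record { S = S₀ ; L = L₀ ; basis = basis₀ ; scale = λ _ → 1ℚ ; scale>0 = λ _ → 0<1
        ; scaled = λ i _ x → sym (ℚ.*-identityˡ (dot (L₀ i) x)) ; bounded = λ _ () }

      module Rescale {k} (k<m : k ℕ.< m) (r : Rescaled k) where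
        open Rescaled r

        i : Fin m
        i = fromℕ< k<m

        earlier : ∀ i′ → toℕ i′ ℕ.< suc k → i ≢ i′ → toℕ i′ ℕ.< k
        earlier i′ lt ne = ℕ.≤∧≢⇒< (ℕ.s≤s⁻¹ lt) λ e → ne (toℕ-injective (trans (toℕ-fromℕ< k<m) (sym e)))

        skip : T (B i) → Rescaled (suc k)
        skip t = record { S = S ; L = L ; basis = basis ; scale = scale ; scale>0 = scale>0 ; scaled = scaled
          ; bounded = λ i′ lt ¬b → bounded i′ (earlier i′ lt λ e → ¬b (subst (T ∘ B) e t)) ¬b }

        module _ (¬b : ¬ T (B i)) where

          max : ∃[ j ] ⊤ × (∀ j′ → ⊤ → dot (L₀ i) (g j′) ≤ dot (L₀ i) (g j))
          -- The order is reversed, so the minimum is a generator with the largest coordinate.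
          max = argmin {P = λ _ → ⊤} {_≼_ = λ j j′ → dot (L₀ i) (g j′) ≤ dot (L₀ i) (g j)} (λ _ → yes tt)
            (λ j j′ → ℚ.≤-total (dot (L₀ i) (g j′)) (dot (L₀ i) (g j))) (λ p q → ℚ.≤-trans q p) (zero , tt)

          top : Fin N
          top = proj₁ max

          top>0 : 0ℚ < dot (L₀ i) (g top)
          top>0 = ℚ.<-≤-trans (subst (0ℚ <_) (sym (trans (IsBasis.dual basis₀ i i) (δ-refl i))) 0<1) (proj₂ (proj₂ max) (S₀ i) tt)

          l : ℚ
          l = dot (L i) (g top)

          l>0 : 0ℚ < l
          l>0 = subst (0ℚ <_) (sym (scaled i ¬b (g top))) (0<* (scale>0 i) top>0)

          c : ℚ
          c = recip l

          c>0 : 0ℚ < c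
          c>0 = recip-pos l>0

          lc : l * c ≡ 1ℚ
          lc = recip-inverse (<⇒≢0 l>0)

          L′ : Fin m → Vector ℚ m
          L′ = pivot L i (g top) c

          -- No generator has two positive coordinates outside `B`, and `top` already has one at
          -- `i`. Hence the exchange at `i` leaves the other functionals outside `B` as they are,
          -- and the bounds achieved so far survive.
          zero-at-top : ∀ i′ → ¬ T (B i′) → i ≢ i′ → dot (L i′) (g top) ≡ 0ℚ
          zero-at-top i′ ¬b′ ne = trans (scaled i′ ¬b′ (g top)) (trans (cong (scale i′ *_)
            (by-cases (dot (L₀ i′) (g top) ℚ.≟ 0ℚ) (λ e → e) λ nz → ⊥-elim (ne (B-unique top ¬b ¬b′ top>0 (≤≢⇒< (B-nonneg top i′ ¬b′) nz)))))
            (ℚ.*-zeroʳ (scale i′)))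

          unchanged : ∀ i′ → ¬ T (B i′) → i ≢ i′ → ∀ x → dot (L′ i′) x ≡ dot (L i′) x
          unchanged i′ ¬b′ ne x = trans (dot-pivot-other L (g top) c x ne) (trans (cong (λ z → dot (L i′) x - z * c * dot (L i) x) (zero-at-top i′ ¬b′ ne))
            (lem (dot (L i′) x) c (dot (L i) x)))
            where
            lem : ∀ a c b → a - 0ℚ * c * b ≡ a
            lem = solve-∀ ℚring

          exchange : Rescaled (suc k)
          exchange = record
            { S       = S [ i ]≔ top
            ; L       = L′
            ; basis   = basis′
            ; scale   = scale [ i ]≔ (c * scale i)
            ; scale>0 = λ i′ → by-cases (i ≟ i′)
                (λ { refl → subst (0ℚ <_) (sym (≔-same scale i (c * scale i))) (0<* c>0 (scale>0 i)) })
                λ ne → subst (0ℚ <_) (sym (≔-other scale (c * scale i) ne)) (scale>0 i′)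
            ; scaled  = λ i′ ¬b′ x → by-cases (i ≟ i′)
                (λ { refl → trans (dot-pivot-same L i (g top) c x lc) (trans (cong (c *_) (scaled i ¬b x))
                       (trans (sym (ℚ.*-assoc c (scale i) (dot (L₀ i) x))) (cong (_* dot (L₀ i) x) (sym (≔-same scale i (c * scale i)))))) })
                λ ne → trans (unchanged i′ ¬b′ ne x) (trans (scaled i′ ¬b′ x) (cong (_* dot (L₀ i′) x) (sym (≔-other scale (c * scale i) ne))))
            ; bounded = λ i′ lt ¬b′ j → by-cases (i ≟ i′)
                (λ { refl → ℚ.≤-trans (ℚ.≤-reflexive (dot-pivot-same L i (g top) c (g j) lc)) (0≤-⇒≤ (subst (0ℚ ≤_) (eq j) (0≤* (ℚ.<⇒≤ c>0) (gap j)))) })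
                λ ne → ℚ.≤-trans (ℚ.≤-reflexive (unchanged i′ ¬b′ ne (g j))) (bounded i′ (earlier i′ lt ne) ¬b′ j)
            }
            where
            b : IsBasis ((g ∘ S) [ i ]≔ g top) L′
            b = pivot-basis i (g top) c lc basis
            at : ∀ k → g ((S [ i ]≔ top) k) ≗ ((g ∘ S) [ i ]≔ g top) k
            at k x = cong (λ v → v x) (≔-map g S i top k)
            basis′ : IsBasis (g ∘ (S [ i ]≔ top)) L′
            basis′ = record { dual = λ k k′ → trans (dot-congʳ (L′ k) (at k′)) (IsBasis.dual b k k′)
                            ; expand = λ x y → trans (IsBasis.expand b x y) (sum-cong λ k → cong (dot (L′ k) x *_) (sym (at k y))) }
            gap : ∀ j → 0ℚ ≤ l - dot (L i) (g j)
            gap j = subst (0ℚ ≤_) (trans (lem (scale i) (dot (L₀ i) (g top)) (dot (L₀ i) (g j))) (sym (cong₂ _-_ (scaled i ¬b (g top)) (scaled i ¬b (g j)))))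
              (0≤* (ℚ.<⇒≤ (scale>0 i)) (0≤- (proj₂ (proj₂ max) j tt)))
              where
              lem : ∀ a b c → a * (b - c) ≡ a * b - a * c
              lem = solve-∀ ℚring
            eq : ∀ j → c * (l - dot (L i) (g j)) ≡ 1ℚ - c * dot (L i) (g j)
            eq j = trans (lem c l (dot (L i) (g j))) (cong (_- c * dot (L i) (g j)) lc)
              where
              lem : ∀ c l x → c * (l - x) ≡ l * c - c * x
              lem = solve-∀ ℚring

        next : Rescaled (suc k)
        next = by-cases (T? (B i)) skip exchange

      rescaled : ∀ k → k ℕ.≤ m → Rescaled k
      rescaled zero    _  = start
      rescaled (suc k) le = Rescale.next le (rescaled k (ℕ.<⇒≤ le))

      opaque
        final : Rescaled m
        final = rescaled m ℕ.≤-refl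

    open Rescaled final public using (S; L; basis)

    private
      open Rescaled final using (scale; scale>0; scaled; bounded)

      -- The fractional part of a lattice point x in the basis S, and its
      -- complement, give two interior lattice points of the cone.
      module Fractional (x : Vector ℚ m) (x-lattice : Lattice x) where

        a : Vector ℚ m
        a i = frac (dot (L i) x)

        fractional : Fin m → Bool
        fractional i = not (does (Int? (dot (L i) x)))

        module Inner (w : Vector ℚ m) (w>0 : ∀ i → 0ℚ < w i) (lat : Lattice (combo w (g ∘ S))) where

          cone : InCone (combo w (g ∘ S))
          cone = cone-combo w (g ∘ S) (λ i → ℚ.<⇒≤ (w>0 i)) (cone-g ∘ S)

          -- Positive coordinates put the whole basis into the face of the point, whose height is
          -- `∑ w`.
          bound : int (ℤ.+ m) ≤ ∑ w + int (ℤ.+ d)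
          bound = ℚ.≤-trans (int-mono-≤ (ℤ.+≤+ (interior-lattice-point basis cone lat (proj₂ ht)
                    λ i → face-of-combo w (g ∘ S) (λ i → ℚ.<⇒≤ (w>0 i)) (cone-g ∘ S) i (w>0 i))))
                  (ℚ.≤-reflexive (trans (cong int (ℤ.pos-+ (proj₁ ht) d)) (trans (int-+ (ℤ.+ proj₁ ht) (ℤ.+ d))
                    (cong (_+ int (ℤ.+ d)) (trans (sym (proj₂ ht)) (sum-cong λ i → ℚ.*-identityʳ (w i)))))))
            where
            ht : ∃[ k ] combo w (g ∘ S) zero ≡ int (ℤ.+ k)
            ht = Int-nonneg (lat zero) (cone-height-nonneg cone)

        frac-lattice : Lattice (combo a (g ∘ S))
        frac-lattice l = Int-≡ (trans (cong (_- ∑ (λ i → (dot (L i) x - a i) * g (S i) l)) (IsBasis.expand basis x l)) (trans (sym (sum-minus (λ i → dot (L i) x * g (S i) l) (λ i → (dot (L i) x - a i) * g (S i) l)))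
            (sum-cong λ i → lem (dot (L i) x) (a i) (g (S i) l))))
          (Int-minus (x-lattice l) (Int-∑ (λ i → (dot (L i) x - a i) * g (S i) l) λ i → Int-* (frac-int (dot (L i) x)) (g-lattice (S i) l)))
          where
          lem : ∀ q a y → q * y - (q - a) * y ≡ a * y
          lem = solve-∀ ℚring

        -- Where the coordinate is integral the fractional part is 0, and adding 1 makes `w₁`
        -- positive. `w₂` is positive without correction, as fractional parts are below 1.
        w₁ w₂ : Vector ℚ m
        w₁ i = a i + indicator (not (fractional i))
        w₂ i = 1ℚ - a i

        w₁>0 : ∀ i → 0ℚ < w₁ i
        w₁>0 i = by-cases (Int? (dot (L i) x))
          (λ z → subst (0ℚ <_) (ℚ.+-comm (indicator (not (fractional i))) (a i)) (0<+ (subst (0ℚ <_) (sym (indicator-T (T-not λ t → T-not⁻ t (does-T (Int? (dot (L i) x)) z)))) 0<1) (0≤frac (dot (L i) x))))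
          λ nz → 0<+ (≤≢⇒< (0≤frac (dot (L i) x)) λ e → nz (frac≡0⇒Int (dot (L i) x) e)) (0≤indicator (not (fractional i)))

        w₁-lattice : Lattice (combo w₁ (g ∘ S))
        w₁-lattice l = Int-≡ (trans (sym (sum-+ (λ i → a i * g (S i) l) (λ i → indicator (not (fractional i)) * g (S i) l)))
            (sum-cong λ i → sym (ℚ.*-distribʳ-+ (g (S i) l) (a i) (indicator (not (fractional i))))))
          (Int-+ (frac-lattice l) (Int-∑ _ λ i → Int-* (Int-indicator (not (fractional i))) (g-lattice (S i) l)))

        w₂-lattice : Lattice (combo w₂ (g ∘ S))
        w₂-lattice l = Int-≡ (trans (sym (sum-minus (λ i → g (S i) l) (λ i → a i * g (S i) l))) (sum-cong λ i → lem (a i) (g (S i) l)))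
          (Int-minus (Int-∑ _ λ i → g-lattice (S i) l) (frac-lattice l))
          where
          lem : ∀ a y → y - a * y ≡ (1ℚ - a) * y
          lem = solve-∀ ℚring

        -- The heights of the two points add up to `m + z`, where `z` counts the integral
        -- coordinates, and each is at least `m - d`; so `m - z ≤ 2 d`.
        weight : cardinality fractional ℕ.≤ 2 ℕ.* d
        weight = ℕ.+-cancelʳ-≤ z _ _ (ℕ.≤-trans (ℕ.≤-reflexive (cardinality-¬ fractional)) (ℕ.+-cancelʳ-≤ m _ _ (ℤ.drop‿+≤+ (int-cancel-≤ total))))
          where
          z : ℕ
          z = cardinality (not ∘ fractional)
          int-ℕ+ : ∀ a b → int (ℤ.+ (a ℕ.+ b)) ≡ int (ℤ.+ a) + int (ℤ.+ b)
          int-ℕ+ a b = trans (cong int (ℤ.pos-+ a b)) (int-+ (ℤ.+ a) (ℤ.+ b))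
          lem : ∀ s z d m → s + z + d + (m - s + d) ≡ d + d + z + m
          lem = solve-∀ ℚring
          lem₂ : ∀ d → 2 ℕ.* d ≡ d ℕ.+ d
          lem₂ = ℕsolver.solve-∀
          Σw₁ : ∑ w₁ ≡ ∑ a + int (ℤ.+ z)
          Σw₁ = trans (sum-+ a (λ i → indicator (not (fractional i)))) (cong (∑ a +_) (∑-indicator (not ∘ fractional)))
          Σw₂ : ∑ w₂ ≡ int (ℤ.+ m) - ∑ a
          Σw₂ = trans (sum-minus (λ _ → 1ℚ) a) (cong (_- ∑ a) (∑-1 m))
          doubled : int (ℤ.+ m) + int (ℤ.+ m) ≤ int (ℤ.+ d) + int (ℤ.+ d) + int (ℤ.+ z) + int (ℤ.+ m)
          doubled = ℚ.≤-trans (ℚ.+-mono-≤ (Inner.bound w₁ w₁>0 w₁-lattice) (Inner.bound w₂ (λ i → 0<- (frac<1 (dot (L i) x))) w₂-lattice))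
            (ℚ.≤-reflexive (trans (cong₂ (λ y z → y + int (ℤ.+ d) + (z + int (ℤ.+ d))) Σw₁ Σw₂) (lem (∑ a) (int (ℤ.+ z)) (int (ℤ.+ d)) (int (ℤ.+ m)))))
          sum-of-ints : int (ℤ.+ (2 ℕ.* d ℕ.+ z ℕ.+ m)) ≡ int (ℤ.+ d) + int (ℤ.+ d) + int (ℤ.+ z) + int (ℤ.+ m)
          sum-of-ints = trans (int-ℕ+ (2 ℕ.* d ℕ.+ z) m) (cong (_+ int (ℤ.+ m)) (trans (int-ℕ+ (2 ℕ.* d) z) (cong (_+ int (ℤ.+ z))
            (trans (cong (λ e → int (ℤ.+ e)) (lem₂ d)) (int-ℕ+ d d)))))
          total : int (ℤ.+ (m ℕ.+ m)) ≤ int (ℤ.+ (2 ℕ.* d ℕ.+ z ℕ.+ m))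
          total = subst₂ _≤_ (sym (int-ℕ+ m m)) (sym sum-of-ints) doubled

      LatticeVector : Set
      LatticeVector = Σ (Vector ℚ m) Lattice

      _⊕_ : LatticeVector → LatticeVector → LatticeVector
      (x , p) ⊕ (y , q) = (λ l → x l + y l) , λ l → Int-+ (p l) (q l)

      supp : LatticeVector → Fin m → Bool
      supp (x , p) = Fractional.fractional x p

      supp⁺ : ∀ x i → ¬ Int (dot (L i) (proj₁ x)) → T (supp x i)
      supp⁺ x i ni = T-not λ t → ni (T-does (Int? (dot (L i) (proj₁ x))) t)

      supp⁻ : ∀ x i → T (supp x i) → ¬ Int (dot (L i) (proj₁ x))
      supp⁻ x i t p = T-not⁻ t (does-T (Int? (dot (L i) (proj₁ x))) p)

      ¬supp⁻ : ∀ x i → ¬ T (supp x i) → Int (dot (L i) (proj₁ x))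
      ¬supp⁻ x i ¬t = by-cases (Int? (dot (L i) (proj₁ x))) (λ p → p) λ ni → ⊥-elim (¬t (supp⁺ x i ni))

      unit : Fin m → LatticeVector
      unit l = δ l , Int-δ l

      integral? : ∀ i → Dec (∀ l → Int (L i l))
      integral? i = all? λ l → Int? (L i l)

      -- The entries of `L i` are its values on the unit vectors, so testing them decides
      -- integrality on the whole lattice.
      U : Fin m → Bool
      U i = not (does (integral? i))

      L-unit : ∀ i l → dot (L i) (δ l) ≡ L i l
      L-unit i l = trans (dot≡∑ (L i) (δ l)) (trans (sum-cong λ k → ℚ.*-comm (L i k) (δ l k)) (sum-δ l (L i)))

      U-used : ∀ i → T (U i) → ∃[ x ] T (supp x i)
      U-used i t = by-cases (any? λ l → ¬? (Int? (L i l)))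
        (λ (l , ni) → unit l , supp⁺ (unit l) i λ p → ni (Int-≡ (L-unit i l) p))
        λ none → ⊥-elim (T-not⁻ t (does-T (integral? i) λ l → by-cases (Int? (L i l)) (λ p → p) λ ni → ⊥-elim (none (l , ni))))

      -- The words are the lattice points. A nonintegral coordinate stays nonintegral when an
      -- integral one is added, which is the property of supports that the covering argument uses;
      -- the maximal weight is `2 d`.
      U-bound : cardinality U ℕ.≤ 2 ℕ.* (2 ℕ.* d)
      U-bound = Supports.used-coordinates supp _⊕_
        (λ x y i s ¬s → supp⁺ (x ⊕ y) i λ p → supp⁻ x i s (Int-≡ (sub (L i) (proj₁ x) (proj₁ y)) (Int-minus p (¬supp⁻ y i ¬s))))
        (λ x y i ¬s s → supp⁺ (x ⊕ y) i λ p → supp⁻ y i s (Int-≡ (sub′ (L i) (proj₁ x) (proj₁ y)) (Int-minus p (¬supp⁻ x i ¬s))))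
        U U-used (2 ℕ.* d) λ (x , p) → Fractional.weight x p
        where
        lem : ∀ a b → a + b - b ≡ a
        lem = solve-∀ ℚring
        lem′ : ∀ a b → a + b - a ≡ b
        lem′ = solve-∀ ℚring
        sub : ∀ f x y → dot f (λ l → x l + y l) - dot f y ≡ dot f x
        sub f x y = trans (cong (_- dot f y) (dot-+ f x y)) (lem (dot f x) (dot f y))
        sub′ : ∀ f x y → dot f (λ l → x l + y l) - dot f x ≡ dot f y
        sub′ f x y = trans (cong (_- dot f x) (dot-+ f x y)) (lem′ (dot f x) (dot f y))

    simple : Fin m → Bool
    simple i = not (B i) ∧ not (U i)

    simple-bound : m ℕ.≤ cardinality simple ℕ.+ 7 ℕ.* d
    simple-bound = ℕ.≤-trans (ℕ.≤-reflexive (sym (cardinality-¬ simple))) (ℕ.+-monoʳ-≤ (cardinality simple)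
        (ℕ.≤-trans (count-∪ (not ∘ simple) B U rest) (ℕ.≤-trans (ℕ.+-mono-≤ (proj₁ (proj₂ exceptional)) U-bound) (ℕ.≤-reflexive (lem d)))))
      where
      lem : ∀ d → 3 ℕ.* d ℕ.+ 2 ℕ.* (2 ℕ.* d) ≡ 7 ℕ.* d
      lem = ℕsolver.solve-∀
      rest : ∀ i → T (not (simple i)) → T (B i) ⊎ T (U i)
      rest i t = by-cases (T? (B i)) inj₁ λ ¬b → by-cases (T? (U i)) inj₂ λ ¬u → ⊥-elim (T-not⁻ t (T-∧⁺ (T-not ¬b) (T-not ¬u)))

    private
      simple-B : ∀ i → T (simple i) → ¬ T (B i)
      simple-B i t = T-not⁻ (proj₁ (T-∧⁻ {not (B i)} t))

    simple-integral : ∀ i → T (simple i) → ∀ l → Int (L i l)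
    simple-integral i t = by-cases (integral? i) (λ p → p) λ np → ⊥-elim (T-not⁻ (proj₂ (T-∧⁻ {not (B i)} t)) (T-not λ u → np (T-does (integral? i) u)))

    -- An integer in the unit interval: nonnegativity survives the positive rescaling, and the upper
    -- bound comes from the exchange for maximal generators.
    simple-01 : ∀ i → T (simple i) → ∀ j → dot (L i) (g j) ≡ 0ℚ ⊎ dot (L i) (g j) ≡ 1ℚ
    simple-01 i t j = Int-unit-interval (Int-dot (L i) (g j) (simple-integral i t) (g-lattice j))
      (subst (0ℚ ≤_) (sym (scaled i (simple-B i t) (g j))) (0≤* (ℚ.<⇒≤ (scale>0 i)) (B-nonneg j i (simple-B i t))))
      (bounded i (toℕ<n i) (simple-B i t) j)

    simple-unique : ∀ {i k} → T (simple i) → T (simple k) → ∀ j → dot (L i) (g j) ≡ 1ℚ → dot (L k) (g j) ≡ 1ℚ → i ≡ k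
    simple-unique {i} {k} t u j e f = B-unique j (simple-B i t) (simple-B k u) (coord>0 i (simple-B i t) e) (coord>0 k (simple-B k u) f)
      where
      coord>0 : ∀ i → ¬ T (B i) → dot (L i) (g j) ≡ 1ℚ → 0ℚ < dot (L₀ i) (g j)
      coord>0 i ¬b e = 0<-cancelˡ (scale>0 i) (subst (0ℚ <_) (trans (sym e) (scaled i ¬b (g j))) 0<1)

  -- Integral bases and elementary operations

  Int-≥1 : ∀ {p} → Int p → 0ℚ < p → 1ℚ ≤ p
  Int-≥1 {p} i 0<p with Int-nonneg i (ℚ.<⇒≤ 0<p)
  ... | zero  , e = ⊥-elim (<⇒≢0 0<p (trans e int-0))
  ... | suc k , e = subst (1ℚ ≤_) (sym (trans e (int-suc k))) (0≤-⇒≤ (subst (0ℚ ≤_) (lem (int (ℤ.+ k))) (0≤int k)))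
    where
    lem : ∀ a → a ≡ 1ℚ + a - 1ℚ
    lem = solve-∀ ℚring

  Int-∣∣ : ∀ {p} → Int p → Int ∣ p ∣
  Int-∣∣ {p} i with ℚ.∣p∣≡p∨∣p∣≡-p p
  ... | inj₁ e = Int-≡ (sym e) i
  ... | inj₂ e = Int-≡ (sym e) (Int-neg i)

  ∣∣-pos : ∀ p → p ≢ 0ℚ → 0ℚ < ∣ p ∣
  ∣∣-pos p ne = ≤≢⇒< (ℚ.0≤∣p∣ p) (ne ∘ ℚ.∣p∣≡0⇒p≡0 p)

  -- A step of the subtractive Euclidean algorithm: `c` is 1 or -1 according to whether the signs
  -- agree.
  reduce-∣∣ : ∀ x y → ∣ y ∣ ≤ ∣ x ∣ → ∃[ c ] Int c × ∣ x - c * y ∣ ≡ ∣ x ∣ - ∣ y ∣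
  reduce-∣∣ x y le with ℚ.∣p∣≡p∨∣p∣≡-p x | ℚ.∣p∣≡p∨∣p∣≡-p y
  ... | inj₁ e | inj₁ f = 1ℚ , Int-1 , trans (cong ∣_∣ (trans (lem x y) (sym (cong₂ _-_ e f)))) (ℚ.0≤p⇒∣p∣≡p (0≤- le))
    where
    lem : ∀ x y → x - 1ℚ * y ≡ x - y
    lem = solve-∀ ℚring
  ... | inj₁ e | inj₂ f = - 1ℚ , Int-neg Int-1 , trans (cong ∣_∣ (trans (lem x y) (sym (cong₂ _-_ e f)))) (ℚ.0≤p⇒∣p∣≡p (0≤- le))
    where
    lem : ∀ x y → x - - 1ℚ * y ≡ x - - y
    lem = solve-∀ ℚring
  ... | inj₂ e | inj₁ f = - 1ℚ , Int-neg Int-1 , trans (cong ∣_∣ (trans (lem x y) (cong -_ (sym (cong₂ _-_ e f)))))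
      (trans (ℚ.∣-p∣≡∣p∣ (∣ x ∣ - ∣ y ∣)) (ℚ.0≤p⇒∣p∣≡p (0≤- le)))
    where
    lem : ∀ x y → x - - 1ℚ * y ≡ - (- x - y)
    lem = solve-∀ ℚring
  ... | inj₂ e | inj₂ f = 1ℚ , Int-1 , trans (cong ∣_∣ (trans (lem x y) (cong -_ (sym (cong₂ _-_ e f)))))
      (trans (ℚ.∣-p∣≡∣p∣ (∣ x ∣ - ∣ y ∣)) (ℚ.0≤p⇒∣p∣≡p (0≤- le)))
    where
    lem : ∀ x y → x - 1ℚ * y ≡ - (- x - - y)
    lem = solve-∀ ℚring

  dot-δ : ∀ {n} (f : Vector ℚ n) l → dot f (δ l) ≡ f l
  dot-δ f l = trans (dot≡∑ f (δ l)) (trans (sum-cong λ k → ℚ.*-comm (f k) (δ l k)) (sum-δ l f))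

  -- A basis of the lattice ℤⁿ: integrality of both `u` and its dual expresses unimodularity without
  -- determinants.
  record IntegralBasis (n : ℕ) : Set where
    field
      u L        : Fin n → Vector ℚ n
      basis      : IsBasis u L
      u-integral : ∀ i l → Int (u i l)
      L-integral : ∀ i l → Int (L i l)

  module _ {n : ℕ} where

    open IntegralBasis

    -- Two integers with product 1 are units, so the exchange stays unimodular.
    exchange : (b : IntegralBasis n) (i : Fin n) (w : Vector ℚ n) (c : ℚ) → (∀ l → Int (w l)) → Int c → dot (L b i) w * c ≡ 1ℚ → IntegralBasis n
    exchange b i w c w-int c-int e = record
      { u          = u b [ i ]≔ w
      ; L          = pivot (L b) i w c
      ; basis      = pivot-basis i w c e (basis b)
      ; u-integral = λ k l → by-cases (i ≟ k)
          (λ { refl → Int-≡ (cong (λ v → v l) (sym (≔-same (u b) i w))) (w-int l) })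
          λ ne → Int-≡ (cong (λ v → v l) (sym (≔-other (u b) w ne))) (u-integral b k l)
      ; L-integral = λ k l → Int-minus (L-integral b k l) (Int-* (Int-* (Int-minus (Int-dot (L b k) w (L-integral b k) w-int) (Int-δ i k)) c-int) (L-integral b i l)) }

    exchange-L-other : ∀ (b : IntegralBasis n) (i : Fin n) w c k → i ≢ k → dot (L b k) w ≡ 0ℚ → pivot (L b) i w c k ≗ L b k
    exchange-L-other b i w c k ne z l = trans (cong₂ (λ y d → L b k l - (y - d) * c * L b i l) z (δ-≢ ne)) (lem (L b k l) c (L b i l))
      where
      lem : ∀ a c b → a - (0ℚ - 0ℚ) * c * b ≡ a
      lem = solve-∀ ℚring

    module Shear (b : IntegralBasis n) (i k : Fin n) (i≢k : i ≢ k) (c : ℚ) (c-int : Int c) where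

      w : Vector ℚ n
      w l = u b i l - c * u b k l

      dot-w : ∀ f → dot f w ≡ dot f (u b i) - c * dot f (u b k)
      dot-w f = trans (dot-minus f (u b i) (λ l → c * u b k l)) (cong (λ z → dot f (u b i) - z) (dot-* f c (u b k)))

      L-w : ∀ j → dot (L b j) w ≡ δ j i - c * δ j k
      L-w j = trans (dot-w (L b j)) (cong₂ (λ y z → y - c * z) (IsBasis.dual (basis b) j i) (IsBasis.dual (basis b) j k))

      shear : IntegralBasis n
      shear = exchange b i w 1ℚ (λ l → Int-minus (u-integral b i l) (Int-* c-int (u-integral b k l))) Int-1
        (trans (cong (_* 1ℚ) (trans (L-w i) (cong₂ (λ y z → y - c * z) (δ-refl i) (δ-≢ i≢k)))) (lem c))
        where
        lem : ∀ c → (1ℚ - c * 0ℚ) * 1ℚ ≡ 1ℚ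
        lem = solve-∀ ℚring

      u-at : ∀ f → dot f (u shear i) ≡ dot f (u b i) - c * dot f (u b k)
      u-at f = trans (dot-congʳ f λ l → cong (λ v → v l) (≔-same (u b) i w)) (dot-w f)

      u-other : ∀ j → i ≢ j → u shear j ≗ u b j
      u-other j ne l = cong (λ v → v l) (≔-other (u b) w ne)

      L-other : ∀ j → i ≢ j → k ≢ j → L shear j ≗ L b j
      L-other j ne ne′ = exchange-L-other b i w 1ℚ j ne
        (trans (L-w j) (trans (cong₂ (λ y z → y - c * z) (δ-≢ (ne ∘ sym)) (δ-≢ (ne′ ∘ sym))) (lem c)))
        where
        lem : ∀ c → 0ℚ - c * 0ℚ ≡ 0ℚ
        lem = solve-∀ ℚring

    module Clear (φ : Vector ℚ n) (φ-int : ∀ l → Int (φ l)) where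

      p : IntegralBasis n → Fin n → ℚ
      p b a = dot φ (u b a)

      p-int : ∀ b a → Int (p b a)
      p-int b a = Int-dot φ (u b a) φ-int (u-integral b a)

      -- Protects the vectors in the kernel of `φ` together with their dual functionals; in the
      -- completion below, all vectors placed earlier are of this kind.
      record Untouched (b b′ : IntegralBasis n) : Set where
        field
          same-u : ∀ a → p b a ≡ 0ℚ → u b′ a ≗ u b a
          same-L : ∀ a → p b a ≡ 0ℚ → L b′ a ≗ L b a

      open Untouched

      untouched-refl : ∀ {b} → Untouched b b
      untouched-refl = record { same-u = λ _ _ _ → refl ; same-L = λ _ _ _ → refl }

      untouched-trans : ∀ {b b′ b″} → Untouched b b′ → Untouched b′ b″ → Untouched b b″
      untouched-trans {b} {b′} r s = record
        { same-u = λ a z l → trans (same-u s a (still r a z) l) (same-u r a z l)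
        ; same-L = λ a z l → trans (same-L s a (still r a z) l) (same-L r a z l) }
        where
        still : Untouched b b′ → ∀ a → p b a ≡ 0ℚ → p b′ a ≡ 0ℚ
        still r a z = trans (dot-congʳ φ (same-u r a z)) z

      Sparse : IntegralBasis n → Set
      Sparse b = ∀ a a′ → p b a ≢ 0ℚ → p b a′ ≢ 0ℚ → a ≡ a′

      Pair : IntegralBasis n → Fin n → Fin n → Set
      Pair b a a′ = a ≢ a′ × p b a ≢ 0ℚ × p b a′ ≢ 0ℚ

      pair? : ∀ b → Dec (∃[ a ] ∃[ a′ ] Pair b a a′)
      pair? b = any? λ a → any? λ a′ → ¬? (a ≟ a′) ×-dec ¬? (p b a ℚ.≟ 0ℚ) ×-dec ¬? (p b a′ ℚ.≟ 0ℚ)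

      norm : IntegralBasis n → ℚ
      norm b = ∑ λ a → ∣ p b a ∣

      module Reduce (b : IntegralBasis n) (a a′ : Fin n) (pair : Pair b a a′) (le : ∣ p b a′ ∣ ≤ ∣ p b a ∣) where

        red : ∃[ c ] Int c × ∣ p b a - c * p b a′ ∣ ≡ ∣ p b a ∣ - ∣ p b a′ ∣
        red = reduce-∣∣ (p b a) (p b a′) le

        open Shear b a a′ (proj₁ pair) (proj₁ red) (proj₁ (proj₂ red)) public

        untouched : Untouched b shear
        untouched = record
          { same-u = λ x z → u-other x λ { refl → proj₁ (proj₂ pair) z }
          ; same-L = λ x z → L-other x (λ { refl → proj₁ (proj₂ pair) z }) (λ { refl → proj₂ (proj₂ pair) z }) }

        decrease : ∀ x → ∣ p shear x ∣ ≡ ∣ p b x ∣ - δ a x * ∣ p b a′ ∣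
        decrease x = by-cases (a ≟ x)
          (λ { refl → trans (cong ∣_∣ (u-at φ)) (trans (proj₂ (proj₂ red)) (trans (lem ∣ p b a ∣ ∣ p b a′ ∣) (cong (λ z → ∣ p b a ∣ - z * ∣ p b a′ ∣) (sym (δ-refl a))))) })
          λ ne → trans (cong ∣_∣ (dot-congʳ φ (u-other x ne))) (trans (lem₂ ∣ p b x ∣ ∣ p b a′ ∣) (cong (λ z → ∣ p b x ∣ - z * ∣ p b a′ ∣) (sym (δ-≢ ne))))
          where
          lem : ∀ x y → x - y ≡ x - 1ℚ * y
          lem = solve-∀ ℚring
          lem₂ : ∀ x y → x ≡ x - 0ℚ * y
          lem₂ = solve-∀ ℚring

        norm-shear : norm shear ≡ norm b - ∣ p b a′ ∣
        norm-shear = trans (sum-cong decrease) (trans (sum-minus (λ x → ∣ p b x ∣) (λ x → δ a x * ∣ p b a′ ∣)) (cong (λ z → norm b - z) (sum-δ a (λ _ → ∣ p b a′ ∣))))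

        norm-decrease : ∀ k → norm b < int (ℤ.+ suc k) → norm shear < int (ℤ.+ k)
        norm-decrease k lt = ℚ.≤-<-trans (ℚ.≤-reflexive norm-shear) (0<-⇒< (subst (0ℚ <_) (trans (cong (λ z → z - norm b + (∣ p b a′ ∣ - 1ℚ)) (int-suc k)) (lem (int (ℤ.+ k)) (norm b) ∣ p b a′ ∣))
            (0<+ (0<- lt) (0≤- (Int-≥1 (Int-∣∣ (p-int b a′)) (∣∣-pos (p b a′) (proj₂ (proj₂ pair))))))))
          where
          lem : ∀ k n p → 1ℚ + k - n + (p - 1ℚ) ≡ k - (n - p)
          lem = solve-∀ ℚring

      -- Each reduction lowers the norm by the absolute value of a nonzero integer, hence by at
      -- least 1; `k` is the fuel.
      clear : ∀ k b → norm b < int (ℤ.+ k) → ∃[ b′ ] Untouched b b′ × Sparse b′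
      clear zero    b lt = ⊥-elim (ℚ.<-irrefl refl (ℚ.<-≤-trans (subst (norm b <_) int-0 lt) (sum-nonneg λ a → ℚ.0≤∣p∣ (p b a))))
      clear (suc k) b lt = by-cases (pair? b)
        (λ (a , a′ , pr@(ne , x , y)) → [ (λ le → continue a a′ pr le) , (λ le → continue a′ a (ne ∘ sym , y , x) le) ]′ (ℚ.≤-total ∣ p b a′ ∣ ∣ p b a ∣))
        λ none → b , untouched-refl , λ a a′ x y → by-cases (a ≟ a′) (λ e → e) λ ne → ⊥-elim (none (a , a′ , ne , x , y))
        where
        continue : ∀ a a′ → Pair b a a′ → ∣ p b a′ ∣ ≤ ∣ p b a ∣ → ∃[ b′ ] Untouched b b′ × Sparse b′
        continue a a′ pr le = let b′ , r , s = clear k (Reduce.shear b a a′ pr le) (Reduce.norm-decrease b a a′ pr le k lt)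
          in b′ , untouched-trans (Reduce.untouched b a a′ pr le) r , s

  -- Completion of a partial lattice basis by Euclid's algorithm

  module Complete {q s : ℕ} (Φ R : Fin s → Vector ℚ (q ℕ.+ s)) (Φ-int : ∀ k l → Int (Φ k l)) (R-int : ∀ k l → Int (R k l))
    (dual : ∀ k k′ → dot (Φ k) (R k′) ≡ δ k k′) where

    open IntegralBasis

    private
      n : ℕ
      n = q ℕ.+ s

      record Extends (K : ℕ) (b : IntegralBasis n) : Set where
        field
          u≗R : ∀ k → toℕ k ℕ.< K → u b (q ↑ʳ k) ≗ R k
          L≗Φ : ∀ k → toℕ k ℕ.< K → L b (q ↑ʳ k) ≗ Φ k

      standard : IntegralBasis n
      standard = record { u = δ ; L = δ ; basis = standard-basis ; u-integral = Int-δ ; L-integral = Int-δ }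

      module Extend {K} (K<s : K ℕ.< s) (b₀ : IntegralBasis n) (ext : Extends K b₀) where

        k₀ : Fin s
        k₀ = fromℕ< K<s

        t : Fin n
        t = q ↑ʳ k₀

        φ r : Vector ℚ n
        φ = Φ k₀
        r = R k₀

        open Clear φ (Φ-int k₀)
        open Untouched

        before : ∀ k → toℕ k ℕ.< K → k₀ ≢ k
        before k lt refl = ℕ.<-irrefl (toℕ-fromℕ< K<s) lt

        processed-zero : ∀ {b} → Extends K b → ∀ k → toℕ k ℕ.< K → p b (q ↑ʳ k) ≡ 0ℚ
        processed-zero e k lt = trans (dot-congʳ φ (Extends.u≗R e k lt)) (trans (dual k₀ k) (δ-≢ (before k lt)))

        carry : ∀ {b b′} → Extends K b → Untouched b b′ → Extends K b′
        carry e w = record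
          { u≗R = λ k lt l → trans (same-u w (q ↑ʳ k) (processed-zero e k lt) l) (Extends.u≗R e k lt l)
          ; L≗Φ = λ k lt l → trans (same-L w (q ↑ʳ k) (processed-zero e k lt) l) (Extends.L≗Φ e k lt l) }

        carry-shear : ∀ {b} → Extends K b → ∀ i k (ne : i ≢ k) c ci → (∀ j → toℕ j ℕ.< K → i ≢ q ↑ʳ j) → (∀ j → toℕ j ℕ.< K → k ≢ q ↑ʳ j) →
          Extends K (Shear.shear b i k ne c ci)
        carry-shear {b} e i k ne c ci fi fk = record
          { u≗R = λ j lt l → trans (Shear.u-other b i k ne c ci (q ↑ʳ j) (fi j lt) l) (Extends.u≗R e j lt l)
          ; L≗Φ = λ j lt l → trans (Shear.L-other b i k ne c ci (q ↑ʳ j) (fi j lt) (fk j lt) l) (Extends.L≗Φ e j lt l) }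

        t-free : ∀ j → toℕ j ℕ.< K → t ≢ q ↑ʳ j
        t-free j lt e = before j lt (↑ʳ-injective q k₀ j e)

        free : ∀ {b} → Extends K b → ∀ a → p b a ≢ 0ℚ → ∀ j → toℕ j ℕ.< K → a ≢ q ↑ʳ j
        free e a nz j lt refl = nz (processed-zero e j lt)

        Concentrated : IntegralBasis n → Set
        Concentrated b = ∀ a → a ≢ t → p b a ≡ 0ℚ

        φ-coords : ∀ b x → dot φ x ≡ ∑ λ a → dot (L b a) x * p b a
        φ-coords b x = trans (dot-congʳ φ (IsBasis.expand (basis b) x)) (dot-combo φ (λ a → dot (L b a) x) (u b))

        nonzero : ∀ b → ∃[ a ] p b a ≢ 0ℚ
        nonzero b = by-cases (any? λ a → ¬? (p b a ℚ.≟ 0ℚ)) (λ x → x) λ none → ⊥-elim (ℚ.1≢0 (trans (sym (trans (dual k₀ k₀) (δ-refl k₀)))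
          (trans (φ-coords b r) (sum-zero λ a → trans (cong (dot (L b a) r *_) (by-cases (p b a ℚ.≟ 0ℚ) (λ e → e) λ ne → ⊥-elim (none (a , ne)))) (ℚ.*-zeroʳ (dot (L b a) r))))))

        -- Two shears move the only nonzero value of `φ` to position `t`: `u a` is added to `u t`,
        -- and the new `u t` is subtracted from `u a`. Neither position has been filled before.
        concentrate : ∀ b → Extends K b → Sparse b → ∃[ b′ ] Extends K b′ × Concentrated b′
        concentrate b e sp = by-cases (a ≟ t) here′ there′
          where
          a : Fin n
          a = proj₁ (nonzero b)
          pa≢0 : p b a ≢ 0ℚ
          pa≢0 = proj₂ (nonzero b)
          only : ∀ x → x ≢ a → p b x ≡ 0ℚ
          only x ne = by-cases (p b x ℚ.≟ 0ℚ) (λ z → z) λ nz → ⊥-elim (ne (sp x a nz pa≢0))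
          here′ : a ≡ t → ∃[ b′ ] Extends K b′ × Concentrated b′
          here′ eq = b , e , λ x ne → only x λ e′ → ne (trans e′ eq)
          there′ : a ≢ t → ∃[ b′ ] Extends K b′ × Concentrated b′
          there′ ne = b₂ , e₂ , conc
            where
            b₁ b₂ : IntegralBasis n
            b₁ = Shear.shear b t a (ne ∘ sym) (- 1ℚ) (Int-neg Int-1)
            e₁ : Extends K b₁
            e₁ = carry-shear e t a (ne ∘ sym) (- 1ℚ) (Int-neg Int-1) t-free (free e a pa≢0)
            b₂ = Shear.shear b₁ a t ne 1ℚ Int-1
            e₂ : Extends K b₂
            e₂ = carry-shear e₁ a t ne 1ℚ Int-1 (free e a pa≢0) t-free
            p₁a : p b₁ a ≡ p b a
            p₁a = dot-congʳ φ (Shear.u-other b t a (ne ∘ sym) (- 1ℚ) (Int-neg Int-1) a (ne ∘ sym))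
            p₁t : p b₁ t ≡ p b a
            p₁t = trans (Shear.u-at b t a (ne ∘ sym) (- 1ℚ) (Int-neg Int-1) φ) (trans (cong (λ z → z - - 1ℚ * p b a) (only t (ne ∘ sym))) (lem (p b a)))
              where
              lem : ∀ x → 0ℚ - - 1ℚ * x ≡ x
              lem = solve-∀ ℚring
            conc : Concentrated b₂
            conc x x≢t = by-cases (a ≟ x)
              (λ { refl → trans (Shear.u-at b₁ a t ne 1ℚ Int-1 φ) (trans (cong₂ (λ y z → y - 1ℚ * z) p₁a p₁t) (lem (p b a))) })
              λ a≢x → trans (dot-congʳ φ (Shear.u-other b₁ a t ne 1ℚ Int-1 x a≢x))
                (trans (dot-congʳ φ (Shear.u-other b t a (ne ∘ sym) (- 1ℚ) (Int-neg Int-1) x (x≢t ∘ sym))) (only x (a≢x ∘ sym)))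
              where
              lem : ∀ x → x - 1ℚ * x ≡ 0ℚ
              lem = solve-∀ ℚring

        module Finish (b : IntegralBasis n) (e : Extends K b) (conc : Concentrated b) where

          φ-at : ∀ x → dot φ x ≡ dot (L b t) x * p b t
          φ-at x = trans (φ-coords b x) (trans (sum-cong λ a → by-cases (t ≟ a)
              (λ { refl → sym (trans (cong (_* (dot (L b t) x * p b t)) (δ-refl t)) (ℚ.*-identityˡ (dot (L b t) x * p b t))) })
              λ ne → trans (cong (dot (L b a) x *_) (conc a (ne ∘ sym))) (trans (ℚ.*-zeroʳ (dot (L b a) x)) (sym (trans (cong (_* (dot (L b t) x * p b t)) (δ-≢ ne)) (ℚ.*-zeroˡ (dot (L b t) x * p b t))))))
            (sum-δ t (λ _ → dot (L b t) x * p b t)))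

          -- `φ` has become `p b t` times `L b t`, and it is 1 on `r`. So `p b t` is an integral
          -- inverse of the coordinate of `r` at `t`, and once `u t` is exchanged for `r` the dual
          -- functional there is `φ` itself.
          unit : dot (L b t) r * p b t ≡ 1ℚ
          unit = trans (sym (φ-at r)) (trans (dual k₀ k₀) (δ-refl k₀))

          b′ : IntegralBasis n
          b′ = exchange b t r (p b t) (R-int k₀) (p-int b t) unit

          processed : ∀ k → toℕ k ℕ.< suc K → k₀ ≢ k → toℕ k ℕ.< K
          processed k lt ne = ℕ.≤∧≢⇒< (ℕ.s≤s⁻¹ lt) λ eq → ne (toℕ-injective (trans (toℕ-fromℕ< K<s) (sym eq)))

          result : Extends (suc K) b′
          result = record
            { u≗R = λ k lt l → by-cases (k₀ ≟ k)
                (λ { refl → cong (λ v → v l) (≔-same (u b) t r) })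
                λ ne → trans (cong (λ v → v l) (≔-other (u b) r (ne ∘ ↑ʳ-injective q k₀ k))) (Extends.u≗R e k (processed k lt ne) l)
            ; L≗Φ = λ k lt l → by-cases (k₀ ≟ k)
                (λ { refl → trans (sym (dot-δ (L b′ t) l)) (trans (dot-pivot-same (L b) t r (p b t) (δ l) unit)
                       (trans (ℚ.*-comm (p b t) (dot (L b t) (δ l))) (trans (sym (φ-at (δ l))) (dot-δ φ l)))) })
                -- Functionals placed earlier survive because they vanish on `r`, by the duality of
                -- `Φ` and `R`.
                λ ne → trans (exchange-L-other b t r (p b t) (q ↑ʳ k) (ne ∘ ↑ʳ-injective q k₀ k)
                    (trans (dot-congˡ r (Extends.L≗Φ e k (processed k lt ne))) (trans (dual k k₀) (δ-≢ (ne ∘ sym)))) l)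
                  (Extends.L≗Φ e k (processed k lt ne) l) }

        next : ∃ (Extends (suc K))
        next = let k , lt        = archimedean (norm b₀)
                   b₁ , w , sp   = clear k b₀ lt
                   b₂ , e , conc = concentrate b₁ (carry ext w) sp
               in Finish.b′ b₂ e conc , Finish.result b₂ e conc

      extends : ∀ K → K ℕ.≤ s → ∃ (Extends K)
      extends zero    _  = standard , record { u≗R = λ _ () ; L≗Φ = λ _ () }
      extends (suc K) le = let b , e = extends K (ℕ.<⇒≤ le) in Extend.next le b e

    opaque
      complete : Σ (IntegralBasis n) λ b → ∀ k → L b (q ↑ʳ k) ≗ Φ k
      complete = let b , e = extends s ℕ.≤-refl in b , λ k → Extends.L≗Φ e k (toℕ<n k)

  -- Affine maps and concatenated coordinates

  open AffineMap using (matrix; translation; apply)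

  opaque
    unfolding ∑ dot

    dot-suc : ∀ {n} (f x : Vector ℚ (suc n)) → dot f x ≡ f zero * x zero + dot (f ∘ suc) (x ∘ suc)
    dot-suc f x = refl

  apply≡ : ∀ {m n} (f : AffineMap m n) x i → apply f x i ≡ dot (matrix f i) x + translation f i
  apply≡ f x i = cong (_+ translation f i) (sym (trans (dot≡∑ (matrix f i) x) (∑≡sum (λ j → matrix f i j * x j))))

  apply-cong : ∀ {m n} (f : AffineMap m n) {x y} → x ≗ y → apply f x ≗ apply f y
  apply-cong f {x} {y} e i = trans (apply≡ f x i) (trans (cong (_+ translation f i) (dot-congʳ (matrix f i) e)) (sym (apply≡ f y i)))

  combines-apply : ∀ {N m n} (f : AffineMap m n) (p : Fin N → Point m) {a x} → Combines p a x → Combines (apply f ∘ p) a (apply f x)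
  combines-apply f p {a} {x} (t , c) = t , λ i → begin
    apply f x i                                                          ≡⟨ apply≡ f x i ⟩
    dot (matrix f i) x + translation f i                                 ≡⟨ cong₂ _+_ (trans (dot-congʳ (matrix f i) c) (dot-combo (matrix f i) a p)) (one-times i) ⟩
    ∑ (λ j → a j * dot (matrix f i) (p j)) + ∑ (λ j → a j * translation f i)  ≡⟨ sym (sum-+ (λ j → a j * dot (matrix f i) (p j)) (λ j → a j * translation f i)) ⟩
    ∑ (λ j → a j * dot (matrix f i) (p j) + a j * translation f i)       ≡⟨ (sum-cong λ j → trans (sym (ℚ.*-distribˡ-+ (a j) (dot (matrix f i) (p j)) (translation f i))) (cong (a j *_) (sym (apply≡ f (p j) i)))) ⟩
    combo a (apply f ∘ p) i                                              ∎
    where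
    open ≡-Reasoning
    one-times : ∀ i → translation f i ≡ ∑ (λ j → a j * translation f i)
    one-times i = sym (trans (sum-*ʳ (translation f i) a) (trans (cong (_* translation f i) t) (ℚ.*-identityˡ (translation f i))))

  ++-unique : ∀ {q s} (f : Vector ℚ (q ℕ.+ s)) (xs : Vector ℚ q) (ys : Vector ℚ s) →
    (∀ i → f (i ↑ˡ s) ≡ xs i) → (∀ k → f (q ↑ʳ k) ≡ ys k) → f ≗ (xs Vector.++ ys)
  ++-unique {q} {s} f xs ys e₁ e₂ i with splitAt q i in eq
  ... | inj₁ a = trans (cong f (sym (splitAt⁻¹-↑ˡ eq))) (e₁ a)
  ... | inj₂ b = trans (cong f (sym (splitAt⁻¹-↑ʳ eq))) (e₂ b)

  Int-++ : ∀ {q s} {xs : Vector ℚ q} {ys : Vector ℚ s} → (∀ i → Int (xs i)) → (∀ k → Int (ys k)) → ∀ i → Int ((xs Vector.++ ys) i)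
  Int-++ {q} p r i with splitAt q i
  ... | inj₁ a = p a
  ... | inj₂ k = r k

  combo-++ : ∀ {N q s} (b : Vector ℚ N) (p : Fin N → Vector ℚ q) (y : Vector ℚ s) {x} → Combines p b x →
    Combines (λ j → p j Vector.++ y) b (x Vector.++ y)
  combo-++ {q = q} {s} b p y {x} (t , c) = t , λ i → sym (++-unique (combo b (λ j → p j Vector.++ y)) x y
    (λ i → trans (sum-cong λ j → cong (b j *_) (lookup-++ˡ (p j) y i)) (sym (c i)))
    (λ k → trans (sum-cong λ j → cong (b j *_) (lookup-++ʳ (p j) y k)) (trans (sum-*ʳ (y k) b) (trans (cong (_* y k) t) (ℚ.*-identityˡ (y k))))) i)

  Int-ι : ∀ {n} {x : Vector ℚ n} → (∀ i → Int (x i)) → ∃[ v ] x ≗ ι v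
  Int-ι p = (λ i → proj₁ (p i)) , λ i → trans (proj₂ (p i)) (int≡/1 _)

  ι-Int : ∀ {n} (v : LatticePoint n) i → Int (ι v i)
  ι-Int v i = v i , sym (int≡/1 (v i))

  -- The affine isomorphism with linear part L and its inverse

  module IntegralIsomorphism {n} (b : IntegralBasis n) (τ : Vector ℚ n) (τ-int : ∀ i → Int (τ i)) where

    open IntegralBasis b

    to from : AffineMap n n
    to = record { matrix = L ; translation = τ }
    from = record { matrix = λ i j → u j i ; translation = λ i → - ∑ λ j → u j i * τ j }

    from-combo : ∀ y → apply from y ≗ combo (λ j → y j - τ j) u
    from-combo y i = trans (apply≡ from y i) (trans (cong (_- ∑ (λ j → u j i * τ j)) (dot≡∑ (λ j → u j i) y))
      (trans (sym (sum-minus (λ j → u j i * y j) (λ j → u j i * τ j))) (sum-cong λ j → lem (u j i) (y j) (τ j))))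
      where
      lem : ∀ u y t → u * y - u * t ≡ (y - t) * u
      lem = solve-∀ ℚring

    isomorphism : AffineIsomorphism n n
    isomorphism = record
      { to = to
      ; from = from
      ; from∘to = λ x i → trans (from-combo (apply to x) i) (trans (sum-cong λ j → cong (_* u j i) (trans (cong (_- τ j) (apply≡ to x j)) (lem (dot (L j) x) (τ j))))
          (sym (IsBasis.expand basis x i)))
      ; to∘from = λ y i → trans (apply≡ to (apply from y) i) (trans (cong (_+ τ i) (trans (dot-congʳ (L i) (from-combo y)) (trans (dot-combo (L i) (λ j → y j - τ j) u)
          (trans (sum-cong λ j → cong ((y j - τ j) *_) (trans (IsBasis.dual basis i j) (δ-sym i j))) (sum-δʳ i (λ j → y j - τ j)))))) (lem₂ (y i) (τ i)))
      }
      where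
      lem : ∀ a b → a + b - b ≡ a
      lem = solve-∀ ℚring
      lem₂ : ∀ a b → a - b + b ≡ a
      lem₂ = solve-∀ ℚring

    to-integral : ∀ {x} → (∀ i → Int (x i)) → ∀ i → Int (apply to x i)
    to-integral {x} p i = Int-≡ (sym (apply≡ to x i)) (Int-+ (Int-dot (L i) x (L-integral i) p) (τ-int i))

    from-integral : ∀ {y} → (∀ i → Int (y i)) → ∀ i → Int (apply from y i)
    from-integral {y} p i = Int-≡ (sym (from-combo y i)) (Int-∑ _ λ j → Int-* (Int-minus (p j) (τ-int j)) (u-integral j i))

    onto : MapsLatticeOnto to
    onto = (λ v → Int-ι (to-integral (ι-Int v))) ,
      λ w → let v , e = Int-ι (from-integral (ι-Int w)) in
        v , λ i → trans (apply-cong to (λ j → sym (e j)) i) (AffineIsomorphism.to∘from isomorphism (ι w) i)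

  -- The Cayley decomposition

  module Build {q s d} (P : LatticePolytope (q ℕ.+ s)) (full : FullDimensional P) (degree : HasDegree P d) where

    open Cone P
    open Adapted P full degree

    module _ (e : Fin s → Fin m) (e-simple : ∀ k → T (simple (e k))) (e-injective : ∀ {k k′} → e k ≡ e k′ → k ≡ k′)
      (rest : Fin m) (rest≢ : ∀ k → e k ≢ rest) where

      private
        -- At height 1 a coordinate functional is an affine function: `Φ` is its linear part, its
        -- entry at `zero` the constant. The edges from the vertex `S rest`, which will lie over the
        -- apex 0, to the vertices `S (e k)` are lattice vectors dual to `Φ`.
        Φ R : Fin s → Vector ℚ (q ℕ.+ s)
        Φ k l = L (e k) (suc l)
        R k l = g (S (e k)) (suc l) - g (S rest) (suc l)

        φ : Fin s → Fin N → ℚ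
        φ k j = dot (L (e k)) (g j)

        φ≡ : ∀ k j → φ k j ≡ dot (Φ k) (gens P j) + L (e k) zero
        φ≡ k j = trans (dot-suc (L (e k)) (g j)) (lem (L (e k) zero) (dot (Φ k) (gens P j)))
          where
          lem : ∀ a b → a * 1ℚ + b ≡ b + a
          lem = solve-∀ ℚring

        φ-S : ∀ k i → φ k (S i) ≡ δ (e k) i
        φ-S k i = IsBasis.dual basis (e k) i

        φ-e : ∀ k k′ → φ k (S (e k′)) ≡ δ k k′
        φ-e k k′ = trans (φ-S k (e k′)) (by-cases (k ≟ k′) (λ { refl → trans (δ-refl (e k)) (sym (δ-refl k)) })
          λ ne → trans (δ-≢ (ne ∘ e-injective)) (sym (δ-≢ ne)))

        φ-rest : ∀ k → φ k (S rest) ≡ 0ℚ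
        φ-rest k = trans (φ-S k rest) (δ-≢ (rest≢ k))

        dual : ∀ k k′ → dot (Φ k) (R k′) ≡ δ k k′
        dual k k′ = trans (dot-minus (Φ k) (gens P (S (e k′))) (gens P (S rest))) (trans (lem (dot (Φ k) (gens P (S (e k′)))) (dot (Φ k) (gens P (S rest))) (L (e k) zero))
          (trans (cong₂ _-_ (trans (sym (φ≡ k (S (e k′)))) (φ-e k k′)) (trans (sym (φ≡ k (S rest))) (φ-rest k))) (lem₂ (δ k k′))))
          where
          lem : ∀ a b c → a - b ≡ a + c - (b + c)
          lem = solve-∀ ℚring
          lem₂ : ∀ a → a - 0ℚ ≡ a
          lem₂ = solve-∀ ℚring

        completion : Σ (IntegralBasis (q ℕ.+ s)) λ b → ∀ k → IntegralBasis.L b (q ↑ʳ k) ≗ Φ k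
        completion = Complete.complete Φ R (λ k l → simple-integral (e k) (e-simple k) (suc l))
          (λ k l → Int-minus (g-lattice (S (e k)) (suc l)) (g-lattice (S rest) (suc l))) dual

        offset : Vector ℚ s
        offset k = L (e k) zero

        τ : Vector ℚ (q ℕ.+ s)
        τ = (λ _ → 0ℚ) Vector.++ offset

        τ-int : ∀ i → Int (τ i)
        τ-int = Int-++ {q} (λ _ → Int-0) (λ k → simple-integral (e k) (e-simple k) zero)

      open IntegralIsomorphism (proj₁ completion) τ τ-int

      private
        image : Fin N → Point (q ℕ.+ s)
        image j = apply to (gens P j)

        image-ʳ : ∀ j k → image j (q ↑ʳ k) ≡ φ k j
        image-ʳ j k = trans (apply≡ to (gens P j) (q ↑ʳ k)) (trans (cong₂ _+_ (dot-congˡ (gens P j) (proj₂ completion k)) (lookup-++ʳ (λ (_ : Fin q) → 0ℚ) offset k)) (sym (φ≡ k j)))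

        Ones : Fin N → Set
        Ones j = ∃[ k ] φ k j ≡ 1ℚ

        classify : ∀ {j} → Dec (Ones j) → Fin (suc s)
        classify (yes (k , _)) = suc k
        classify (no _)        = zero

        class : Fin N → Fin (suc s)
        class j = classify (any? λ k → φ k j ℚ.≟ 1ℚ)

        -- The simple coordinates of a generator are 0 or 1 and at most one of them is 1, so
        -- together they form an apex.
        class-apex : ∀ j k → φ k j ≡ apex (class j) k
        class-apex j k = at (any? λ k → φ k j ℚ.≟ 1ℚ)
          where
          not-one : ¬ (φ k j ≡ 1ℚ) → φ k j ≡ 0ℚ
          not-one n = [ (λ z → z) , (λ o → ⊥-elim (n o)) ]′ (simple-01 (e k) (e-simple k) j)
          at : (D : Dec (Ones j)) → φ k j ≡ apex (classify D) k
          at (no none)      = not-one λ o → none (k , o)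
          at (yes (k′ , o)) = by-cases (k′ ≟ k) (λ { refl → trans o (sym (δ-refl k)) })
            λ ne → trans (not-one λ o′ → ne (e-injective (simple-unique (e-simple k′) (e-simple k) j o o′))) (sym (δ-≢ ne))

        apex-injective : ∀ (c c′ : Fin (suc s)) → apex c ≗ apex c′ → c ≡ c′
        apex-injective zero    zero     _ = refl
        apex-injective zero    (suc k)  p = ⊥-elim (ℚ.1≢0 (trans (sym (δ-refl k)) (sym (p k))))
        apex-injective (suc k) zero     p = ⊥-elim (ℚ.1≢0 (trans (sym (δ-refl k)) (p k)))
        apex-injective (suc k) (suc k′) p = by-cases (k ≟ k′) (cong suc) λ ne → ⊥-elim (ℚ.1≢0 (trans (sym (δ-refl k)) (trans (p k) (δ-≢ (ne ∘ sym)))))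

        representative : Fin (suc s) → Fin N
        representative zero    = S rest
        representative (suc k) = S (e k)

        class-representative : ∀ c → class (representative c) ≡ c
        class-representative c = apex-injective (class (representative c)) c λ k → trans (sym (class-apex (representative c) k)) (at c k)
          where
          at : ∀ c k → φ k (representative c) ≡ apex c k
          at zero     k = φ-rest k
          at (suc k′) k = trans (φ-e k k′) (δ-sym k k′)

        choose : ∀ {c j} → Dec (class j ≡ c) → Fin N
        choose {c} {j} (yes _) = j
        choose {c} {j} (no _)  = representative c

        -- Generating families may repeat points, so every factor can be indexed by all of `Fin N`:
        -- generators of other classes are replaced by a representative, whose existence also shows
        -- that no factor is empty.
        retract : Fin (suc s) → Fin N → Fin N
        retract c j = choose {c} {j} (class j ≟ c)

        class-retract : ∀ c j → class (retract c j) ≡ c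
        class-retract c j = at (class j ≟ c)
          where
          at : (D : Dec (class j ≡ c)) → class (choose {c} {j} D) ≡ c
          at (yes p) = p
          at (no _)  = class-representative c

        retract-self : ∀ j → retract (class j) j ≡ j
        retract-self j = at (class j ≟ class j)
          where
          at : (D : Dec (class j ≡ class j)) → choose {class j} {j} D ≡ j
          at (yes _) = refl
          at (no ne) = ⊥-elim (ne refl)

        factor-vertex : ∀ c (j : Fin N) i → Int (image (retract c j) (i ↑ˡ s))
        factor-vertex c j i = to-integral (λ _ → Int-int _) (i ↑ˡ s)

        factor : Fin (suc s) → LatticePolytope q
        factor c = record { pred-size = LatticePolytope.pred-size P ; generators = λ j i → proj₁ (factor-vertex c j i) }

        image-retract : ∀ c j → image (retract c j) ≗ (gens (factor c) j Vector.++ apex c)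
        image-retract c j = ++-unique (image (retract c j)) (gens (factor c) j) (apex c) (λ i → proj₂ (factor-vertex c j i))
          λ k → trans (image-ʳ (retract c j) k) (trans (class-apex (retract c j) k) (cong (λ c → apex c k) (class-retract c j)))

        forwards : ∀ x → body P x → cayleySum factor (apply to x)
        forwards x x∈ = let a , a≥0 , c = body⇒convex P x∈ in
          convex⇒hull image (λ j → class j , gens (factor (class j)) j , convex⇒body (factor (class j)) (δ j , 0≤δ j , combines-δ (gens (factor (class j))) j) ,
              λ i → trans (cong (λ k → image k i) (sym (retract-self j))) (image-retract (class j) j i))
            (a , a≥0 , combines-apply to (gens P) c)

        -- Every generating point of the Cayley sum is a convex combination of images of generators
        -- of `P`, and the inverse affine map carries such combinations back.
        backwards : ∀ x → cayleySum factor (apply to x) → body P x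
        backwards x h = let a , a≥0 , t , c = hull⇒convex image h (λ { z (c , y , y∈ , e) → part c y z (body⇒convex (factor c) y∈) e }) in
            convex⇒body P (a , a≥0 , combines-cong (gens P) (AffineIsomorphism.from∘to isomorphism x)
              (t , λ l → trans (proj₂ (combines-apply from image (t , c)) l) (sum-cong λ j → cong (a j *_) (AffineIsomorphism.from∘to isomorphism (gens P j) l))))
          where
          part : ∀ c y z → ConvexCombines (gens (factor c)) y → z ≗ (y Vector.++ apex c) → ConvexCombines image z
          part c y z (b , b≥0 , cb) e = combo b (λ j → δ (retract c j)) , combo-nonneg b (λ j → δ (retract c j)) b≥0 (λ j → 0≤δ (retract c j)) ,
            combines-compose image b (λ j → δ (retract c j)) (λ j → gens (factor c) j Vector.++ apex c)
              (λ j → combines-cong image (image-retract c j) (combines-δ image (retract c j)))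
              (combines-cong (λ j → gens (factor c) j Vector.++ apex c) (λ l → sym (e l)) (combo-++ b (gens (factor c)) (apex c) cb))

      decomposition : CayleyDecomposition P q
      decomposition = record
        { s          = s
        ; factors    = factor
        ; iso        = isomorphism
        ; lattice    = onto
        ; identifies = λ x → mk⇔ (forwards x) (backwards x) }

  -- Choice of the indices and the numerical bound

  Decomposes : ∀ {n} → LatticePolytope n → ℕ → Set
  Decomposes P d = ∃[ q ] (q ≡ 0 ⊎ q ℕ.< 7 ℕ.* d) × CayleyDecomposition P q

  -- One index outside the list `e` has to serve as `rest`. If some index is not simple, it does,
  -- and `q + 1 = n + 1 - |simple| ≤ 7 d`. If all are simple, index `zero` is given up and `q = 0`.
  decompose : ∀ {n d} (P : LatticePolytope n) → FullDimensional P → HasDegree P d → Decomposes P d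
  decompose {n} {d} P full degree = by-cases (any? λ i → T? (not (simple i))) some none
    where
    open Adapted P full degree using (simple; simple-bound)
    build : ∀ {n} q s → n ≡ q ℕ.+ s → (P : LatticePolytope n) (full : FullDimensional P) (degree : HasDegree P d) →
      (e : Fin s → Fin (suc n)) → (∀ k → T (Adapted.simple P full degree (e k))) → (∀ {k k′} → e k ≡ e k′ → k ≡ k′) →
      (rest : Fin (suc n)) → (∀ k → e k ≢ rest) → CayleyDecomposition P q
    build q s refl P full degree = Build.decomposition P full degree
    none : ¬ (∃[ i ] T (not (simple i))) → Decomposes P d
    none ¬p = 0 , inj₁ refl , build 0 n refl P full degree suc (λ k → by-cases (T? (simple (suc k))) (λ t → t) λ ¬t → ⊥-elim (¬p (suc k , T-not ¬t)))
      suc-injective zero λ _ ()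
    some : ∃[ i ] T (not (simple i)) → Decomposes P d
    some (i , t) = n ℕ.∸ c , inj₂ q< , build (n ℕ.∸ c) c (sym (ℕ.m∸n+n≡m c≤n)) P full degree (select simple) (select-T simple)
        (λ {k} {k′} → select-injective simple k k′) i λ k e → T-not⁻ t (subst (λ i → T (simple i)) e (select-T simple k))
      where
      c : ℕ
      c = cardinality simple
      total : c ℕ.+ cardinality (not ∘ simple) ≡ suc n
      total = cardinality-¬ simple
      c≤n : c ℕ.≤ n
      c≤n = ℕ.s≤s⁻¹ (ℕ.≤-trans (ℕ.≤-reflexive (ℕ.+-comm 1 c)) (ℕ.≤-trans (ℕ.+-monoʳ-≤ c (count-pos (not ∘ simple) i t)) (ℕ.≤-reflexive total)))
      q< : n ℕ.∸ c ℕ.< 7 ℕ.* d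
      q< = ℕ.+-cancelˡ-≤ c (suc (n ℕ.∸ c)) (7 ℕ.* d) (ℕ.≤-trans (ℕ.≤-reflexive (trans (ℕ.+-suc c (n ℕ.∸ c)) (cong suc (ℕ.m+[n∸m]≡n c≤n)))) simple-bound)

  -- For positive `d`, `2 (7 d - 1) ≤ d² + 19 d - 4` amounts to `2 ≤ d² + 5 d`. For `d = 0`
  -- truncated subtraction makes the bound 0, and only `q = 0` is possible.
  7d≤bound : ∀ q d → q ≡ 0 ⊎ q ℕ.< 7 ℕ.* d → q ℕ.≤ (d ℕ.^ 2 ℕ.+ 19 ℕ.* d ℕ.∸ 4) ℕ./ 2
  7d≤bound q d       (inj₁ refl) = ℕ.z≤n
  7d≤bound q (suc d) (inj₂ lt) = ℕ.≤-trans (ℕ.≤-reflexive (sym (m*n/n≡m q 2))) (/-monoˡ-≤ 2 (ℕ.m+n≤o⇒m≤o∸n (q ℕ.* 2)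
    (ℕ.≤-trans (ℕ.≤-reflexive (lem q)) (ℕ.≤-trans (ℕ.+-monoˡ-≤ 2 (ℕ.*-monoʳ-≤ 2 lt))
      (ℕ.≤-trans (ℕ.m≤m+n (2 ℕ.* (7 ℕ.* suc d) ℕ.+ 2) (d ℕ.* d ℕ.+ 7 ℕ.* d ℕ.+ 4)) (ℕ.≤-reflexive (lem₂ d)))))))
    where
    lem : ∀ q → q ℕ.* 2 ℕ.+ 4 ≡ 2 ℕ.* (1 ℕ.+ q) ℕ.+ 2
    lem = ℕsolver.solve-∀
    lem₂ : ∀ d → 2 ℕ.* (7 ℕ.* (1 ℕ.+ d)) ℕ.+ 2 ℕ.+ (d ℕ.* d ℕ.+ 7 ℕ.* d ℕ.+ 4) ≡ (1 ℕ.+ d) ℕ.* ((1 ℕ.+ d) ℕ.* 1) ℕ.+ 19 ℕ.* (1 ℕ.+ d)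
    lem₂ = ℕsolver.solve-∀

open import Data.Nat.Base using (ℕ; _+_; _*_; _∸_; _^_; _/_; _≤_)
open import Data.Product.Base using (∃-syntax; _×_; _,_)
open import Defs using (LatticePolytope; FullDimensional; HasDegree; CayleyDecomposition)
open Development using (decompose; 7d≤bound)

theorem1p2 : ∀ (n d : ℕ) (P : LatticePolytope n) →
    FullDimensional P →
    HasDegree P d →
    ∃[ q ] q ≤ (d ^ 2 + 19 * d ∸ 4) / 2 × CayleyDecomposition P q
theorem1p2 n d P full degree =
  let q , bound , decomposition = decompose P full degree in q , 7d≤bound q d bound , decomposition
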